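{- Assume $\mathrm{char}\,F>0$. For each $n\geq 1$ there exists a morphism \[ \mu_n : \mathscr{F}^{\mathrm{univ}}[\pi^n]\times\cdots\times \mathscr{F}^{\mathrm{univ}}[\pi^n] \to \mathrm{LT}[\pi^n]\otimes\mathcal{A} \] ($h$ factors) of group schemes over $\mathcal{A}=\hat{\mathcal{O}}_{F^{\mathrm{nr}}}[[u_1,\dots,u_{h-1}]]$ which is $\mathcal{O}_F$-multilinear and alternating, and which satisfies: (1) for $n\geq 2$, $\mu_n([\pi]_{\mathscr{F}^{\mathrm{univ}}}(X_1),\dots,[\pi]_{\mathscr{F}^{\mathrm{univ}}}(X_h))=\mu_{n-1}(X_1,\dots,X_h)$; (2) if $X_1,\dots,X_h$ are sections of $\mathscr{F}^{\mathrm{univ}}[\pi^n]$ over an $\mathcal{A}$-algebra $R$ which form a Drinfeld level $\pi^n$ structure, then $\mu_n(X_1,\dots,X_h)$ is a Drinfeld level $\pi^n$ structure for $\mathrm{LT}[\pi^n]\otimes R$.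
   Context: $F=k((\pi))$ with $k=\mathbf{F}_q$, $\mathcal{O}_F=k[[\pi]]$, $h\ge1$, $\hat{\mathcal{O}}_{F^{\mathrm{nr}}}=\bar k[[\pi]]$. $\mathscr{F}^{\mathrm{univ}}$ is the formal $\mathcal{O}_F$-module over $\mathcal{A}$ with addition $X+Y$, $[\zeta](X)=\zeta X$ for $\zeta\in k$, and $[\pi](X)=\pi X+u_1X^q+\dots+u_{h-1}X^{q^{h-1}}+X^{q^h}$ (this is the universal deformation of the height-$h$ module over $\bar k$ with $[\pi](X)=X^{q^h}$). $\mathrm{LT}$ is the formal $\mathcal{O}_F$-module over $\hat{\mathcal{O}}_{F^{\mathrm{nr}}}$ with addition $X+Y$, $[\zeta](X)=\zeta X$ ($\zeta\in k$), $[\pi](X)=\pi X+(-1)^{h-1}X^q$. For such a module $G$ with $[\pi^n]_G$ a polynomial, $G[\pi^n]$ is the group scheme of roots of $[\pi^n]_G$; its sections over $R$ are $s\in R$ with $[\pi^n]_G(s)=0$, and $a\in\mathcal{O}_F/\pi^n$ acts via $[a]_G$. Sections $X_1,\dots,X_h$ of $G[\pi^n]$ ($G$ of height $h$) form a Drinfeld level $\pi^n$ structure if the $\mathcal{O}_F$-module map $\phi:(\pi^{ -n}\mathcal{O}_F/\mathcal{O}_F)^h\to R$ sending the $i$-th standard basis vector $\pi^{ -n}e_i$ to $X_i$ satisfies: $\prod_{y\in(\pi^{ -1}\mathcal{O}_F/\mathcal{O}_F)^h}(T-\phi(y))$ divides $[\pi]_G(T)$ in $R[[T]]$; for $\mathrm{LT}$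 (height one) the same with $h=1$.
   Formalization: Clause (1), which as printed forces μ_1=0, is corrected to μ_{n-1}([π]X_1,…,[π]X_h)=[π]_LT(μ_n(X_1,…,X_h)); clause (2), false for arbitrary R, is proved for R separated for the (π,u_1,…,u_{h-1})-adic topology, and for every R with divisibility in R[T] instead of R[[T]]. -}

module Defs where

open import Algebra.Bundles using (CommutativeRing; Semiring)
import Algebra.Definitions.RawSemiring as RawSemiringOps
open import Algebra.Morphism.Structures using (module RingMorphisms)
open import Algebra.Morphism.Construct.Composition using (isRingHomomorphism)
import Algebra.Properties.CommutativeMonoid.Sum as Sum
import Algebra.Properties.Ring as RingProperties
open import Data.Fin.Base using (Fin; toℕ; finToFun)
open import Data.Nat.Base as ℕ using (ℕ; zero; suc; _∸_)
open import Data.Product.Base using (Σ-syntax; ∃-syntax; _×_; _,_; proj₁)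
open import Data.Unit.Polymorphic.Base using (⊤)
open import Data.Vec.Base using (Vec; []; _∷_; _∷ʳ_; lookup; tabulate; map)
open import Data.Vec.Functional using (Vector; updateAt)
open import Function.Base using (_∘_; const)
open import Function.Bundles using (Inverse)
open import Level using (Level; _⊔_) renaming (suc to lsuc)
open import Relation.Binary.PropositionalEquality.Core using (_≢_)
open import Relation.Binary.PropositionalEquality.Properties using (setoid)
open import Relation.Nullary.Negation.Core using (¬_)

private
  variable
    a b c d e f : Level

------------------------------------------------------------------------
-- Rings

module RingOps (R : CommutativeRing a b) where
  open CommutativeRing R public
  open RawSemiringOps (Semiring.rawSemiring semiring) public using (_^_; _∣_)
  open Sum +-commutativeMonoid public using (sum-syntax; sum⁺-syntax)

  infixl 10 prod-syntax
  prod-syntax : ∀ n → Vector Carrier n → Carrier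
  prod-syntax n = Sum.sum *-commutativeMonoid

  syntax prod-syntax n (λ i → x) = ∏[ i < n ] x

  -- The monic polynomial xⁿ + pₙ₋₁xⁿ⁻¹ + ⋯ + p₀.
  monic : ∀ {n} → Vector Carrier n → Carrier → Carrier
  monic {n} p x = x ^ n + ∑[ i < n ] (p i * x ^ toℕ i)

IsRingHom : (R : CommutativeRing a b) (S : CommutativeRing c d) →
            (CommutativeRing.Carrier R → CommutativeRing.Carrier S) → Set (a ⊔ b ⊔ d)
IsRingHom R S = RingMorphisms.IsRingHomomorphism (CommutativeRing.rawRing R) (CommutativeRing.rawRing S)

record IsField (R : CommutativeRing a b) : Set (a ⊔ b) where
  open CommutativeRing R
  field
    1≉0     : ¬ (1# ≈ 0#)
    inverse : ∀ x → ¬ (x ≈ 0#) → ∃[ y ] x * y ≈ 1#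

record FiniteField (q : ℕ) (a b : Level) : Set (lsuc (a ⊔ b)) where
  field
    ring     : CommutativeRing a b
    isField  : IsField ring
    elements : Inverse (setoid (Fin q)) (CommutativeRing.setoid ring)

record AlgebraicClosure (k : CommutativeRing a b) (c d : Level) : Set (a ⊔ b ⊔ lsuc (c ⊔ d)) where
  field
    ring    : CommutativeRing c d
    isField : IsField ring
    ι       : CommutativeRing.Carrier k → CommutativeRing.Carrier ring
    ι-isHom : IsRingHom k ring ι

  open RingOps ring

  field
    closed    : ∀ {n} (p : Vector Carrier (suc n)) → ∃[ x ] monic p x ≈ 0#
    algebraic : ∀ x → ∃[ n ] Σ[ p ∈ Vector (CommutativeRing.Carrier k) (suc n) ] monic (ι ∘ p) x ≈ 0#

------------------------------------------------------------------------
-- The power series ring R[[T]]; a series is its sequence of coefficients.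

module PowerSeries (R : CommutativeRing a b) where
  open RingOps R
  open RingProperties ring using (-0#≈0#)
  open import Relation.Binary.Reasoning.Setoid (CommutativeRing.setoid R)
  private module +Sum = Sum +-commutativeMonoid

  Series : Set a
  Series = ℕ → Carrier

  infix 4 _≋_
  _≋_ : Series → Series → Set b
  f ≋ g = ∀ n → f n ≈ g n

  infixl 7 _⊛_
  _⊛_ : Series → Series → Series
  (f ⊛ g) n = ∑[ i ≤ n ] (f (toℕ i) * g (n ∸ toℕ i))

  monomial : ℕ → Carrier → Series
  monomial zero    x zero    = x
  monomial zero    x (suc j) = 0#
  monomial (suc n) x zero    = 0#
  monomial (suc n) x (suc j) = monomial n x j

  constant : Carrier → Series
  constant = monomial 0

  T : Series
  T = monomial 1 1#

  private
    middle : ∀ w x y z → (w + x) + (y + z) ≈ (w + y) + (x + z)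
    middle w x y z = begin
      (w + x) + (y + z) ≈⟨ +-assoc w x (y + z) ⟩
      w + (x + (y + z)) ≈⟨ +-congˡ (+-assoc x y z) ⟨
      w + ((x + y) + z) ≈⟨ +-congˡ (+-congʳ (+-comm x y)) ⟩
      w + ((y + x) + z) ≈⟨ +-congˡ (+-assoc y x z) ⟩
      w + (y + (x + z)) ≈⟨ +-assoc w y (x + z) ⟨
      (w + y) + (x + z) ∎

    ⊛-cong : ∀ {f f′ g g′} → f ≋ f′ → g ≋ g′ → f ⊛ g ≋ f′ ⊛ g′
    ⊛-cong p r n = +Sum.sum-cong-≋ {suc n} λ i → *-cong (p (toℕ i)) (r (n ∸ toℕ i))

    ⊛-zeroˡ : ∀ g → (λ _ → 0#) ⊛ g ≋ (λ _ → 0#)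
    ⊛-zeroˡ g zero    = trans (+-identityʳ _) (zeroˡ _)
    ⊛-zeroˡ g (suc n) = trans (+-cong (zeroˡ _) (⊛-zeroˡ g n)) (+-identityʳ 0#)

    ⊛-distribʳ : ∀ h f g → (λ n → f n + g n) ⊛ h ≋ (λ n → (f ⊛ h) n + (g ⊛ h) n)
    ⊛-distribʳ h f g zero    = begin
      (f 0 + g 0) * h 0 + 0#                 ≈⟨ +-cong (distribʳ _ _ _) (sym (+-identityʳ 0#)) ⟩
      (f 0 * h 0 + g 0 * h 0) + (0# + 0#)    ≈⟨ middle _ _ _ _ ⟩
      (f 0 * h 0 + 0#) + (g 0 * h 0 + 0#)    ∎
    ⊛-distribʳ h f g (suc n) =
      trans (+-cong (distribʳ _ _ _) (⊛-distribʳ h (f ∘ suc) (g ∘ suc) n)) (middle _ _ _ _)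

    ⊛-last : ∀ f g n → (f ⊛ g) (suc n) ≈ (f ⊛ (g ∘ suc)) n + f (suc n) * g 0
    ⊛-last f g zero    = begin
      f 0 * g 1 + (f 1 * g 0 + 0#)   ≈⟨ +-congˡ (+-identityʳ _) ⟩
      f 0 * g 1 + f 1 * g 0          ≈⟨ +-congʳ (+-identityʳ _) ⟨
      (f 0 * g 1 + 0#) + f 1 * g 0   ∎
    ⊛-last f g (suc n) =
      trans (+-congˡ (⊛-last (f ∘ suc) g n)) (sym (+-assoc _ _ _))

    ⊛-comm : ∀ f g → f ⊛ g ≋ g ⊛ f
    ⊛-comm f g zero    = +-congʳ (*-comm _ _)
    ⊛-comm f g (suc n) = begin
      f 0 * g (suc n) + ((f ∘ suc) ⊛ g) n   ≈⟨ +-cong (*-comm _ _) (⊛-comm (f ∘ suc) g n) ⟩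
      g (suc n) * f 0 + (g ⊛ (f ∘ suc)) n   ≈⟨ +-comm _ _ ⟩
      (g ⊛ (f ∘ suc)) n + g (suc n) * f 0   ≈⟨ ⊛-last g f n ⟨
      (g ⊛ f) (suc n)                       ∎

    ⊛-scaleˡ : ∀ x f g n → ((λ j → x * f j) ⊛ g) n ≈ x * (f ⊛ g) n
    ⊛-scaleˡ x f g zero    = begin
      (x * f 0) * g 0 + 0#       ≈⟨ +-cong (*-assoc _ _ _) (sym (zeroʳ x)) ⟩
      x * (f 0 * g 0) + x * 0#   ≈⟨ distribˡ _ _ _ ⟨
      x * (f 0 * g 0 + 0#)       ∎
    ⊛-scaleˡ x f g (suc n) =
      trans (+-cong (*-assoc _ _ _) (⊛-scaleˡ x (f ∘ suc) g n)) (sym (distribˡ _ _ _))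

    ⊛-assoc : ∀ f g h → (f ⊛ g) ⊛ h ≋ f ⊛ (g ⊛ h)
    ⊛-assoc f g h zero    = +-congʳ (begin
      (f 0 * g 0 + 0#) * h 0   ≈⟨ *-congʳ (+-identityʳ _) ⟩
      (f 0 * g 0) * h 0        ≈⟨ *-assoc _ _ _ ⟩
      f 0 * (g 0 * h 0)        ≈⟨ *-congˡ (+-identityʳ _) ⟨
      f 0 * (g 0 * h 0 + 0#)   ∎)
    ⊛-assoc f g h (suc n) = begin
      (f 0 * g 0 + 0#) * h (suc n) + (((λ j → f 0 * g (suc j) + ((f ∘ suc) ⊛ g) j)) ⊛ h) n
        ≈⟨ +-cong (trans (*-congʳ (+-identityʳ _)) (*-assoc _ _ _))
                  (⊛-distribʳ h (λ j → f 0 * g (suc j)) ((f ∘ suc) ⊛ g) n) ⟩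
      f 0 * (g 0 * h (suc n)) + (((λ j → f 0 * g (suc j)) ⊛ h) n + (((f ∘ suc) ⊛ g) ⊛ h) n)
        ≈⟨ +-assoc _ _ _ ⟨
      (f 0 * (g 0 * h (suc n)) + ((λ j → f 0 * g (suc j)) ⊛ h) n) + (((f ∘ suc) ⊛ g) ⊛ h) n
        ≈⟨ +-cong (trans (+-congˡ (⊛-scaleˡ (f 0) (g ∘ suc) h n)) (sym (distribˡ _ _ _)))
                  (⊛-assoc (f ∘ suc) g h n) ⟩
      f 0 * (g ⊛ h) (suc n) + ((f ∘ suc) ⊛ (g ⊛ h)) n ∎

    ⊛-identityˡ : ∀ g → constant 1# ⊛ g ≋ g
    ⊛-identityˡ g zero    = trans (+-identityʳ _) (*-identityˡ _)
    ⊛-identityˡ g (suc n) = trans (+-cong (*-identityˡ _) (⊛-zeroˡ g n)) (+-identityʳ _)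

  powerSeries : CommutativeRing a b
  powerSeries = record
    { Carrier = Series
    ; _≈_     = _≋_
    ; _+_     = λ f g n → f n + g n
    ; _*_     = _⊛_
    ; -_      = λ f n → - f n
    ; 0#      = λ _ → 0#
    ; 1#      = constant 1#
    ; isCommutativeRing = record
      { isRing = record
        { +-isAbelianGroup = record
          { isGroup = record
            { isMonoid = record
              { isSemigroup = record
                { isMagma = record
                  { isEquivalence = record
                    { refl  = λ _ → refl
                    ; sym   = λ p n → sym (p n)
                    ; trans = λ p r n → trans (p n) (r n)
                    }
                  ; ∙-cong = λ p r n → +-cong (p n) (r n)
                  }
                ; assoc = λ f g h n → +-assoc (f n) (g n) (h n)
                }
              ; identity = (λ f n → +-identityˡ (f n)) , (λ f n → +-identityʳ (f n))
              }
            ; inverse = (λ f n → -‿inverseˡ (f n)) , (λ f n → -‿inverseʳ (f n))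
            ; ⁻¹-cong = λ p n → -‿cong (p n)
            }
          ; comm = λ f g n → +-comm (f n) (g n)
          }
        ; *-cong     = ⊛-cong
        ; *-assoc    = ⊛-assoc
        ; *-identity = ⊛-identityˡ , λ f n → trans (⊛-comm f (constant 1#) n) (⊛-identityˡ f n)
        ; distrib    = (λ h f g n → trans (⊛-comm h (λ j → f j + g j) n)
                         (trans (⊛-distribʳ h f g n) (+-cong (⊛-comm f h n) (⊛-comm g h n))))
                     , ⊛-distribʳ
        }
      ; *-comm = ⊛-comm
      }
    }

  private
    constant-* : ∀ x y → constant (x * y) ≋ constant x ⊛ constant y
    constant-* x y zero    = sym (+-identityʳ _)
    constant-* x y (suc n) =
      sym (trans (+-cong (zeroʳ x) (⊛-zeroˡ (constant y) n)) (+-identityʳ 0#))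

    constant-cong : ∀ {x y} → x ≈ y → constant x ≋ constant y
    constant-cong p zero    = p
    constant-cong p (suc n) = refl

    constant-+ : ∀ x y → constant (x + y) ≋ (λ n → constant x n + constant y n)
    constant-+ x y zero    = refl
    constant-+ x y (suc n) = sym (+-identityʳ 0#)

    constant-- : ∀ x → constant (- x) ≋ (λ n → - constant x n)
    constant-- x zero    = refl
    constant-- x (suc n) = sym -0#≈0#

    constant-0 : constant 0# ≋ (λ _ → 0#)
    constant-0 zero    = refl
    constant-0 (suc n) = refl

  constant-isHom : IsRingHom R powerSeries constant
  constant-isHom = record
    { isSemiringHomomorphism = record
      { isNearSemiringHomomorphism = record
        { +-isMonoidHomomorphism = record
          { isMagmaHomomorphism = record
            { isRelHomomorphism = record { cong = constant-cong }
            ; homo = constant-+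
            }
          ; ε-homo = constant-0
          }
        ; *-homo = constant-*
        }
      ; 1#-homo = λ _ → refl
      }
    ; -‿homo = constant--
    }

open PowerSeries using (powerSeries)

-- R[[u₁,…,uₘ]], built one variable at a time.
multiPowerSeries : CommutativeRing a b → ℕ → CommutativeRing a b
multiPowerSeries R zero    = R
multiPowerSeries R (suc m) = powerSeries (multiPowerSeries R m)

multiConstant : (R : CommutativeRing a b) (m : ℕ) →
                CommutativeRing.Carrier R → CommutativeRing.Carrier (multiPowerSeries R m)
multiConstant R zero    x = x
multiConstant R (suc m) x = PowerSeries.constant (multiPowerSeries R m) (multiConstant R m x)

variables : (R : CommutativeRing a b) (m : ℕ) → Vec (CommutativeRing.Carrier (multiPowerSeries R m)) m
variables R zero    = []
variables R (suc m) = map (PowerSeries.constant (multiPowerSeries R m)) (variables R m)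
                        ∷ʳ PowerSeries.T (multiPowerSeries R m)

------------------------------------------------------------------------
-- Commutative algebras

record Algebra (A : CommutativeRing a b) (c d : Level) : Set (a ⊔ b ⊔ lsuc (c ⊔ d)) where
  field
    ring  : CommutativeRing c d
    ⟦_⟧   : CommutativeRing.Carrier A → CommutativeRing.Carrier ring
    isHom : IsRingHom A ring ⟦_⟧

  open RingOps ring public hiding (ring)

record AlgebraHom {A : CommutativeRing a b} (R S : Algebra A c d) : Set (a ⊔ c ⊔ d) where
  private
    module R = Algebra R
    module S = Algebra S
  field
    to       : R.Carrier → S.Carrier
    isHom    : IsRingHom R.ring S.ring to
    commutes : ∀ x → to R.⟦ x ⟧ S.≈ S.⟦ x ⟧

infix 30 _[[T]]
_[[T]] : {A : CommutativeRing a b} → Algebra A c d → Algebra A c d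
R [[T]] = record
  { ring  = powerSeries R.ring
  ; ⟦_⟧   = constant ∘ R.⟦_⟧
  ; isHom = isRingHomomorphism (CommutativeRing.trans (powerSeries R.ring)) R.isHom constant-isHom
  }
  where
  module R = Algebra R
  open PowerSeries R.ring using (constant; constant-isHom)

------------------------------------------------------------------------
-- The formal modules, with height h = m + 1, and the algebras over
-- 𝒜 at which their sections are taken in universe levels e and f.

module LubinTate {q : ℕ} (k : FiniteField q a b) (k̄ : AlgebraicClosure (FiniteField.ring k) c d)
                 (m : ℕ) (e f : Level) where

  private
    module k = FiniteField k
    module k̄ = AlgebraicClosure k̄

  h : ℕ
  h = suc m

  𝒪F : CommutativeRing a b
  𝒪F = powerSeries k.ring

  𝒪̂nr : CommutativeRing c d
  𝒪̂nr = powerSeries k̄.ring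

  𝒜 : CommutativeRing c d
  𝒜 = multiPowerSeries 𝒪̂nr m

  embed : CommutativeRing.Carrier 𝒪̂nr → CommutativeRing.Carrier 𝒜
  embed = multiConstant 𝒪̂nr m

  πnr : CommutativeRing.Carrier 𝒪̂nr
  πnr = PowerSeries.T k̄.ring

  u : Vec (CommutativeRing.Carrier 𝒜) m
  u = variables 𝒪̂nr m

  -- A formal 𝒪F-module with addition X + Y, [ζ](X) = ζX for ζ ∈ k, and
  -- [π](X) = Σⱼ cⱼ X^(qʲ), the sum running over 0 ≤ j ≤ height.
  record FormalModule (B : CommutativeRing c d) : Set c where
    field
      height       : ℕ
      coefficients : Vec (CommutativeRing.Carrier B) (suc height)

  ℱuniv : FormalModule 𝒜
  ℱuniv = record
    { height       = h
    ; coefficients = embed πnr ∷ (u ∷ʳ CommutativeRing.1# 𝒜)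
    }

  LT : FormalModule 𝒪̂nr
  LT = record
    { height       = 1
    ; coefficients = πnr ∷ ((- 1#) ^ m) ∷ []
    }
    where open RingOps 𝒪̂nr

  infix 30 _⊗𝒜
  _⊗𝒜 : FormalModule 𝒪̂nr → FormalModule 𝒜
  G ⊗𝒜 = record { height = height ; coefficients = map embed coefficients }
    where open FormalModule G

  ----------------------------------------------------------------------
  -- Torsion sections over an 𝒜-algebra

  module Sections (G : FormalModule 𝒜) (R : Algebra 𝒜 e f) where
    open FormalModule G
    open Algebra R

    [π] : Carrier → Carrier
    [π] x = ∑[ j ≤ height ] (⟦ lookup coefficients j ⟧ * x ^ (q ℕ.^ toℕ j))

    [π^_] : ℕ → Carrier → Carrier
    [π^ zero  ] x = x
    [π^ suc n ] x = [π^ n ] ([π] x)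

    ⟦_⟧ₖ : CommutativeRing.Carrier k.ring → Carrier
    ⟦ ζ ⟧ₖ = ⟦ embed (PowerSeries.constant k̄.ring (k̄.ι ζ)) ⟧

    -- The action of Σᵢ aᵢ πⁱ ∈ 𝒪F on sections killed by [πⁿ], where only
    -- its class modulo πⁿ matters: the terms with i ≥ n vanish.
    [_]mod-π^_ : CommutativeRing.Carrier 𝒪F → ℕ → Carrier → Carrier
    ([ α ]mod-π^ n) x = ∑[ i < n ] (⟦ α (toℕ i) ⟧ₖ * [π^ toℕ i ] x)

    Torsion : ℕ → Set (e ⊔ f)
    Torsion n = Σ[ s ∈ Carrier ] [π^ n ] s ≈ 0#

    [π]ₜ : ∀ n → Torsion (suc n) → Torsion n
    [π]ₜ n (s , p) = [π] s , p

  open Sections public using (Torsion)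

  ----------------------------------------------------------------------
  -- Drinfeld level πⁿ⁺¹ structures

  module DrinfeldLevel (G : FormalModule 𝒜) (R : Algebra 𝒜 e f) (n : ℕ)
               (X : Vector (Torsion G R (suc n)) (FormalModule.height G)) where
    open FormalModule G using (height)
    open Sections G R using ([_]mod-π^_)
    open PowerSeries (Algebra.ring R) using (constant; T)
    module R = Algebra R
    module R[[T]] = Algebra (R [[T]])

    -- φ at the class of π⁻ⁿ⁻¹α, for α ∈ 𝒪F^height.
    φ : Vector (CommutativeRing.Carrier 𝒪F) height → R.Carrier
    φ α = R.∑[ i < height ] (([ α i ]mod-π^ suc n) (proj₁ (X i)))

    -- π⁻¹ζ = π⁻ⁿ⁻¹(ζπⁿ), so π⁻¹ζ is represented by ζπⁿ.
    π⁻¹ : Vector (CommutativeRing.Carrier k.ring) height → Vector (CommutativeRing.Carrier 𝒪F) height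
    π⁻¹ ζ i = PowerSeries.monomial k.ring n (ζ i)

    -- finToFun enumerates Fin height → Fin q, hence k^height, which is
    -- (π⁻¹𝒪F/𝒪F)^height via π⁻¹.
    divisor : R[[T]].Carrier
    divisor = R[[T]].∏[ t < q ℕ.^ height ]
                (T R[[T]].- constant (φ (π⁻¹ (Inverse.to k.elements ∘ finToFun t))))

    [π]T : R[[T]].Carrier
    [π]T = Sections.[π] G (R [[T]]) T

    IsDrinfeld : Set (e ⊔ f)
    IsDrinfeld = divisor R[[T]].∣ [π]T

    -- The same condition with divisibility in R[T].
    IsDrinfeldPolynomial : Set (e ⊔ f)
    IsDrinfeldPolynomial =
      Σ[ g ∈ R[[T]].Carrier ]
        (∃[ N ] ∀ j → N ℕ.≤ j → g j R.≈ R.0#) × g R[[T]].* divisor R[[T]].≈ [π]T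

  open DrinfeldLevel public using (IsDrinfeld; IsDrinfeldPolynomial)

  ----------------------------------------------------------------------
  -- The ideals 𝔪ᴺR for 𝔪 = (π, u₁, …, uₘ) ⊂ 𝒜.

  module _ (R : Algebra 𝒜 e f) where
    open Algebra R

    infix 4 _∈𝔪^_
    _∈𝔪^_ : Carrier → ℕ → Set (e ⊔ f)
    x ∈𝔪^ zero  = ⊤
    x ∈𝔪^ suc N = Σ[ y ∈ Vector Carrier h ]
      (∀ i → y i ∈𝔪^ N) × x ≈ ∑[ i < h ] (⟦ lookup (embed πnr ∷ u) i ⟧ * y i)

    𝔪-Separated : Set (e ⊔ f)
    𝔪-Separated = ∀ x → (∀ N → x ∈𝔪^ N) → x ≈ 0#

  ----------------------------------------------------------------------
  -- Morphisms ℱuniv[πⁿ]ʰ → LT[πⁿ] ⊗ 𝒜 of schemes over 𝒜, as natural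
  -- transformations between functors of points.

  module ℱuniv = Sections ℱuniv
  module LT = Sections (LT ⊗𝒜)

  record Morphism (n : ℕ) : Set (c ⊔ d ⊔ lsuc (e ⊔ f)) where
    field
      at      : (R : Algebra 𝒜 e f) → Vector (ℱuniv.Torsion R n) h → LT.Torsion R n
      -- For the identity homomorphism this says that at R respects ≈.
      natural : ∀ {R S} (φ : AlgebraHom R S) → let open Algebra S in
                (X : Vector (ℱuniv.Torsion R n) h) (Y : Vector (ℱuniv.Torsion S n) h) →
                (∀ i → AlgebraHom.to φ (proj₁ (X i)) ≈ proj₁ (Y i)) →
                AlgebraHom.to φ (proj₁ (at R X)) ≈ proj₁ (at S Y)

  -- Torsion sections are closed under sums and under 𝒪F; w is the sum
  -- s + t, respectively the multiple [α]s, as a section.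
  record IsMultilinear {n : ℕ} (μ : Morphism n) : Set (a ⊔ c ⊔ d ⊔ lsuc (e ⊔ f)) where
    open Morphism μ
    field
      additive : ∀ R → let open Algebra R in
                 ∀ (X : Vector (ℱuniv.Torsion R n) h) i (s t w : ℱuniv.Torsion R n) →
                 proj₁ w ≈ proj₁ s + proj₁ t →
                 proj₁ (at R (updateAt X i (const w))) ≈
                   proj₁ (at R (updateAt X i (const s))) + proj₁ (at R (updateAt X i (const t)))
      homogeneous : ∀ R → let open Algebra R in
                    ∀ (X : Vector (ℱuniv.Torsion R n) h) i
                    (α : CommutativeRing.Carrier 𝒪F) (s w : ℱuniv.Torsion R n) →
                    proj₁ w ≈ (ℱuniv.[_]mod-π^_ R α n) (proj₁ s) →
                    proj₁ (at R (updateAt X i (const w))) ≈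
                      (LT.[_]mod-π^_ R α n) (proj₁ (at R (updateAt X i (const s))))

  IsAlternating : ∀ {n} → Morphism n → Set (c ⊔ d ⊔ lsuc (e ⊔ f))
  IsAlternating {n} μ =
    ∀ R → let open Algebra R in
    ∀ (X : Vector (ℱuniv.Torsion R n) h) i j → i ≢ j →
    proj₁ (X i) ≈ proj₁ (X j) → proj₁ (Morphism.at μ R X) ≈ 0#

  -- μ([π](X₁),…,[π](Xₕ)) = [π](ν(X₁,…,Xₕ)), the transition maps
  -- G[πⁿ⁺¹] → G[πⁿ] on both sides being [π].
  IsCompatible : ∀ {n} → Morphism n → Morphism (suc n) → Set (c ⊔ d ⊔ lsuc (e ⊔ f))
  IsCompatible {n} μ ν =
    ∀ R → let open Algebra R in
    ∀ (X : Vector (ℱuniv.Torsion R (suc n)) h) →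
    proj₁ (Morphism.at μ R (λ i → ℱuniv.[π]ₜ R n (X i))) ≈ proj₁ (LT.[π]ₜ R n (Morphism.at ν R X))

  -- Divisibility of [π](T) by ∏(T - φ(y)) forces the two monic polynomials
  -- to be equal if it holds in R[T], or if it holds in R[[T]] and R is
  -- 𝔪-separated. Divisibility in R[[T]] alone does not: the difference may
  -- be a nonzero series whose coefficients lie in every power of 𝔪R.
  PreservesDrinfeld : ∀ {n} → Morphism (suc n) → Set (c ⊔ d ⊔ lsuc (e ⊔ f))
  PreservesDrinfeld {n} μ =
    ∀ R → 𝔪-Separated R → (X : Vector (ℱuniv.Torsion R (suc n)) h) →
    IsDrinfeld ℱuniv R n X → IsDrinfeld (LT ⊗𝒜) R n (λ _ → Morphism.at μ R X)

  PreservesDrinfeldPolynomial : ∀ {n} → Morphism (suc n) → Set (c ⊔ d ⊔ lsuc (e ⊔ f))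
  PreservesDrinfeldPolynomial {n} μ =
    ∀ R → (X : Vector (ℱuniv.Torsion R (suc n)) h) →
    IsDrinfeldPolynomial ℱuniv R n X → IsDrinfeldPolynomial (LT ⊗𝒜) R n (λ _ → Morphism.at μ R X)

{-# OPTIONS --safe #-}
module Submission where

-- Write [πⁿ]X for iterated multiplication and X̂ = Σₙ [πⁿ](X) tⁿ ∈ R[[t]], let τ be the coefficientwise
-- q-power map, and let M̂ = det (τʲX̂ᵢ) be the Moore determinant over R[[t]]. With h = m + 1, the morphism on
-- πⁿ⁺¹-torsion is the coefficient of t^(mn) in M̂, that is, the sum of the Moore determinants of
-- [π^a₁](X₁),…,[π^aₕ](Xₕ) over all a₁ + ⋯ + aₕ = mn.
--
-- On πⁿ⁺¹-torsion X̂ is a polynomial of degree at most n and t · [π]X̂ = X̂ - X, the right side with X constant.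
-- Substituting this in one row, in one column, or everywhere changes M̂ only in degrees ≤ mn, because a
-- determinant with one constant row or column has degree at most mn. Comparing the coefficients above
-- that degree shows that [π]_LT, multiplying one Xᵢ by π, and multiplying all Xᵢ by π all shift the index of the
-- coefficient; this is 𝒪F-linearity, the torsion condition and the compatibility of the μₙ.
--
-- The shift also gives [πⁿ]_LT μ(X) = z, the Moore determinant of Yᵢ = [πⁿ](Xᵢ). The product of T - y·Y over y ∈ kʰ
-- is a monic q-polynomial with linear coefficient (-1)ʰ z^(q-1), as one sees by adjoining one Yᵢ at a time.
-- If it divides [π](T), the quotient is constant: the lower coefficients of the qʰ-th power of the product lie in 𝔪,
-- since [π]Yᵢ = 0 puts Yᵢ^(qʰ) there, so the higher coefficients of the quotient lie in every 𝔪ᴺ. Then the two agree,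
-- so π = (-1)ʰ z^(q-1), which says that (-1)ᵐ (T^q - z^(q-1) T) is [π]_LT(T).

open import Algebra.Bundles using (CommutativeRing; RawRing)
open import Algebra.Definitions.RawMagma using (_,_)
open import Algebra.Morphism.Construct.Composition using (isRingHomomorphism)
import Algebra.Morphism.Construct.Identity as Identity
open import Algebra.Morphism.Structures using (module RingMorphisms)
import Algebra.Properties.CommutativeMonoid.Sum as CommutativeMonoidSum
import Algebra.Properties.CommutativeSemiring.Exp as Exp
import Algebra.Properties.Ring as RingProperties
import Algebra.Properties.Semiring.Sum as SemiringSum
import Algebra.Solver.Ring as Solver
open import Algebra.Solver.Ring.AlmostCommutativeRing using (fromCommutativeRing; _-Raw-AlmostCommutative⟶_)
open import Data.Bool.Base using (Bool; true; false)
open import Data.Empty using (⊥-elim)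
open import Data.Fin.Base using (Fin; zero; suc; toℕ; combine; finToFun; punchIn; _↑ˡ_; _↑ʳ_)
import Data.Fin.Permutation as Perm
import Data.Fin.Properties as Fin
import Data.Integer.Base as ℤ
import Data.Integer.Properties as ℤ
open import Data.Maybe.Base using (Maybe; just; nothing)
open import Data.Nat.Base as ℕ using (ℕ; zero; suc; s≤s; z≤n; _∸_)
import Data.Nat.Properties as ℕ
open import Data.Nat.Solver using (module +-*-Solver)
open import Data.Product.Base using (∃-syntax; Σ-syntax; _×_; _,_; proj₁; proj₂)
import Data.Sign.Base as Sign
open import Data.Sum.Base using (inj₁; inj₂)
open import Data.Unit.Polymorphic.Base using (⊤; tt)
open import Data.Vec.Base using (Vec; []; _∷_; head; lookup; map; replicate; zipWith; _∷ʳ_)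
open import Data.Vec.Functional using (Vector; tail; updateAt)
open import Data.Vec.Functional.Properties using (updateAt-updates; updateAt-minimal)
open import Data.Vec.Properties using (map-id; map-∘)
open import Data.Vec.Relation.Binary.Pointwise.Inductive as Pointwise using (Pointwise; []; _∷_)
open import Data.Vec.Relation.Unary.All using (All; []; _∷_)
open import Function.Base using (_∘_; id; const)
open import Function.Bundles using (Inverse)
open import Level using (Level; _⊔_)
open import Relation.Binary.PropositionalEquality.Core as ≡ using (_≡_; _≢_)
open import Relation.Nullary.Decidable.Core using (Dec; yes; no)
open import Relation.Nullary.Negation.Core using (¬_; contradiction)
open import Defs

-- `FiniteField` supplies q elements but no prime p and no exponent, so additivity of x ↦ x^q does
-- not come from binomial coefficients. Fermat gives ∏ (x - ζz) = x^q - z^(q-1) x as an identity of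
-- coefficients, hence in every k-algebra; additivity follows from it, and it also evaluates the
-- products over k-spans.
--
-- The sign (-1)ᵐ of LT arises as follows. Applying τ to a Moore determinant replaces the columns x,
-- τx, ..., τᵐx by τx, ..., τ^(m+1)x. The new column may be exchanged for [π](x) - πx, since the
-- other terms repeat columns, and bringing it to the place of x passes m columns. So a q-polynomial
-- of height m + 1 on the entries becomes one of height 1 on the determinant.
--
-- The index mn is where the comparison of coefficients becomes available; n + 1 steps further the
-- index exceeds the total degree (m + 1)n, whence torsion.
--
-- Determinants are chains of wedge products, built column by column. Column operations are then
-- direct, whereas facts about rows (linearity, equal rows, degrees) need an invariant carried along
-- the chain. Characteristic 2 is allowed, so vanishing on equal rows cannot be drawn from
-- antisymmetry.

private
  variable
    a b c d e f : Level

-- Polynomial identities in commutative rings, and ring homomorphisms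

module IntegerSolver (R : CommutativeRing a b) where
  open CommutativeRing R
  open import Data.Integer.Base using (ℤ; +_; -[1+_])
  open import Algebra.Properties.Ring ring
  open import Algebra.Properties.AbelianGroup +-abelianGroup using (⁻¹-∙-comm)
  open import Algebra.Properties.Semiring.Mult.TCOptimised semiring
    using (1+×; ×-homo-+; ×1-homo-*) renaming (_×_ to _·_)
  open import Relation.Binary.Reasoning.Setoid setoid

  private
    ⟦_⟧ : ℤ → Carrier
    ⟦ + n ⟧      = n · 1#
    ⟦ -[1+ n ] ⟧ = - (suc n · 1#)

    ⊖-homo : ∀ m n → ⟦ m ℤ.⊖ n ⟧ ≈ m · 1# + - (n · 1#)
    ⊖-homo zero    zero    = sym (-‿inverseʳ 0#)
    ⊖-homo zero    (suc n) = sym (+-identityˡ _)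
    ⊖-homo (suc m) zero    = sym (trans (+-congˡ -0#≈0#) (+-identityʳ _))
    ⊖-homo (suc m) (suc n) = begin
      ⟦ suc m ℤ.⊖ suc n ⟧                     ≡⟨ ≡.cong ⟦_⟧ (ℤ.[1+m]⊖[1+n]≡m⊖n m n) ⟩
      ⟦ m ℤ.⊖ n ⟧                             ≈⟨ ⊖-homo m n ⟩
      x + - y                                 ≈⟨ +-congʳ (+-identityˡ x) ⟨
      (0# + x) + - y                          ≈⟨ +-congʳ (+-congʳ (-‿inverseʳ 1#)) ⟨
      ((1# + - 1#) + x) + - y                 ≈⟨ +-congʳ (+-assoc _ _ _) ⟩
      (1# + (- 1# + x)) + - y                 ≈⟨ +-congʳ (+-congˡ (+-comm _ _)) ⟩
      (1# + (x + - 1#)) + - y                 ≈⟨ +-congʳ (+-assoc _ _ _) ⟨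
      ((1# + x) + - 1#) + - y                 ≈⟨ +-assoc _ _ _ ⟩
      (1# + x) + (- 1# + - y)                 ≈⟨ +-congˡ (⁻¹-∙-comm 1# y) ⟩
      (1# + x) + - (1# + y)                   ≈⟨ +-cong (1+× m 1#) (-‿cong (1+× n 1#)) ⟨
      suc m · 1# + - (suc n · 1#)             ∎
      where
      x = m · 1#
      y = n · 1#

    +-homo : ∀ i j → ⟦ i ℤ.+ j ⟧ ≈ ⟦ i ⟧ + ⟦ j ⟧
    +-homo (+ m)      (+ n)      = ×-homo-+ 1# m n
    +-homo (+ m)      -[1+ n ]   = ⊖-homo m (suc n)
    +-homo -[1+ m ]   (+ n)      = trans (⊖-homo n (suc m)) (+-comm _ _)
    +-homo -[1+ m ]   -[1+ n ]   = begin
      - (suc (suc (m ℕ.+ n)) · 1#)              ≈⟨ -‿cong (reflexive (≡.cong (λ l → suc l · 1#) (≡.sym (ℕ.+-suc m n)))) ⟩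
      - ((suc m ℕ.+ suc n) · 1#)                ≈⟨ -‿cong (×-homo-+ 1# (suc m) (suc n)) ⟩
      - (suc m · 1# + suc n · 1#)               ≈⟨ ⁻¹-∙-comm _ _ ⟨
      - (suc m · 1#) + - (suc n · 1#)           ∎

    +◃-homo : ∀ n → ⟦ Sign.+ ℤ.◃ n ⟧ ≈ n · 1#
    +◃-homo zero    = refl
    +◃-homo (suc n) = refl

    -◃-homo : ∀ n → ⟦ Sign.- ℤ.◃ n ⟧ ≈ - (n · 1#)
    -◃-homo zero    = sym -0#≈0#
    -◃-homo (suc n) = refl

    *-homo : ∀ i j → ⟦ i ℤ.* j ⟧ ≈ ⟦ i ⟧ * ⟦ j ⟧
    *-homo (+ m)    (+ n)    = trans (+◃-homo (m ℕ.* n)) (×1-homo-* m n)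
    *-homo (+ m)    -[1+ n ] = trans (-◃-homo (m ℕ.* suc n))
      (trans (-‿cong (×1-homo-* m (suc n))) (-‿distribʳ-* _ _))
    *-homo -[1+ m ] (+ n)    = trans (-◃-homo (suc m ℕ.* n))
      (trans (-‿cong (×1-homo-* (suc m) n)) (-‿distribˡ-* _ _))
    *-homo -[1+ m ] -[1+ n ] = trans (×1-homo-* (suc m) (suc n)) (sym (-x*-y≈x*y _ _))
      where
      -x*-y≈x*y : ∀ x y → - x * - y ≈ x * y
      -x*-y≈x*y x y = trans (sym (-‿distribˡ-* x (- y)))
        (trans (-‿cong (sym (-‿distribʳ-* x y))) (-‿involutive _))

    -‿homo : ∀ i → ⟦ ℤ.- i ⟧ ≈ - ⟦ i ⟧
    -‿homo (+ zero)  = sym -0#≈0#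
    -‿homo (+ suc n) = refl
    -‿homo -[1+ n ]  = sym (-‿involutive _)

    ℤ-rawRing : RawRing _ _
    ℤ-rawRing = record
      { _≈_ = _≡_ ; _+_ = ℤ._+_ ; _*_ = ℤ._*_ ; -_ = ℤ.-_ ; 0# = ℤ.0ℤ ; 1# = ℤ.1ℤ }

    morphism : ℤ-rawRing -Raw-AlmostCommutative⟶ fromCommutativeRing R
    morphism = record
      { ⟦_⟧ = ⟦_⟧ ; +-homo = +-homo ; *-homo = *-homo ; -‿homo = -‿homo
      ; 0-homo = refl ; 1-homo = refl }

    -- Coefficients are compared in ℤ, where equality is decidable. Distinct integers may still have
    -- equal images in R, so only a positive answer is returned.
    ≟-weak : ∀ i j → Maybe (⟦ i ⟧ ≈ ⟦ j ⟧)
    ≟-weak i j with i ℤ.≟ j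
    ... | yes p = just (reflexive (≡.cong ⟦_⟧ p))
    ... | no  _ = nothing

  open Solver ℤ-rawRing (fromCommutativeRing R) morphism ≟-weak using (con)
  open Solver ℤ-rawRing (fromCommutativeRing R) morphism ≟-weak public
    using (solve; Polynomial; _:+_; _:*_; _:-_; :-_; _:=_)

  :0 :1 : ∀ {n} → Polynomial n
  :0 = con ℤ.0ℤ
  :1 = con ℤ.1ℤ

module RingLemmas (R : CommutativeRing a b) where
  open RingOps R public hiding (zero)
  open IntegerSolver R public
  open RingProperties ring public
    using (-0#≈0#; -‿distribˡ-*; x∙y⁻¹≈ε⇒x≈y)
  open Exp commutativeSemiring public using (^-congˡ; ^-congʳ; ^-assocʳ; ^-distrib-*)
  open SemiringSum semiring public
    using (sum-cong-≋; *-distribˡ-sum; ∑-distrib-+)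
  open import Relation.Binary.Reasoning.Setoid setoid public

  module ∏ = CommutativeMonoidSum *-commutativeMonoid

  1^n≈1 : ∀ n → 1# ^ n ≈ 1#
  1^n≈1 zero    = refl
  1^n≈1 (suc n) = trans (*-identityˡ _) (1^n≈1 n)

  ∏-zero : ∀ {n} (t : Vector Carrier n) i → t i ≈ 0# → ∏[ j < n ] t j ≈ 0#
  ∏-zero t zero    p = trans (*-congʳ p) (zeroˡ _)
  ∏-zero t (suc i) p = trans (*-congˡ (∏-zero (t ∘ suc) i p)) (zeroʳ _)

  sum-zero : ∀ {n} (t : Vector Carrier n) → (∀ i → t i ≈ 0#) → ∑[ i < n ] t i ≈ 0#
  sum-zero {zero}  t p = refl
  sum-zero {suc n} t p = trans (+-cong (p zero) (sum-zero (t ∘ suc) (p ∘ suc))) (+-identityˡ 0#)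

module HomLemmas (R : CommutativeRing a b) (S : CommutativeRing c d)
                 {φ : CommutativeRing.Carrier R → CommutativeRing.Carrier S}
                 (φ-isHom : IsRingHom R S φ) where
  private
    module R = RingLemmas R
    module S = RingLemmas S
  open RingMorphisms.IsRingHomomorphism φ-isHom public
    using (⟦⟧-cong; +-homo; *-homo; -‿homo; 0#-homo; 1#-homo)

  sub-homo : ∀ x y → φ (x R.- y) S.≈ φ x S.- φ y
  sub-homo x y = S.trans (+-homo x (R.- y)) (S.+-congˡ (-‿homo y))

  ^-homo : ∀ x n → φ (x R.^ n) S.≈ φ x S.^ n
  ^-homo x zero    = 1#-homo
  ^-homo x (suc n) = S.trans (*-homo x _) (S.*-congˡ (^-homo x n))

  sum-homo : ∀ {n} (t : Vector R.Carrier n) → φ (R.sum-syntax n t) S.≈ S.sum-syntax n (φ ∘ t)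
  sum-homo {zero}  t = 0#-homo
  sum-homo {suc n} t = S.trans (+-homo _ _) (S.+-congˡ (sum-homo (tail t)))

-- Finite fields

module FieldLemmas {K : CommutativeRing a b} (isField : IsField K) where
  open RingLemmas K
  open IsField isField

  *-cancelˡ : ∀ {x y z} → ¬ (x ≈ 0#) → x * y ≈ x * z → y ≈ z
  *-cancelˡ {x} {y} {z} x≉0 xy≈xz with x⁻¹ , xx⁻¹≈1 ← inverse x x≉0 = begin
    y               ≈⟨ cancel y ⟨
    x⁻¹ * (x * y)   ≈⟨ *-congˡ xy≈xz ⟩
    x⁻¹ * (x * z)   ≈⟨ cancel z ⟩
    z               ∎
    where
    cancel : ∀ y → x⁻¹ * (x * y) ≈ y
    cancel y = trans (sym (*-assoc x⁻¹ x y))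
      (trans (*-congʳ (trans (*-comm x⁻¹ x) xx⁻¹≈1)) (*-identityˡ y))

  *-nonzero : ∀ {x y} → ¬ (x ≈ 0#) → ¬ (y ≈ 0#) → ¬ (x * y ≈ 0#)
  *-nonzero x≉0 y≉0 p = y≉0 (*-cancelˡ x≉0 (trans p (sym (zeroʳ _))))

  ∏-nonzero : ∀ {n} (t : Vector Carrier n) → (∀ i → ¬ (t i ≈ 0#)) → ¬ (∏[ i < n ] t i ≈ 0#)
  ∏-nonzero {zero}  t t≉0 = 1≉0
  ∏-nonzero {suc n} t t≉0 = *-nonzero (t≉0 zero) (∏-nonzero (t ∘ suc) (t≉0 ∘ suc))

  eval : ∀ {n} → Vec Carrier n → Carrier → Carrier
  eval []      x = 0#
  eval (a ∷ p) x = a + x * eval p x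

  -- Synthetic division by x - r: the coefficients of the quotient are the intermediate values of
  -- Horner's scheme at r.
  quotient : ∀ {n} → Carrier → Vec Carrier (suc n) → Vec Carrier n
  quotient r (a ∷ [])    = []
  quotient r (a ∷ b ∷ p) = eval (b ∷ p) r ∷ quotient r (b ∷ p)

  eval-quotient : ∀ {n} r (p : Vec Carrier (suc n)) x →
                  eval p x ≈ eval p r + (x - r) * eval (quotient r p) x
  eval-quotient r (a ∷ [])    x =
    solve 3 (λ a r x → a :+ x :* :0 := (a :+ r :* :0) :+ (x :- r) :* :0) refl a r x
  eval-quotient r (a ∷ b ∷ p) x = begin
    a + x * eval (b ∷ p) x                  ≈⟨ +-congˡ (*-congˡ (eval-quotient r (b ∷ p) x)) ⟩
    a + x * (E + (x - r) * Q)               ≈⟨ solve 5 (λ a r x E Q → a :+ x :* (E :+ (x :- r) :* Q)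
                                                 := (a :+ r :* E) :+ (x :- r) :* (E :+ x :* Q)) refl a r x E Q ⟩
    (a + r * E) + (x - r) * (E + x * Q)     ∎
    where
    E = eval (b ∷ p) r
    Q = eval (quotient r (b ∷ p)) x

  -- The head of the quotient is the value at r of the tail of p. Once it vanishes, the value of p
  -- at r is its constant term.
  quotient-zero : ∀ {n} r (p : Vec Carrier (suc n)) → eval p r ≈ 0# →
                  All (_≈ 0#) (quotient r p) → All (_≈ 0#) p
  quotient-zero r (a ∷ [])    p0 _         = trans (sym (trans (+-congˡ (zeroʳ r)) (+-identityʳ a))) p0 ∷ []
  quotient-zero r (a ∷ b ∷ p) p0 (z ∷ zs) =
    trans (sym (trans (+-congˡ (trans (*-congˡ z) (zeroʳ r))) (+-identityʳ a))) p0 ∷ quotient-zero r (b ∷ p) z zs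

  -- With n coefficients the degree is below n, so n distinct roots are one too many. After division
  -- by x - r₀ the other roots remain roots of the quotient, because their differences from r₀ can
  -- be cancelled.
  roots⇒zero : ∀ {n} (p : Vec Carrier n) (r : Vector Carrier n) → (∀ {i j} → i ≢ j → ¬ (r i ≈ r j)) →
               (∀ i → eval p (r i) ≈ 0#) → All (_≈ 0#) p
  roots⇒zero []        r distinct root = []
  roots⇒zero p@(_ ∷ _) r distinct root =
    quotient-zero (r zero) p (root zero)
      (roots⇒zero (quotient (r zero) p) (r ∘ suc) (λ i≢j → distinct (i≢j ∘ Fin.suc-injective)) λ i →
        *-cancelˡ (λ r-r≈0 → distinct (λ ()) (x∙y⁻¹≈ε⇒x≈y _ _ r-r≈0)) (begin
          (r (suc i) - r zero) * E i                          ≈⟨ +-identityˡ _ ⟨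
          0# + (r (suc i) - r zero) * E i                     ≈⟨ +-congʳ (root zero) ⟨
          eval p (r zero) + (r (suc i) - r zero) * E i        ≈⟨ eval-quotient (r zero) p (r (suc i)) ⟨
          eval p (r (suc i))                                  ≈⟨ root (suc i) ⟩
          0#                                                  ≈⟨ zeroʳ _ ⟨
          (r (suc i) - r zero) * 0#                           ∎))
    where E = λ i → eval (quotient (r zero) p) (r (suc i))

-- A monic homogeneous polynomial xⁿ + pₙ₋₁xⁿ⁻¹z + ⋯ + p₀zⁿ is the vector of the pᵢ.
module MonicForms (K : CommutativeRing a b) where
  open RingLemmas K

  addHead : ∀ {n} → Carrier → Vec Carrier (suc n) → Vec Carrier (suc n)
  addHead a (b ∷ p) = (b + a) ∷ p

  timesLinear : ∀ {n} → Carrier → Vec Carrier n → Vec Carrier (suc n)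
  timesLinear ζ []      = (- ζ) ∷ []
  timesLinear ζ (a ∷ p) = (- (a * ζ)) ∷ addHead a (timesLinear ζ p)

  linearProduct : ∀ {n} → Vector Carrier n → Vec Carrier n
  linearProduct {zero}  ζ = []
  linearProduct {suc n} ζ = timesLinear (ζ zero) (linearProduct (ζ ∘ suc))

  -- The coefficients of xⁿ⁺² - zⁿ⁺¹x.
  frobeniusForm : ∀ n → Vec Carrier (suc (suc n))
  frobeniusForm n = 0# ∷ (- 1#) ∷ replicate n 0#

module EvalMonicForms (K : CommutativeRing a b) (R : CommutativeRing c d)
                  {κ : CommutativeRing.Carrier K → CommutativeRing.Carrier R} (κ-isHom : IsRingHom K R κ) where
  private module K = RingLemmas K
  open RingLemmas R
  open HomLemmas K R κ-isHom
  open MonicForms K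

  form : ∀ {n} → Vec K.Carrier n → Carrier → Carrier → Carrier
  form         []      x z = 1#
  form {suc n} (a ∷ p) x z = κ a * z ^ suc n + x * form p x z

  form-cong : ∀ {n} {p p′ : Vec K.Carrier n} → Pointwise K._≈_ p p′ → ∀ x z → form p x z ≈ form p′ x z
  form-cong []       x z = refl
  form-cong (r ∷ rs) x z = +-cong (*-congʳ (⟦⟧-cong r)) (*-congˡ (form-cong rs x z))

  form-addHead : ∀ {n} a (p : Vec K.Carrier (suc n)) x z →
                 form (addHead a p) x z ≈ κ a * z ^ suc n + form p x z
  form-addHead a (b ∷ p) x z = trans (+-congʳ (*-congʳ (+-homo b a)))
    (solve 4 (λ a b Z F → (b :+ a) :* Z :+ F := a :* Z :+ (b :* Z :+ F)) refl _ _ _ _)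

  form-timesLinear : ∀ {n} ζ (p : Vec K.Carrier n) x z →
                     (x - κ ζ * z) * form p x z ≈ form (timesLinear ζ p) x z
  form-timesLinear ζ [] x z = sym (trans (+-congʳ (*-congʳ (-‿homo ζ)))
    (solve 3 (λ x ζ z → (:- ζ) :* (z :* :1) :+ x :* :1 := (x :- ζ :* z) :* :1) refl x (κ ζ) z))
  form-timesLinear {suc n} ζ (a ∷ p) x z = begin
    (x - κ ζ * z) * (κ a * Z + x * F)
      ≈⟨ solve 6 (λ x ζ z a Z F → (x :- ζ :* z) :* (a :* Z :+ x :* F)
           := (:- (a :* ζ)) :* (z :* Z) :+ x :* (a :* Z :+ (x :- ζ :* z) :* F)) refl x (κ ζ) z (κ a) Z F ⟩
    (- (κ a * κ ζ)) * (z * Z) + x * (κ a * Z + (x - κ ζ * z) * F)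
      ≈⟨ +-cong (*-congʳ (trans (-‿cong (sym (*-homo a ζ))) (sym (-‿homo _))))
                (*-congˡ (trans (+-congˡ (form-timesLinear ζ p x z)) (sym (form-addHead a (timesLinear ζ p) x z)))) ⟩
    κ (K.- (a K.* ζ)) * (z * Z) + x * form (addHead a (timesLinear ζ p)) x z ∎
    where
    Z = z ^ suc n
    F = form p x z

  form-linearProduct : ∀ {n} (ζ : Vector K.Carrier n) x z →
                       ∏[ i < n ] (x - κ (ζ i) * z) ≈ form (linearProduct ζ) x z
  form-linearProduct {zero}  ζ x z = refl
  form-linearProduct {suc n} ζ x z = trans (*-congˡ (form-linearProduct (ζ ∘ suc) x z))
    (form-timesLinear (ζ zero) (linearProduct (ζ ∘ suc)) x z)

  form-replicate : ∀ n x z → form (replicate n K.0#) x z ≈ x ^ n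
  form-replicate zero    x z = refl
  form-replicate (suc n) x z = trans (+-congʳ (trans (*-congʳ 0#-homo) (zeroˡ _)))
    (trans (+-identityˡ _) (*-congˡ (form-replicate n x z)))

  form-frobenius : ∀ n x z → form (frobeniusForm n) x z ≈ x ^ suc (suc n) - z ^ suc n * x
  form-frobenius n x z = begin
    κ K.0# * _ + x * (κ (K.- K.1#) * Z + x * form (replicate n K.0#) x z)
      ≈⟨ +-cong (trans (*-congʳ 0#-homo) (zeroˡ _))
           (*-congˡ (+-cong (*-congʳ (trans (-‿homo _) (-‿cong 1#-homo))) (*-congˡ (form-replicate n x z)))) ⟩
    0# + x * ((- 1#) * Z + x * x ^ n)
      ≈⟨ +-identityˡ _ ⟩
    x * ((- 1#) * Z + x * x ^ n)
      ≈⟨ *-congˡ (+-congʳ (trans (sym (-‿distribˡ-* 1# Z)) (-‿cong (*-identityˡ Z)))) ⟩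
    x * (- Z + x * x ^ n)
      ≈⟨ solve 3 (λ x Z X → x :* (:- Z :+ X) := x :* X :- Z :* x) refl x Z (x * x ^ n) ⟩
    x * (x * x ^ n) - Z * x ∎
    where Z = z ^ suc n

id-isHom : (R : CommutativeRing a b) → IsRingHom R R id
id-isHom R = Identity.isRingHomomorphism (CommutativeRing.rawRing R) (CommutativeRing.refl R)

module FiniteFieldLemmas where

  module _ {q : ℕ} (k : FiniteField q a b) where
    open FiniteField k
    open RingLemmas ring
    open Inverse elements renaming (to to element; from to index)

    distinct : ∀ {i j} → i ≢ j → ¬ (element i ≈ element j)
    distinct i≢j p = i≢j (≡.trans (≡.sym (strictlyInverseʳ _)) (≡.trans (from-cong p) (strictlyInverseʳ _)))

    permutation : (σ τ : Carrier → Carrier) → (∀ {x y} → x ≈ y → σ x ≈ σ y) → (∀ {x y} → x ≈ y → τ x ≈ τ y) →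
                  (∀ x → σ (τ x) ≈ x) → (∀ x → τ (σ x) ≈ x) → Perm.Permutation q q
    permutation σ τ σ-cong τ-cong στ τσ = Perm.permutation (index ∘ σ ∘ element) (index ∘ τ ∘ element)
      (λ i → ≡.trans (from-cong (trans (σ-cong (strictlyInverseˡ _)) (στ _))) (strictlyInverseʳ i))
      (λ i → ≡.trans (from-cong (trans (τ-cong (strictlyInverseˡ _)) (τσ _))) (strictlyInverseʳ i))

  nontrivial : ∀ {q} → FiniteField q a b → ∃[ r ] q ≡ suc (suc r)
  nontrivial {q = zero}        k with () ← Inverse.from (FiniteField.elements k) (CommutativeRing.0# (FiniteField.ring k))
  nontrivial {q = suc zero}    k = contradiction (begin
    1#                  ≈⟨ strictlyInverseˡ 1# ⟨
    to (from 1#)        ≡⟨ ≡.cong to (only (from 1#) (from 0#)) ⟩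
    to (from 0#)        ≈⟨ strictlyInverseˡ 0# ⟩
    0#                  ∎) 1≉0
    where
    open FiniteField k
    open RingLemmas ring
    open IsField isField
    open Inverse elements
    only : (i j : Fin 1) → i ≡ j
    only zero zero = ≡.refl
  nontrivial {q = suc (suc r)} k = r , ≡.refl

  -- Multiplication by x ≠ 0 permutes the nonzero elements, so x^(q-1) times their product is that
  -- product, which can be cancelled.
  fermat : ∀ {q} (k : FiniteField q a b) → let open RingLemmas (FiniteField.ring k) in ∀ x → x ^ q ≈ x
  fermat {q = zero}  k x with () ← Inverse.from (FiniteField.elements k) x
  fermat {q = suc r} k x = by-cases (index x Fin.≟ i₀)
    where
    open FiniteField k
    open RingLemmas ring
    open FieldLemmas isField
    open Inverse elements renaming (to to element; from to index)
    i₀ = index 0#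

    nonzero : Vector Carrier r
    nonzero j = element (punchIn i₀ j)

    nonzero≉0 : ∀ j → ¬ (nonzero j ≈ 0#)
    nonzero≉0 j p = Fin.punchInᵢ≢i i₀ j (≡.trans (≡.sym (strictlyInverseʳ _)) (from-cong p))

    -- Replacing the element 0 by 1 turns the product of the nonzero elements into one over all of
    -- `Fin q`, where a permutation of all the elements can act.
    unlessZero : Vector Carrier (suc r)
    unlessZero i with i Fin.≟ i₀
    ... | yes _ = 1#
    ... | no  _ = element i

    unlessZero-i₀ : ∀ {i} → i ≡ i₀ → unlessZero i ≈ 1#
    unlessZero-i₀ {i} p with i Fin.≟ i₀
    ... | yes _ = refl
    ... | no ¬p = ⊥-elim (¬p p)

    unlessZero-≢ : ∀ {i} → i ≢ i₀ → unlessZero i ≈ element i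
    unlessZero-≢ {i} ¬p with i Fin.≟ i₀
    ... | yes p = ⊥-elim (¬p p)
    ... | no  _ = refl

    x^r≈1 : ¬ (x ≈ 0#) → x ^ r ≈ 1#
    x^r≈1 x≉0 = *-cancelˡ (∏-nonzero nonzero nonzero≉0) (begin
      (∏[ j < r ] nonzero j) * x ^ r                      ≈⟨ *-comm _ _ ⟩
      x ^ r * (∏[ j < r ] nonzero j)                      ≈⟨ *-congʳ (∏.sum-replicate r) ⟨
      (∏[ j < r ] x) * (∏[ j < r ] nonzero j)             ≈⟨ ∏.∑-distrib-+ (λ _ → x) nonzero ⟨
      ∏[ j < r ] (x * nonzero j)                          ≈⟨ ∏.sum-cong-≋ shifted ⟨
      ∏[ j < r ] unlessZero (σ Perm.⟨$⟩ʳ punchIn i₀ j)    ≈⟨ *-identityˡ _ ⟨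
      1# * _                                              ≈⟨ *-congʳ (unlessZero-i₀ σ-i₀) ⟨
      unlessZero (σ Perm.⟨$⟩ʳ i₀) * _                     ≈⟨ ∏.sum-remove {i = i₀} (λ i → unlessZero (σ Perm.⟨$⟩ʳ i)) ⟨
      ∏[ i < suc r ] unlessZero (σ Perm.⟨$⟩ʳ i)           ≈⟨ ∏.sum-permute unlessZero σ ⟨
      ∏[ i < suc r ] unlessZero i                         ≈⟨ ∏.sum-remove {i = i₀} unlessZero ⟩
      unlessZero i₀ * _
        ≈⟨ *-cong (unlessZero-i₀ ≡.refl) (∏.sum-cong-≋ λ j → unlessZero-≢ (Fin.punchInᵢ≢i i₀ j)) ⟩
      1# * (∏[ j < r ] nonzero j)                         ≈⟨ *-comm _ _ ⟩
      (∏[ j < r ] nonzero j) * 1#                         ∎)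
      where
      x⁻¹ = proj₁ (IsField.inverse isField x x≉0)
      xx⁻¹ = proj₂ (IsField.inverse isField x x≉0)
      σ = permutation k (x *_) (x⁻¹ *_) *-congˡ *-congˡ
        (λ y → trans (sym (*-assoc _ _ _)) (trans (*-congʳ xx⁻¹) (*-identityˡ y)))
        (λ y → trans (sym (*-assoc _ _ _)) (trans (*-congʳ (trans (*-comm _ _) xx⁻¹)) (*-identityˡ y)))
      σ-i₀ : σ Perm.⟨$⟩ʳ i₀ ≡ i₀
      σ-i₀ = from-cong (trans (*-congˡ (strictlyInverseˡ 0#)) (zeroʳ x))
      σ-≢ : ∀ j → σ Perm.⟨$⟩ʳ punchIn i₀ j ≢ i₀
      σ-≢ j p = *-nonzero x≉0 (nonzero≉0 j)
        (trans (sym (strictlyInverseˡ _)) (trans (reflexive (≡.cong element p)) (strictlyInverseˡ 0#)))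
      shifted : ∀ j → unlessZero (σ Perm.⟨$⟩ʳ punchIn i₀ j) ≈ x * nonzero j
      shifted j = trans (unlessZero-≢ (σ-≢ j)) (strictlyInverseˡ _)

    by-cases : _ → x ^ suc r ≈ x
    by-cases (yes p) = trans (trans (*-congʳ x≈0) (zeroˡ _)) (sym x≈0)
      where
      x≈0 : x ≈ 0#
      x≈0 = trans (sym (strictlyInverseˡ x)) (trans (reflexive (≡.cong element p)) (strictlyInverseˡ 0#))
    by-cases (no ¬p) = trans (*-congˡ (x^r≈1 (¬p ∘ from-cong))) (*-identityʳ x)

  module _ {r : ℕ} (k : FiniteField (suc (suc r)) a b) where
    private
      q : ℕ
      q = suc (suc r)

      module K = RingLemmas (FiniteField.ring k)
    open FiniteField k using (isField)
    open FieldLemmas isField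
    open Inverse (FiniteField.elements k) using () renaming (to to element)
    private module Kforms = EvalMonicForms (FiniteField.ring k) (FiniteField.ring k) (id-isHom (FiniteField.ring k))
    open MonicForms (FiniteField.ring k) using (linearProduct; frobeniusForm)
    open K

    -- The implicit leading terms cancel: the difference of two monic forms of degree n has only n
    -- coefficients, as `roots⇒zero` requires.
    eval-difference : ∀ {n} (p p′ : Vec Carrier n) x →
                      eval (zipWith _-_ p p′) x ≈ Kforms.form p x 1# - Kforms.form p′ x 1#
    eval-difference         []      []        x = sym (-‿inverseʳ 1#)
    eval-difference {suc n} (a ∷ p) (a′ ∷ p′) x = begin
      (a - a′) + x * eval (zipWith _-_ p p′) x
        ≈⟨ +-cong (+-cong (unit a) (-‿cong (unit a′))) (*-congˡ (eval-difference p p′ x)) ⟩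
      (a * O - a′ * O) + x * (F - F′)
        ≈⟨ solve 6 (λ a a′ O x F F′ → (a :* O :- a′ :* O) :+ x :* (F :- F′)
             := (a :* O :+ x :* F) :- (a′ :* O :+ x :* F′)) refl a a′ O x F F′ ⟩
      (a * O + x * F) - (a′ * O + x * F′) ∎
      where
      O = 1# ^ suc n
      F = Kforms.form p x 1#
      F′ = Kforms.form p′ x 1#
      unit : ∀ a → a ≈ a * O
      unit a = sym (trans (*-congˡ (1^n≈1 (suc n))) (*-identityʳ a))

    -- At z = 1 both forms are monic of degree q and vanish at all q elements of the field, the
    -- second by Fermat. Equality of coefficients, unlike equality of values, transports to any
    -- algebra over the field and to a z that is not invertible.
    linearProduct≈frobenius : Pointwise _≈_ (linearProduct element) (frobeniusForm r)
    linearProduct≈frobenius = difference-zero (linearProduct element) (frobeniusForm r)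
        (roots⇒zero _ element (distinct k) λ i → begin
      eval (zipWith _-_ (linearProduct element) (frobeniusForm r)) (element i)
        ≈⟨ eval-difference (linearProduct element) (frobeniusForm r) (element i) ⟩
      Kforms.form (linearProduct element) (element i) 1# - Kforms.form (frobeniusForm r) (element i) 1#
        ≈⟨ +-cong (sym (Kforms.form-linearProduct element (element i) 1#))
            (-‿cong (Kforms.form-frobenius r (element i) 1#)) ⟩
      (∏[ j < q ] (element i - element j * 1#)) - (element i ^ q - 1# ^ suc r * element i)
        ≈⟨ +-cong (∏-zero (λ j → element i - element j * 1#) i (trans (+-congˡ (-‿cong (*-identityʳ _))) (-‿inverseʳ _)))
                  (-‿cong (+-cong (fermat k (element i)) (-‿cong (trans (*-congʳ (1^n≈1 (suc r))) (*-identityˡ _))))) ⟩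
      0# - (element i - element i)
        ≈⟨ +-congˡ (-‿cong (-‿inverseʳ _)) ⟩
      0# - 0#
        ≈⟨ -‿inverseʳ 0# ⟩
      0# ∎)
      where
      difference-zero : ∀ {n} (p p′ : Vec Carrier n) → All (_≈ 0#) (zipWith _-_ p p′) → Pointwise _≈_ p p′
      difference-zero []      []        []       = []
      difference-zero (a ∷ p) (a′ ∷ p′) (z ∷ zs) = x∙y⁻¹≈ε⇒x≈y a a′ z ∷ difference-zero p p′ zs

module FqAlgebra {q : ℕ} (k : FiniteField q a b) (R : CommutativeRing c d)
                 {κ : CommutativeRing.Carrier (FiniteField.ring k) → CommutativeRing.Carrier R}
                 (κ-isHom : IsRingHom (FiniteField.ring k) R κ) where
  open FiniteFieldLemmas
  private
    module K = RingLemmas (FiniteField.ring k)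
    module κ = HomLemmas (FiniteField.ring k) R κ-isHom
  open RingLemmas R
  open Inverse (FiniteField.elements k) renaming (to to element; from to index)

  linear-factors : ∀ x z → ∏[ i < q ] (x - κ (element i) * z) ≈ x ^ q - z ^ ℕ.pred q * x
  linear-factors x z with r , ≡.refl ← nontrivial k = begin
    _                                ≈⟨ form-linearProduct element x z ⟩
    form (linearProduct element) x z ≈⟨ form-cong (linearProduct≈frobenius k) x z ⟩
    form (frobeniusForm r) x z       ≈⟨ form-frobenius r x z ⟩
    _                                ∎
    where
    open MonicForms (FiniteField.ring k)
    open EvalMonicForms (FiniteField.ring k) R κ-isHom

  -- The left side of linear-factors is invariant under x ↦ x + z.
  frobenius-+ : ∀ x z → (x + z) ^ q ≈ x ^ q + z ^ q
  frobenius-+ x z with r , ≡.refl ← nontrivial k = begin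
    X+Z
      ≈⟨ solve 4 (λ A x z Z → A := (A :- Z :* (x :+ z)) :+ Z :* (x :+ z)) refl X+Z x z Z ⟩
    (X+Z - Z * (x + z)) + Z * (x + z)            ≈⟨ +-congʳ (linear-factors (x + z) z) ⟨
    P (x + z) + Z * (x + z)                      ≈⟨ +-congʳ (∏.sum-cong-≋ shift) ⟩
    (∏[ i < q ] (x - κ (element (σ Perm.⟨$⟩ʳ i)) * z)) + Z * (x + z)
                                                 ≈⟨ +-congʳ (∏.sum-permute (λ i → x - κ (element i) * z) σ) ⟨
    P x + Z * (x + z)                            ≈⟨ +-congʳ (linear-factors x z) ⟩
    (x ^ q - Z * x) + Z * (x + z)
      ≈⟨ solve 4 (λ A x z Z → (A :- Z :* x) :+ Z :* (x :+ z) := A :+ z :* Z) refl (x ^ q) x z Z ⟩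
    x ^ q + z ^ q                                ∎
    where
    Z = z ^ ℕ.pred q
    X+Z = (x + z) ^ q
    P = λ x → ∏[ i < q ] (x - κ (element i) * z)
    -- Since x + z - ζz = x - (ζ - 1)z, the substitution permutes the factors by ζ ↦ ζ - 1.
    σ = permutation k (K._- K.1#) (K._+ K.1#) K.+-congʳ K.+-congʳ
      (λ y → K.solve 2 (λ y o → (y K.:+ o) K.:- o K.:= y) K.refl y K.1#)
      (λ y → K.solve 2 (λ y o → (y K.:- o) K.:+ o K.:= y) K.refl y K.1#)
    shift : ∀ i → (x + z) - κ (element i) * z ≈ x - κ (element (σ Perm.⟨$⟩ʳ i)) * z
    shift i = begin
      (x + z) - κ (element i) * z             ≈⟨ +-congʳ (+-congˡ (*-identityˡ z)) ⟨
      (x + 1# * z) - κ (element i) * z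
        ≈⟨ solve 4 (λ x z o y → (x :+ o :* z) :- y :* z := x :- (y :- o) :* z) refl x z 1# (κ (element i)) ⟩
      x - (κ (element i) - 1#) * z            ≈⟨ +-congˡ (-‿cong (*-congʳ (+-congˡ (-‿cong κ.1#-homo)))) ⟨
      x - (κ (element i) - κ K.1#) * z        ≈⟨ +-congˡ (-‿cong (*-congʳ (κ.sub-homo (element i) K.1#))) ⟨
      x - κ (element i K.- K.1#) * z          ≈⟨ +-congˡ (-‿cong (*-congʳ (κ.⟦⟧-cong (strictlyInverseˡ _)))) ⟨
      x - κ (element (σ Perm.⟨$⟩ʳ i)) * z     ∎

  frobenius-κ : ∀ ζ → κ ζ ^ q ≈ κ ζ
  frobenius-κ ζ = trans (sym (κ.^-homo ζ q)) (κ.⟦⟧-cong (fermat k ζ))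

  0^q : 0# ^ q ≈ 0#
  0^q with r , ≡.refl ← nontrivial k = zeroˡ _

  frobenius-isHom : IsRingHom R R (_^ q)
  frobenius-isHom = record
    { isSemiringHomomorphism = record
      { isNearSemiringHomomorphism = record
        { +-isMonoidHomomorphism = record
          { isMagmaHomomorphism = record
            { isRelHomomorphism = record { cong = ^-congˡ q }
            ; homo = frobenius-+
            }
          ; ε-homo = 0^q
          }
        ; *-homo = λ x y → ^-distrib-* x y q
        }
      ; 1#-homo = 1^n≈1 q
      }
    ; -‿homo = λ x → begin
        (- x) ^ q                           ≈⟨ solve 2 (λ A B → A := (B :+ A) :- B) refl ((- x) ^ q) (x ^ q) ⟩
        (x ^ q + (- x) ^ q) - x ^ q         ≈⟨ +-congʳ (frobenius-+ x (- x)) ⟨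
        (x - x) ^ q - x ^ q                 ≈⟨ +-congʳ (trans (^-congˡ q (-‿inverseʳ x)) 0^q) ⟩
        0# - x ^ q                          ≈⟨ +-identityˡ _ ⟩
        - x ^ q                             ∎
    }

-- Moore determinants

-- The exterior algebra of Sⁿ, an element being the family of its coefficients
-- on the basis eᵢ ∧ eⱼ ∧ ⋯ (i < j < ⋯) indexed by subsets of {0,…,n-1}.
module Exterior (S : CommutativeRing a b) where
  open RingLemmas S

  Λ : ℕ → Set a
  Λ n = Vec Bool n → Carrier

  1Λ : ∀ {n} → Λ n
  1Λ []          = 1#
  1Λ (true  ∷ I) = 0#
  1Λ (false ∷ I) = 1Λ I

  -- Multiplication by the vector c from the left. With ω = ω₀ + e₀ ∧ ω₁, the minus sign comes from
  -- moving the tail of c past e₀.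
  wedge : ∀ {n} → Vector Carrier n → Λ n → Λ n
  wedge c ω []          = 0#
  wedge c ω (true  ∷ I) = c zero * ω (false ∷ I) - wedge (c ∘ suc) (ω ∘ (true ∷_)) I
  wedge c ω (false ∷ I) = wedge (c ∘ suc) (ω ∘ (false ∷_)) I

  top : ∀ {n} → Λ n → Carrier
  top ω = ω (replicate _ true)

  -- The product c (m-1) ∧ ⋯ ∧ c 0. Its top coefficient for m = n is the determinant of the columns
  -- taken from the last to the first.
  chain : ∀ {n} → (ℕ → Vector Carrier n) → ℕ → Λ n
  chain c zero    = 1Λ
  chain c (suc m) = wedge (c m) (chain c m)

  wedge-cong : ∀ {n} {c d : Vector Carrier n} {ω η : Λ n} → (∀ i → c i ≈ d i) → (∀ I → ω I ≈ η I) →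
               ∀ I → wedge c ω I ≈ wedge d η I
  wedge-cong p r []          = refl
  wedge-cong p r (true  ∷ I) =
    +-cong (*-cong (p zero) (r (false ∷ I))) (-‿cong (wedge-cong (p ∘ suc) (λ J → r (true ∷ J)) I))
  wedge-cong p r (false ∷ I) = wedge-cong (p ∘ suc) (λ J → r (false ∷ J)) I

  chain-cong : ∀ {n} {c d : ℕ → Vector Carrier n} → (∀ j i → c j i ≈ d j i) → ∀ m I → chain c m I ≈ chain d m I
  chain-cong p zero    I = refl
  chain-cong p (suc m) I = wedge-cong (p m) (chain-cong p m) I

  wedge-linearʳ : ∀ {n} (c : Vector Carrier n) x ω y η I →
                  wedge c (λ J → x * ω J + y * η J) I ≈ x * wedge c ω I + y * wedge c η I
  wedge-linearʳ c x ω y η []          = sym (trans (+-cong (zeroʳ x) (zeroʳ y)) (+-identityˡ 0#))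
  wedge-linearʳ c x ω y η (true  ∷ I) = trans (+-congˡ (-‿cong (wedge-linearʳ (c ∘ suc) x _ y _ I)))
    (solve 7 (λ c x ω W y η V → c :* (x :* ω :+ y :* η) :- (x :* W :+ y :* V)
       := x :* (c :* ω :- W) :+ y :* (c :* η :- V)) refl _ x _ _ y _ _)
  wedge-linearʳ c x ω y η (false ∷ I) = wedge-linearʳ (c ∘ suc) x _ y _ I

  wedge-linearˡ : ∀ {n} x (c : Vector Carrier n) y d ω I →
                  wedge (λ i → x * c i + y * d i) ω I ≈ x * wedge c ω I + y * wedge d ω I
  wedge-linearˡ x c y d ω []          = sym (trans (+-cong (zeroʳ x) (zeroʳ y)) (+-identityˡ 0#))
  wedge-linearˡ x c y d ω (true  ∷ I) = trans (+-congˡ (-‿cong (wedge-linearˡ x (c ∘ suc) y (d ∘ suc) _ I)))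
    (solve 7 (λ x c W y d V ω → (x :* c :+ y :* d) :* ω :- (x :* W :+ y :* V)
       := x :* (c :* ω :- W) :+ y :* (d :* ω :- V)) refl x _ _ y _ _ _)
  wedge-linearˡ x c y d ω (false ∷ I) = wedge-linearˡ x (c ∘ suc) y (d ∘ suc) _ I

  wedge-sub : ∀ {n} (c : Vector Carrier n) x ω η I →
              wedge c (λ J → x * ω J - η J) I ≈ x * wedge c ω I - wedge c η I
  wedge-sub c x ω η I = trans (wedge-cong (λ _ → refl) (λ J → minus (x * ω J) (η J)) I)
    (trans (wedge-linearʳ c x ω (- 1#) η I) (sym (minus _ _)))
    where
    minus : ∀ u v → u - v ≈ u + (- 1#) * v
    minus = solve 2 (λ u v → u :- v := u :+ (:- :1) :* v) refl

  wedge-scaleʳ : ∀ {n} (c : Vector Carrier n) x ω I → wedge c (λ J → x * ω J) I ≈ x * wedge c ω I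
  wedge-scaleʳ c x ω I = trans (wedge-cong (λ _ → refl) (λ J → pad (ω J)) I)
    (trans (wedge-linearʳ c x ω 0# ω I) (sym (pad _)))
    where
    pad : ∀ u → x * u ≈ x * u + 0# * u
    pad = λ u → solve 2 (λ x u → x :* u := x :* u :+ :0 :* u) refl x u

  wedge-zeroʳ : ∀ {n} (c : Vector Carrier n) I → wedge c (λ _ → 0#) I ≈ 0#
  wedge-zeroʳ c I = trans (wedge-cong (λ _ → refl) (λ _ → sym (zeroˡ 0#)) I)
    (trans (wedge-scaleʳ c 0# (λ _ → 0#) I) (zeroˡ _))

  wedge-zeroˡ : ∀ {n} {c : Vector Carrier n} → (∀ i → c i ≈ 0#) → ∀ ω I → wedge c ω I ≈ 0#
  wedge-zeroˡ p ω []          = refl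
  wedge-zeroˡ p ω (true  ∷ I) =
    trans (+-cong (trans (*-congʳ (p zero)) (zeroˡ _)) (-‿cong (wedge-zeroˡ (p ∘ suc) _ I))) (-‿inverseʳ 0#)
  wedge-zeroˡ p ω (false ∷ I) = wedge-zeroˡ (p ∘ suc) _ I

  wedge-neg : ∀ {n} (c : Vector Carrier n) ω I → wedge c (λ J → - ω J) I ≈ - wedge c ω I
  wedge-neg c ω I = trans (wedge-cong (λ _ → refl) (λ J → minus (ω J)) I)
    (trans (wedge-scaleʳ c (- 1#) ω I) (sym (minus _)))
    where
    minus : ∀ u → - u ≈ (- 1#) * u
    minus = solve 1 (λ u → :- u := (:- :1) :* u) refl

  wedge-anticomm : ∀ {n} (c d : Vector Carrier n) ω I → wedge c (wedge d ω) I ≈ - wedge d (wedge c ω) I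
  wedge-anticomm c d ω []          = sym -0#≈0#
  wedge-anticomm c d ω (true  ∷ I) = begin
    c zero * D - wedge c′ (λ J → d zero * ωf J - wedge d′ ωt J) I ≈⟨ +-congˡ (-‿cong (wedge-sub c′ (d zero) ωf _ I)) ⟩
    c zero * D - (d zero * C - wedge c′ (wedge d′ ωt) I)
      ≈⟨ +-congˡ (-‿cong (+-congˡ (-‿cong (wedge-anticomm c′ d′ ωt I)))) ⟩
    c zero * D - (d zero * C - (- DC))                            ≈⟨ solve 5 (λ c D d C DC → c :* D :- (d :* C :- (:- DC))
                                                                       := :- (d :* C :- (c :* D :- DC))) refl
                                                                           (c zero) D (d zero) C DC ⟩
    - (d zero * C - (c zero * D - DC))
      ≈⟨ -‿cong (+-congˡ (-‿cong (wedge-sub d′ (c zero) ωf _ I))) ⟨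
    - (d zero * C - wedge d′ (λ J → c zero * ωf J - wedge c′ ωt J) I) ∎
    where
    c′ = c ∘ suc
    d′ = d ∘ suc
    ωf = ω ∘ (false ∷_)
    ωt = ω ∘ (true ∷_)
    C = wedge c′ ωf I
    D = wedge d′ ωf I
    DC = wedge d′ (wedge c′ ωt) I
  wedge-anticomm c d ω (false ∷ I) = wedge-anticomm (c ∘ suc) (d ∘ suc) _ I

  wedge-square : ∀ {n} (c : Vector Carrier n) ω I → wedge c (wedge c ω) I ≈ 0#
  wedge-square c ω []          = refl
  wedge-square c ω (true  ∷ I) = begin
    c zero * C - wedge (c ∘ suc) (λ J → c zero * ω (false ∷ J) - wedge (c ∘ suc) (ω ∘ (true ∷_)) J) I
      ≈⟨ +-congˡ (-‿cong (wedge-sub (c ∘ suc) (c zero) _ _ I)) ⟩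
    c zero * C - (c zero * C - wedge (c ∘ suc) (wedge (c ∘ suc) (ω ∘ (true ∷_))) I)
      ≈⟨ +-congˡ (-‿cong (+-congˡ (-‿cong (wedge-square (c ∘ suc) _ I)))) ⟩
    c zero * C - (c zero * C - 0#)
      ≈⟨ solve 1 (λ x → x :- (x :- :0) := :0) refl (c zero * C) ⟩
    0# ∎
    where C = wedge (c ∘ suc) (ω ∘ (false ∷_)) I
  wedge-square c ω (false ∷ I) = wedge-square (c ∘ suc) _ I

  -- Anticommuting past the later columns brings c j next to its own copy, where the square is zero.
  wedge-chain-repeated : ∀ {n} (c : ℕ → Vector Carrier n) {j m} → j ℕ.< m → ∀ I → wedge (c j) (chain c m) I ≈ 0#
  wedge-chain-repeated c {j} {suc m} j<1+m I with ℕ.m<1+n⇒m<n∨m≡n j<1+m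
  ... | inj₂ ≡.refl = wedge-square (c m) (chain c m) I
  ... | inj₁ j<m    = trans (wedge-anticomm (c j) (c m) (chain c m) I)
    (trans (-‿cong (trans (wedge-cong (λ _ → refl) (wedge-chain-repeated c j<m) I) (wedge-zeroʳ (c m) I))) -0#≈0#)

  sign : ℕ → Carrier
  sign m = (- 1#) ^ m

  sign-square : ∀ m → sign m * sign m ≈ 1#
  sign-square zero    = *-identityˡ 1#
  sign-square (suc m) = trans (solve 1 (λ s → ((:- :1) :* s) :* ((:- :1) :* s) := s :* s) refl (sign m)) (sign-square m)

  -- The column c 0 moves from the outermost to the innermost place past m columns, at the cost of
  -- one sign each. This is the source of the sign in LT.
  chain-rotate : ∀ {n} (c : ℕ → Vector Carrier n) m I →
                 wedge (c 0) (chain (c ∘ suc) m) I ≈ sign m * chain c (suc m) I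
  chain-rotate c zero    I = sym (*-identityˡ _)
  chain-rotate c (suc m) I = begin
    wedge (c 0) (wedge (c (suc m)) (chain (c ∘ suc) m)) I     ≈⟨ wedge-anticomm _ _ _ I ⟩
    - wedge (c (suc m)) (wedge (c 0) (chain (c ∘ suc) m)) I   ≈⟨ -‿cong (wedge-cong (λ _ → refl) (chain-rotate c m) I) ⟩
    - wedge (c (suc m)) (λ J → sign m * chain c (suc m) J) I  ≈⟨ -‿cong (wedge-scaleʳ _ _ _ I) ⟩
    - (sign m * chain c (suc (suc m)) I)
      ≈⟨ solve 2 (λ s x → :- (s :* x) := ((:- :1) :* s) :* x) refl _ _ ⟩
    sign (suc m) * chain c (suc (suc m)) I                    ∎

  chain-tail : ∀ {n} (c : ℕ → Vector Carrier (suc n)) m I → chain c m (false ∷ I) ≈ chain (λ j → c j ∘ suc) m I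
  chain-tail c zero    I = refl
  chain-tail c (suc m) I = wedge-cong (λ _ → refl) (chain-tail c m) I

  -- The interior product with the i-th coordinate form; `contract-wedge` is its antiderivation
  -- rule.
  contract : ∀ {n} → Fin n → Λ n → Λ n
  contract zero    ω (true  ∷ I) = 0#
  contract zero    ω (false ∷ I) = ω (true ∷ I)
  contract (suc i) ω (true  ∷ I) = - contract i (ω ∘ (true ∷_)) I
  contract (suc i) ω (false ∷ I) = contract i (ω ∘ (false ∷_)) I

  contract-sub : ∀ {n} (i : Fin n) x ω η I → contract i (λ J → x * ω J - η J) I ≈ x * contract i ω I - contract i η I
  contract-sub zero    x ω η (true  ∷ I) = solve 1 (λ x → :0 := x :* :0 :- :0) refl x
  contract-sub zero    x ω η (false ∷ I) = refl
  contract-sub (suc i) x ω η (true  ∷ I) = trans (-‿cong (contract-sub i x _ _ I))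
    (solve 3 (λ x u v → :- (x :* u :- v) := x :* (:- u) :- (:- v)) refl x _ _)
  contract-sub (suc i) x ω η (false ∷ I) = contract-sub i x _ _ I

  contract-wedge : ∀ {n} i (c : Vector Carrier n) ω I →
                   contract i (wedge c ω) I ≈ c i * ω I - wedge c (contract i ω) I
  contract-wedge zero    c ω (true  ∷ I) = sym (begin
    x - (x - wedge (c ∘ suc) (λ _ → 0#) I)  ≈⟨ +-congˡ (-‿cong (+-congˡ (-‿cong (wedge-zeroʳ (c ∘ suc) I)))) ⟩
    x - (x - 0#)                            ≈⟨ solve 1 (λ x → x :- (x :- :0) := :0) refl x ⟩
    0#                                      ∎)
    where x = c zero * ω (true ∷ I)
  contract-wedge zero    c ω (false ∷ I) = refl
  contract-wedge (suc i) c ω (true  ∷ I) = begin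
    - contract i (λ J → c zero * ωf J - wedge c′ ωt J) I       ≈⟨ -‿cong (contract-sub i (c zero) ωf _ I) ⟩
    - (c zero * F - contract i (wedge c′ ωt) I)                ≈⟨ -‿cong (+-congˡ (-‿cong (contract-wedge i c′ ωt I))) ⟩
    - (c zero * F - (c′ i * ωt I - G))
      ≈⟨ solve 4 (λ c F w G → :- (c :* F :- (w :- G)) := w :- (c :* F :- (:- G)))
                                                                    refl (c zero) F (c′ i * ωt I) G ⟩
    c′ i * ωt I - (c zero * F - (- G))
      ≈⟨ +-congˡ (-‿cong (+-congˡ (-‿cong (wedge-neg c′ (contract i ωt) I)))) ⟨
    c′ i * ωt I - (c zero * F - wedge c′ (λ J → - contract i ωt J) I) ∎
    where
    c′ = c ∘ suc
    ωf = ω ∘ (false ∷_)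
    ωt = ω ∘ (true ∷_)
    F = contract i ωf I
    G = wedge c′ (contract i ωt) I
  contract-wedge (suc i) c ω (false ∷ I) = contract-wedge i (c ∘ suc) _ I

  contract-top : ∀ {n} (i : Fin n) ω → top (contract i ω) ≈ 0#
  contract-top zero    ω = refl
  contract-top (suc i) ω = trans (-‿cong (contract-top i _)) -0#≈0#

  contract-zero : ∀ {n} (i : Fin n) I → contract i (λ _ → 0#) I ≈ 0#
  contract-zero zero    (true  ∷ I) = refl
  contract-zero zero    (false ∷ I) = refl
  contract-zero (suc i) (true  ∷ I) = trans (-‿cong (contract-zero i I)) -0#≈0#
  contract-zero (suc i) (false ∷ I) = contract-zero i I

  contract-1Λ : ∀ {n} (i : Fin n) I → contract i 1Λ I ≈ 0#
  contract-1Λ zero    (true  ∷ I) = refl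
  contract-1Λ zero    (false ∷ I) = refl
  contract-1Λ (suc i) (true  ∷ I) = trans (-‿cong (contract-zero i I)) -0#≈0#
  contract-1Λ (suc i) (false ∷ I) = contract-1Λ i I

  -- Membership in the exterior algebra of the submodule of vectors whose
  -- i-th and j-th coordinates agree; for i = 0 it says that contraction with
  -- the coordinate forms 0 and j agree on the part of ω without e₀.
  Symmetric : ∀ {n} → Fin n → Fin n → Λ n → Set b
  Symmetric zero    zero    ω = ⊤
  Symmetric zero    (suc j) ω = ∀ I → ω (true ∷ I) ≈ contract j (ω ∘ (false ∷_)) I
  Symmetric (suc i) zero    ω = ∀ I → ω (true ∷ I) ≈ contract i (ω ∘ (false ∷_)) I
  Symmetric (suc i) (suc j) ω = Symmetric i j (ω ∘ (true ∷_)) × Symmetric i j (ω ∘ (false ∷_))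

  private
    symmetric-sub₀ : ∀ {n} (j : Fin n) x (ω η : Λ (suc n)) →
      (∀ I → ω (true ∷ I) ≈ contract j (ω ∘ (false ∷_)) I) →
      (∀ I → η (true ∷ I) ≈ contract j (η ∘ (false ∷_)) I) →
      ∀ I → x * ω (true ∷ I) - η (true ∷ I) ≈ contract j (λ J → x * ω (false ∷ J) - η (false ∷ J)) I
    symmetric-sub₀ j x ω η p r I =
      trans (+-cong (*-congˡ (p I)) (-‿cong (r I))) (sym (contract-sub j x _ _ I))

    symmetric-wedge₀ : ∀ {n} (j : Fin n) (c : Vector Carrier (suc n)) ω → c zero ≈ c (suc j) →
      (∀ I → ω (true ∷ I) ≈ contract j (ω ∘ (false ∷_)) I) →
      ∀ I → wedge c ω (true ∷ I) ≈ contract j (wedge c ω ∘ (false ∷_)) I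
    symmetric-wedge₀ j c ω p s I = trans (+-cong (*-congʳ p) (-‿cong (wedge-cong (λ _ → refl) s I)))
      (sym (contract-wedge j (c ∘ suc) _ I))

  symmetric-sub : ∀ {n} (i j : Fin n) x ω η → Symmetric i j ω → Symmetric i j η → Symmetric i j (λ I → x * ω I - η I)
  symmetric-sub zero    zero    x ω η p       r         = tt
  symmetric-sub zero    (suc j) x ω η p       r         = symmetric-sub₀ j x ω η p r
  symmetric-sub (suc i) zero    x ω η p       r         = symmetric-sub₀ i x ω η p r
  symmetric-sub (suc i) (suc j) x ω η (p , p′) (r , r′) = symmetric-sub i j x (ω ∘ (true ∷_)) (η ∘ (true ∷_)) p r ,
      symmetric-sub i j x (ω ∘ (false ∷_)) (η ∘ (false ∷_)) p′ r′

  symmetric-wedge : ∀ {n} (i j : Fin n) c ω → c i ≈ c j → Symmetric i j ω → Symmetric i j (wedge c ω)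
  symmetric-wedge zero    zero    c ω p s        = tt
  symmetric-wedge zero    (suc j) c ω p s        = symmetric-wedge₀ j c ω p s
  symmetric-wedge (suc i) zero    c ω p s        = symmetric-wedge₀ i c ω (sym p) s
  symmetric-wedge (suc i) (suc j) c ω p (s , s′) =
      symmetric-sub i j (c zero) (ω ∘ (false ∷_)) (wedge (c ∘ suc) (ω ∘ (true ∷_))) s′
        (symmetric-wedge i j (c ∘ suc) (ω ∘ (true ∷_)) p s)
    , symmetric-wedge i j (c ∘ suc) (ω ∘ (false ∷_)) p s′

  symmetric-zero : ∀ {n} (i j : Fin n) → Symmetric i j (λ _ → 0#)
  symmetric-zero zero    zero    = tt
  symmetric-zero zero    (suc j) = λ I → sym (contract-zero j I)
  symmetric-zero (suc i) zero    = λ I → sym (contract-zero i I)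
  symmetric-zero (suc i) (suc j) = symmetric-zero i j , symmetric-zero i j

  symmetric-1Λ : ∀ {n} (i j : Fin n) → Symmetric i j 1Λ
  symmetric-1Λ zero    zero    = tt
  symmetric-1Λ zero    (suc j) = λ I → sym (contract-1Λ j I)
  symmetric-1Λ (suc i) zero    = λ I → sym (contract-1Λ i I)
  symmetric-1Λ (suc i) (suc j) = symmetric-zero i j , symmetric-1Λ i j

  symmetric-top : ∀ {n} {i j : Fin n} → i ≢ j → ∀ ω → Symmetric i j ω → top ω ≈ 0#
  symmetric-top {i = zero}  {zero}  i≢j ω s       = ⊥-elim (i≢j ≡.refl)
  symmetric-top {i = zero}  {suc j} i≢j ω s       = trans (s _) (contract-top j _)
  symmetric-top {i = suc i} {zero}  i≢j ω s       = trans (s _) (contract-top i _)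
  symmetric-top {i = suc i} {suc j} i≢j ω (s , _) = symmetric-top (i≢j ∘ ≡.cong suc) _ s

  -- Two rows are equal here, not two columns, so no square appears in the chain. Instead every
  -- column lies in the submodule of vectors with equal i-th and j-th coordinates, and its exterior
  -- algebra has no top coefficient.
  chain-alternating : ∀ {n} {i j : Fin n} → i ≢ j → (c : ℕ → Vector Carrier n) → (∀ l → c l i ≈ c l j) →
                      ∀ m → top (chain c m) ≈ 0#
  chain-alternating {i = i} {j} i≢j c p m = symmetric-top i≢j _ (symmetric m)
    where
    symmetric : ∀ m → Symmetric i j (chain c m)
    symmetric zero    = symmetric-1Λ i j
    symmetric (suc m) = symmetric-wedge i j (c m) _ (p m) (symmetric m)

  -- ω = x η + y θ on the coefficients involving eᵢ, and ω = η = θ elsewhere.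
  Combination : ∀ {n} → Fin n → Carrier → Carrier → Λ n → Λ n → Λ n → Set b
  Combination zero    x y ω η θ = (∀ I → ω (true ∷ I) ≈ x * η (true ∷ I) + y * θ (true ∷ I))
                                × (∀ I → ω (false ∷ I) ≈ η (false ∷ I)) × (∀ I → ω (false ∷ I) ≈ θ (false ∷ I))
  Combination (suc i) x y ω η θ = Combination i x y (ω ∘ (true ∷_)) (η ∘ (true ∷_)) (θ ∘ (true ∷_))
                                × Combination i x y (ω ∘ (false ∷_)) (η ∘ (false ∷_)) (θ ∘ (false ∷_))

  -- The scalars u, v, w are the entries of the three matrices in a row other than the i-th, where
  -- the matrices agree.
  combination-sub : ∀ {n} (i : Fin n) {x y u v w ω η θ ω′ η′ θ′} → u ≈ v → u ≈ w →
    Combination i x y ω η θ → Combination i x y ω′ η′ θ′ →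
    Combination i x y (λ I → u * ω I - ω′ I) (λ I → v * η I - η′ I) (λ I → w * θ I - θ′ I)
  combination-sub zero {x} {y} u≈v u≈w (p , r , s) (p′ , r′ , s′) =
      (λ I → trans (+-cong (trans (*-congˡ (p I)) (distribˡ _ _ _)) (-‿cong (p′ I)))
        (trans (+-congʳ (+-cong (*-congʳ u≈v) (*-congʳ u≈w)))
          (solve 8 (λ x y v w η θ η′ θ′ → (v :* (x :* η) :+ w :* (y :* θ)) :- (x :* η′ :+ y :* θ′)
             := x :* (v :* η :- η′) :+ y :* (w :* θ :- θ′)) refl x y _ _ _ _ _ _)))
    , (λ I → +-cong (*-cong u≈v (r I)) (-‿cong (r′ I)))
    , (λ I → +-cong (*-cong u≈w (s I)) (-‿cong (s′ I)))
  combination-sub (suc i) u≈v u≈w (p , r) (p′ , r′) = combination-sub i u≈v u≈w p p′ , combination-sub i u≈v u≈w r r′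

  combination-wedge : ∀ {n} (i : Fin n) {x y} {c d e : Vector Carrier n} {ω η θ} → c i ≈ x * d i + y * e i →
    (∀ j → j ≢ i → c j ≈ d j) → (∀ j → j ≢ i → c j ≈ e j) →
    Combination i x y ω η θ → Combination i x y (wedge c ω) (wedge d η) (wedge e θ)
  combination-wedge zero {x} {y} {c} {d} {e} {ω} {η} {θ} cᵢ c≈d c≈e (p , r , s) =
      (λ I → begin
        c zero * ω (false ∷ I) - wedge (c ∘ suc) (ω ∘ (true ∷_)) I
          ≈⟨ +-cong (trans (*-congʳ cᵢ) (distribʳ _ _ _)) (-‿cong (wedge-cong (λ _ → refl) p I)) ⟩
        (x * d zero * ω (false ∷ I) + y * e zero * ω (false ∷ I)) - wedge (c ∘ suc)
            (λ J → x * η (true ∷ J) + y * θ (true ∷ J)) I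
          ≈⟨ +-cong (+-cong (*-congˡ (r I)) (*-congˡ (s I))) (-‿cong (trans (wedge-linearʳ (c ∘ suc) x _ y _ I)
               (+-cong (*-congˡ (wedge-cong (λ j → c≈d (suc j) (λ ())) (λ _ → refl) I))
                       (*-congˡ (wedge-cong (λ j → c≈e (suc j) (λ ())) (λ _ → refl) I))))) ⟩
        (x * d zero * η (false ∷ I) + y * e zero * θ (false ∷ I)) -
          (x * wedge (d ∘ suc) (η ∘ (true ∷_)) I + y * wedge (e ∘ suc) (θ ∘ (true ∷_)) I)
          ≈⟨ solve 8 (λ x y d e η θ H T → (x :* d :* η :+ y :* e :* θ) :- (x :* H :+ y :* T)
               := x :* (d :* η :- H) :+ y :* (e :* θ :- T)) refl x y _ _ _ _ _ _ ⟩
        x * wedge d η (true ∷ I) + y * wedge e θ (true ∷ I) ∎)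
    , wedge-cong (λ j → c≈d (suc j) (λ ())) r
    , wedge-cong (λ j → c≈e (suc j) (λ ())) s
  combination-wedge (suc i) cᵢ c≈d c≈e (p , r) =
      combination-sub i (c≈d zero (λ ())) (c≈e zero (λ ())) r (tails p)
    , tails r
    where
    tails : ∀ {ω η θ} → _ → _
    tails {ω} {η} {θ} = combination-wedge i {ω = ω} {η} {θ} cᵢ
      (λ j j≢i → c≈d (suc j) (j≢i ∘ Fin.suc-injective)) (λ j j≢i → c≈e (suc j) (j≢i ∘ Fin.suc-injective))

  combination-zero : ∀ {n} (i : Fin n) {x y} → Combination i x y (λ _ → 0#) (λ _ → 0#) (λ _ → 0#)
  combination-zero zero {x} {y} = (λ _ → solve 2 (λ x y → :0 := x :* :0 :+ y :* :0) refl x y) , (λ _ → refl) , (λ _ → refl)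
  combination-zero (suc i)      = combination-zero i , combination-zero i

  combination-1Λ : ∀ {n} (i : Fin n) {x y} → Combination i x y 1Λ 1Λ 1Λ
  combination-1Λ zero {x} {y} = (λ _ → solve 2 (λ x y → :0 := x :* :0 :+ y :* :0) refl x y) , (λ _ → refl) , (λ _ → refl)
  combination-1Λ (suc i)      = combination-zero i , combination-1Λ i

  combination-top : ∀ {n} (i : Fin n) {x y} ω η θ → Combination i x y ω η θ → top ω ≈ x * top η + y * top θ
  combination-top zero    ω η θ (p , _) = p _
  combination-top (suc i) ω η θ (p , _) = combination-top i _ _ _ p

  -- A basis product contains eᵢ at most once, so row i enters each coefficient linearly or not at
  -- all.
  chain-combination : ∀ {n} (i : Fin n) x y (c d e : ℕ → Vector Carrier n) → (∀ l → c l i ≈ x * d l i + y * e l i) →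
    (∀ l j → j ≢ i → c l j ≈ d l j) → (∀ l j → j ≢ i → c l j ≈ e l j) →
    ∀ m → top (chain c m) ≈ x * top (chain d m) + y * top (chain e m)
  chain-combination i x y c d e cᵢ c≈d c≈e m = combination-top i _ _ _ (combination m)
    where
    combination : ∀ m → Combination i x y (chain c m) (chain d m) (chain e m)
    combination zero    = combination-1Λ i
    combination (suc m) = combination-wedge i (cᵢ m) (c≈d m) (c≈e m) (combination m)

module ExteriorHom (S : CommutativeRing a b) (S′ : CommutativeRing c d)
                   {φ : CommutativeRing.Carrier S → CommutativeRing.Carrier S′} (φ-isHom : IsRingHom S S′ φ) where
  private
    module S = Exterior S
  open RingLemmas S′
  open Exterior S′
  open HomLemmas S S′ φ-isHom

  wedge-homo : ∀ {n} c (ω : S.Λ n) I → φ (S.wedge c ω I) ≈ wedge (φ ∘ c) (φ ∘ ω) I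
  wedge-homo c ω []          = 0#-homo
  wedge-homo c ω (true  ∷ I) = trans (sub-homo _ _) (+-cong (*-homo _ _) (-‿cong (wedge-homo (c ∘ suc) _ I)))
  wedge-homo c ω (false ∷ I) = wedge-homo (c ∘ suc) _ I

  1Λ-homo : ∀ {n} (I : Vec Bool n) → φ (S.1Λ I) ≈ 1Λ I
  1Λ-homo []          = 1#-homo
  1Λ-homo (true  ∷ I) = 0#-homo
  1Λ-homo (false ∷ I) = 1Λ-homo I

  chain-homo : ∀ {n} (c : ℕ → Vector _ n) m I → φ (S.chain c m I) ≈ chain (λ j → φ ∘ c j) m I
  chain-homo c zero    I = 1Λ-homo I
  chain-homo c (suc m) I = trans (wedge-homo (c m) _ I) (wedge-cong (λ _ → refl) (chain-homo c m) I)

-- The q-polynomials Σⱼ pⱼXʲ with Xʲ acting as the j-th iterate of τ, and the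
-- determinants of the matrices (τʲxᵢ).
module Moore (S : CommutativeRing a b) {τ : CommutativeRing.Carrier S → CommutativeRing.Carrier S}
             (τ-isHom : IsRingHom S S τ) where
  open RingLemmas S
  open Exterior S
  private module τ = HomLemmas S S τ-isHom

  -- The leading coefficient 1 is implicit: the empty vector is the identity, and a vector of length
  -- n is monic of degree n in τ.
  twisted : ∀ {n} → Vec Carrier n → Carrier → Carrier
  twisted []      x = x
  twisted (a ∷ p) x = a * x + twisted p (τ x)

  twisted-cong : ∀ {n} (p : Vec Carrier n) {x y} → x ≈ y → twisted p x ≈ twisted p y
  twisted-cong []      r = r
  twisted-cong (a ∷ p) r = +-cong (*-congˡ r) (twisted-cong p (τ.⟦⟧-cong r))

  twisted-linear : ∀ {n} (p : Vec Carrier n) {x y} → τ x ≈ x → τ y ≈ y → ∀ s t →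
                   twisted p (x * s + y * t) ≈ x * twisted p s + y * twisted p t
  twisted-linear []      τx τy s t = refl
  twisted-linear (a ∷ p) {x} {y} τx τy s t = begin
    a * (x * s + y * t) + twisted p (τ (x * s + y * t))
      ≈⟨ +-congˡ (trans (twisted-cong p (trans (τ.+-homo _ _)
           (+-cong (trans (τ.*-homo x s) (*-congʳ τx)) (trans (τ.*-homo y t) (*-congʳ τy)))))
           (twisted-linear p τx τy (τ s) (τ t))) ⟩
    a * (x * s + y * t) + (x * twisted p (τ s) + y * twisted p (τ t))
      ≈⟨ solve 7 (λ a x s y t P Q → a :* (x :* s :+ y :* t) :+ (x :* P :+ y :* Q)
           := x :* (a :* s :+ P) :+ y :* (a :* t :+ Q)) refl a x s y t _ _ ⟩
    x * twisted (a ∷ p) s + y * twisted (a ∷ p) t ∎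

  iterate : ℕ → Carrier → Carrier
  iterate zero    x = x
  iterate (suc j) x = τ (iterate j x)

  columns : ∀ {n} → Vector Carrier n → ℕ → Vector Carrier n
  columns x j i = iterate j (x i)

  moore : ∀ {n} → Vector Carrier n → Carrier
  moore {n} x = top (chain (columns x) n)

  iterate-cong : ∀ j {x y} → x ≈ y → iterate j x ≈ iterate j y
  iterate-cong zero    p = p
  iterate-cong (suc j) p = τ.⟦⟧-cong (iterate-cong j p)

  moore-cong : ∀ {n} {x y : Vector Carrier n} → (∀ i → x i ≈ y i) → moore x ≈ moore y
  moore-cong {n} p = chain-cong (λ j i → iterate-cong j (p i)) n (replicate n true)

  moore-alternating : ∀ {n} (x : Vector Carrier n) {i j} → i ≢ j → x i ≈ x j → moore x ≈ 0#
  moore-alternating {n} x i≢j p = chain-alternating i≢j (columns x) (λ l → iterate-cong l p) n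

  moore-combination : ∀ {n} (i : Fin n) {x y} → τ x ≈ x → τ y ≈ y → (r s t : Vector Carrier n) →
    r i ≈ x * s i + y * t i → (∀ j → j ≢ i → r j ≈ s j) → (∀ j → j ≢ i → r j ≈ t j) →
    moore r ≈ x * moore s + y * moore t
  moore-combination {n} i {x} {y} τx τy r s t rᵢ r≈s r≈t =
    chain-combination i x y (columns r) (columns s) (columns t)
      (λ l → trans (iterate-cong l rᵢ) (iterate-linear l _ _))
      (λ l j j≢i → iterate-cong l (r≈s j j≢i)) (λ l j j≢i → iterate-cong l (r≈t j j≢i)) n
    where
    iterate-linear : ∀ l u v → iterate l (x * u + y * v) ≈ x * iterate l u + y * iterate l v
    iterate-linear zero    u v = refl
    iterate-linear (suc l) u v = trans (τ.⟦⟧-cong (iterate-linear l u v)) (trans (τ.+-homo _ _)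
      (+-cong (trans (τ.*-homo x _) (*-congʳ τx)) (trans (τ.*-homo y _) (*-congʳ τy))))

  moore-scale : ∀ {n x} → τ x ≈ x → (s : Vector Carrier n) → moore (λ i → x * s i) ≈ x ^ n * moore s
  moore-scale {n} {x} τx s = scaled n (replicate n true)
    where
    iterate-scale : ∀ j u → iterate j (x * u) ≈ x * iterate j u + 0# * iterate j u
    -- The summand with coefficient 0 gives a multiple the shape that `wedge-linearˡ` accepts.
    iterate-scale zero    u = solve 2 (λ x u → x :* u := x :* u :+ :0 :* u) refl x u
    iterate-scale (suc j) u = trans (τ.⟦⟧-cong
        (trans (iterate-scale j u) (solve 2 (λ x u → x :* u :+ :0 :* u := x :* u) refl x _)))
      (trans (trans (τ.*-homo x _) (*-congʳ τx)) (solve 2 (λ x u → x :* u := x :* u :+ :0 :* u) refl x _))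
    scaled : ∀ m I → chain (columns (λ i → x * s i)) m I ≈ x ^ m * chain (columns s) m I
    scaled zero    I = sym (*-identityˡ _)
    scaled (suc m) I = begin
      wedge (columns (λ i → x * s i) m) (chain (columns (λ i → x * s i)) m) I
        ≈⟨ wedge-cong (λ i → iterate-scale m (s i)) (scaled m) I ⟩
      wedge (λ i → x * columns s m i + 0# * columns s m i) (λ J → x ^ m * chain (columns s) m J) I
        ≈⟨ trans (wedge-linearˡ x (columns s m) 0# (columns s m) _ I)
             (+-cong (*-congˡ (wedge-scaleʳ (columns s m) (x ^ m) _ I)) (*-congˡ (wedge-scaleʳ (columns s m) (x ^ m) _ I))) ⟩
      x * (x ^ m * W) + 0# * (x ^ m * W)
        ≈⟨ solve 3 (λ x y W → x :* (y :* W) :+ :0 :* (y :* W) := (x :* y) :* W) refl x (x ^ m) W ⟩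
      (x * x ^ m) * W ∎
      where W = chain (columns s) (suc m) I

  -- The lower terms of the q-polynomial contribute the columns c j, ..., c (m-1), all of them
  -- already in the chain. Only the leading term survives, and it is the column c m.
  wedge-twisted : ∀ {n l} (c : ℕ → Vector Carrier n) → (∀ j i → τ (c j i) ≈ c (suc j) i) →
                  ∀ (p : Vec Carrier l) j {m} → j ℕ.+ l ≡ m → ∀ I →
                  wedge (λ i → twisted p (c j i)) (chain c m) I ≈ chain c (suc m) I
  wedge-twisted c τc []      j ≡.refl I rewrite ℕ.+-identityʳ j = refl
  wedge-twisted {l = suc l} c τc (a ∷ p) j {m} eq I = begin
    wedge (λ i → a * c j i + twisted p (τ (c j i))) (chain c m) I
      ≈⟨ wedge-cong (λ i → +-congˡ (trans (twisted-cong p (τc j i)) (sym (*-identityˡ _)))) (λ _ → refl) I ⟩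
    wedge (λ i → a * c j i + 1# * twisted p (c (suc j) i)) (chain c m) I
      ≈⟨ wedge-linearˡ a (c j) 1# (λ i → twisted p (c (suc j) i)) (chain c m) I ⟩
    a * wedge (c j) (chain c m) I + 1# * wedge (λ i → twisted p (c (suc j) i)) (chain c m) I
      ≈⟨ +-cong (trans (*-congˡ (wedge-chain-repeated c j<m I)) (zeroʳ a))
                (trans (*-identityˡ _) (wedge-twisted c τc p (suc j) (≡.trans (≡.sym (ℕ.+-suc j l)) eq) I)) ⟩
    0# + chain c (suc m) I
      ≈⟨ +-identityˡ _ ⟩
    chain c (suc m) I ∎
    where
    j<m : j ℕ.< m
    j<m = ≡.subst (suc j ℕ.≤_) (≡.trans (≡.sym (ℕ.+-suc j l)) eq) (ℕ.m≤m+n (suc j) l)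

  -- The columns τx, ..., τᵐx alone: wedging with a vector puts it in the place of the column x, up
  -- to the sign of `moore-rotate`.
  twistedChain : ∀ {m} → Vector Carrier (suc m) → Λ (suc m)
  twistedChain {m} x = chain (columns x ∘ suc) m

  moore-rotate : ∀ {m} (x : Vector Carrier (suc m)) → moore x ≈ sign m * top (wedge x (twistedChain x))
  moore-rotate {m} x = sym (trans (*-congˡ (chain-rotate (columns x) m (replicate (suc m) true)))
    (trans (sym (*-assoc _ _ _)) (trans (*-congʳ (sign-square m)) (*-identityˡ _))))

  -- By linearity in the wedged column, the term a x gives back the determinant with factor a. Of
  -- the remaining terms only the leading one, τ^(m+1)x, is not a repeated column, and it completes
  -- the chain to its image under τ.
  moore-twisted : ∀ {m} (a : Carrier) (p : Vec Carrier m) (x : Vector Carrier (suc m)) →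
                  a * moore x + sign m * τ (moore x) ≈ sign m * top (wedge (λ i → twisted (a ∷ p) (x i)) (twistedChain x))
  moore-twisted {m} a p x = sym (begin
    sign m * wedge (λ i → a * x i + twisted p (τ (x i))) W ⊤′
      ≈⟨ *-congˡ (trans (wedge-cong {ω = W} (λ i → +-congˡ {a * x i} (sym (*-identityˡ (twisted p (τ (x i))))))
          (λ _ → refl) ⊤′)
           (wedge-linearˡ a x 1# (λ i → twisted p (τ (x i))) W ⊤′)) ⟩
    sign m * (a * wedge x W ⊤′ + 1# * wedge (λ i → twisted p (τ (x i))) W ⊤′)
      ≈⟨ *-congˡ (+-congˡ (*-congˡ (trans (wedge-twisted (columns x ∘ suc) (λ _ _ → refl) p 0 ≡.refl ⊤′)
           (sym (chain-homo (columns x) (suc m) ⊤′))))) ⟩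
    sign m * (a * wedge x W ⊤′ + 1# * τ (moore x))
      ≈⟨ solve 4 (λ s a w t → s :* (a :* w :+ :1 :* t) := a :* (s :* w) :+ s :* t) refl _ a _ _ ⟩
    a * (sign m * wedge x W ⊤′) + sign m * τ (moore x)
      ≈⟨ +-congʳ (*-congˡ (moore-rotate x)) ⟨
    a * moore x + sign m * τ (moore x) ∎)
    where
    open ExteriorHom S S τ-isHom
    W = twistedChain x
    ⊤′ = replicate (suc m) true

  -- The factor t moves into the column of values of the q-polynomial, which becomes x - y; the part
  -- x restores the determinant itself.
  moore-eigen : ∀ {m} (t a : Carrier) (p : Vec Carrier m) (x y : Vector Carrier (suc m)) →
                (∀ i → t * twisted (a ∷ p) (x i) ≈ x i - y i) →
                t * (a * moore x + sign m * τ (moore x)) ≈ moore x - sign m * top (wedge y (twistedChain x))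
  moore-eigen {m} t a p x y eigen = begin
    t * (a * moore x + sign m * τ (moore x))
      ≈⟨ *-congˡ (moore-twisted a p x) ⟩
    t * (sign m * top (wedge E W))
      ≈⟨ solve 3 (λ t s w → t :* (s :* w) := s :* (t :* w :+ :0 :* w)) refl t (sign m) _ ⟩
    sign m * (t * top (wedge E W) + 0# * top (wedge E W))
      ≈⟨ *-congˡ (wedge-linearˡ t E 0# E W ⊤′) ⟨
    sign m * top (wedge (λ i → t * E i + 0# * E i) W)
      ≈⟨ *-congˡ (wedge-cong {ω = W} (λ i → trans (solve 2 (λ t e → t :* e :+ :0 :* e := t :* e) refl t (E i))
           (trans (eigen i) (minus (x i) (y i)))) (λ _ → refl) ⊤′) ⟩
    sign m * top (wedge (λ i → 1# * x i + (- 1#) * y i) W)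
      ≈⟨ *-congˡ (wedge-linearˡ 1# x (- 1#) y W ⊤′) ⟩
    sign m * (1# * top (wedge x W) + (- 1#) * top (wedge y W))
      ≈⟨ solve 3 (λ s u v → s :* (:1 :* u :+ (:- :1) :* v) := s :* u :- s :* v) refl (sign m) _ _ ⟩
    sign m * top (wedge x W) - sign m * top (wedge y W)
      ≈⟨ +-congʳ (moore-rotate x) ⟨
    moore x - sign m * top (wedge y W) ∎
    where
    W = twistedChain x
    ⊤′ = replicate (suc m) true
    E : Vector Carrier (suc m)
    E i = twisted (a ∷ p) (x i)
    minus : ∀ u v → u - v ≈ 1# * u + (- 1#) * v
    minus = solve 2 (λ u v → u :- v := :1 :* u :+ (:- :1) :* v) refl

  -- Column operations turn the last column into the values of the q-polynomial, which vanish
  -- outside row 0. Expanding along it leaves the other rows with the first n columns; as this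
  -- column is outermost and the row is the first, no sign appears.
  moore-expand : ∀ {n} (p : Vec Carrier n) (x : Vector Carrier (suc n)) → (∀ i → twisted p (x (suc i)) ≈ 0#) →
                 moore x ≈ twisted p (x zero) * moore (x ∘ suc)
  moore-expand {n} p x root = begin
    chain (columns x) (suc n) ⊤′
      ≈⟨ wedge-twisted (columns x) (λ _ _ → refl) p 0 ≡.refl ⊤′ ⟨
    twisted p (x zero) * chain (columns x) n (false ∷ replicate n true) - wedge (λ i → twisted p (x (suc i))) _
        (replicate n true)
      ≈⟨ +-cong (*-congˡ (chain-tail (columns x) n (replicate n true))) (-‿cong (wedge-zeroˡ root _ (replicate n true))) ⟩
    twisted p (x zero) * moore (x ∘ suc) - 0#
      ≈⟨ solve 1 (λ x → x :- :0 := x) refl _ ⟩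
    twisted p (x zero) * moore (x ∘ suc) ∎
    where ⊤′ = replicate (suc n) true

module MooreHom (S : CommutativeRing a b) {τ : CommutativeRing.Carrier S → CommutativeRing.Carrier S}
                (τ-isHom : IsRingHom S S τ)
                (S′ : CommutativeRing c d) {τ′ : CommutativeRing.Carrier S′ → CommutativeRing.Carrier S′}
                (τ′-isHom : IsRingHom S′ S′ τ′)
                {φ : CommutativeRing.Carrier S → CommutativeRing.Carrier S′} (φ-isHom : IsRingHom S S′ φ)
                (φτ≈τ′φ : ∀ x → CommutativeRing._≈_ S′ (φ (τ x)) (τ′ (φ x))) where
  private
    module S = Moore S τ-isHom
    module τ′ = HomLemmas S′ S′ τ′-isHom
  open RingLemmas S′
  open Exterior S′
  open Moore S′ τ′-isHom
  open HomLemmas S S′ φ-isHom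
  open ExteriorHom S S′ φ-isHom

  iterate-homo : ∀ j x → φ (S.iterate j x) ≈ iterate j (φ x)
  iterate-homo zero    x = refl
  iterate-homo (suc j) x = trans (φτ≈τ′φ _) (τ′.⟦⟧-cong (iterate-homo j x))

  moore-homo : ∀ {n} (x : Vector _ n) → φ (S.moore x) ≈ moore (φ ∘ x)
  moore-homo {n} x = trans (chain-homo (S.columns x) n (replicate n true))
    (chain-cong (λ j i → iterate-homo j (x i)) n (replicate n true))

  twisted-homo : ∀ {n} (p : Vec _ n) x → φ (S.twisted p x) ≈ twisted (map φ p) (φ x)
  twisted-homo []      x = refl
  twisted-homo (a ∷ p) x = trans (+-homo _ _)
    (+-cong (*-homo a x) (trans (twisted-homo p _) (twisted-cong (map φ p) (φτ≈τ′φ x))))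

-- q-polynomials

module _ (R : CommutativeRing a b) where
  open RingLemmas R

  ∏-+ : ∀ m {n} (t : Vector Carrier (m ℕ.+ n)) →
        ∏[ i < m ℕ.+ n ] t i ≈ (∏[ i < m ] t (i ↑ˡ n)) * (∏[ j < n ] t (m ↑ʳ j))
  ∏-+ zero    t = sym (*-identityˡ _)
  ∏-+ (suc m) t = trans (*-congˡ (∏-+ m (t ∘ suc))) (sym (*-assoc _ _ _))

  ∏-combine : ∀ m n (t : Vector Carrier (m ℕ.* n)) →
              ∏[ i < m ℕ.* n ] t i ≈ ∏[ i < m ] ∏[ j < n ] t (combine i j)
  ∏-combine zero    n t = refl
  ∏-combine (suc m) n t = trans (∏-+ n t) (*-congˡ (∏-combine m n (t ∘ (n ↑ʳ_))))

  record IsIdeal (J : Carrier → Set e) : Set (a ⊔ b ⊔ e) where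
    field
      resp     : ∀ {x y} → x ≈ y → J x → J y
      0-in     : J 0#
      +-closed : ∀ {x y} → J x → J y → J (x + y)
      *-closed : ∀ x {y} → J y → J (x * y)

    *-closedʳ : ∀ x {y} → J y → J (y * x)
    *-closedʳ x p = resp (*-comm _ _) (*-closed x p)

    neg-closed : ∀ {x} → J x → J (- x)
    neg-closed p = resp (solve 1 (λ x → (:- :1) :* x := :- x) refl _) (*-closed (- 1#) p)

    ^-closed : ∀ {x} n → J x → J (x ^ suc n)
    ^-closed n p = *-closedʳ _ p

module QPolynomials {q : ℕ} (k : FiniteField q a b) (R : CommutativeRing c d)
                    {κ : CommutativeRing.Carrier (FiniteField.ring k) → CommutativeRing.Carrier R}
                    (κ-isHom : IsRingHom (FiniteField.ring k) R κ) where
  open FiniteFieldLemmas using (nontrivial)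
  open RingLemmas R
  open FqAlgebra k R κ-isHom
  open MonicForms R using (addHead)
  open Moore R frobenius-isHom
  open Exterior R using (sign)
  open Inverse (FiniteField.elements k) using () renaming (to to element)
  private module Frobenius = HomLemmas R R frobenius-isHom

  -- The composite (τ - c) ∘ p in the twisted polynomial ring, where τ a = a^q τ.
  frobeniusMinus : ∀ {n} → Carrier → Vec Carrier n → Vec Carrier (suc n)
  frobeniusMinus c []      = (- c) ∷ []
  frobeniusMinus c (a ∷ p) = (- (c * a)) ∷ addHead (a ^ q) (frobeniusMinus c p)

  twisted-addHead : ∀ {n} a (p : Vec Carrier (suc n)) x → twisted (addHead a p) x ≈ a * x + twisted p x
  twisted-addHead a (b ∷ p) x = solve 4 (λ a b x P → (b :+ a) :* x :+ P := a :* x :+ (b :* x :+ P)) refl a b x _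

  twisted-frobeniusMinus : ∀ {n} c (p : Vec Carrier n) x →
                           twisted (frobeniusMinus c p) x ≈ twisted p x ^ q - c * twisted p x
  twisted-frobeniusMinus c []      x = solve 3 (λ c x X → (:- c) :* x :+ X := X :- c :* x) refl c x (x ^ q)
  twisted-frobeniusMinus c (a ∷ p) x = begin
    (- (c * a)) * x + twisted (addHead (a ^ q) (frobeniusMinus c p)) (x ^ q)
      ≈⟨ +-congˡ (trans (twisted-addHead (a ^ q) (frobeniusMinus c p) (x ^ q))
          (+-congˡ (twisted-frobeniusMinus c p (x ^ q)))) ⟩
    (- (c * a)) * x + (a ^ q * x ^ q + (P ^ q - c * P))
      ≈⟨ solve 6 (λ c a x AX Q P → (:- (c :* a)) :* x :+ (AX :+ (Q :- c :* P)) := (AX :+ Q) :- c :* (a :* x :+ P))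
           refl c a x (a ^ q * x ^ q) (P ^ q) P ⟩
    (a ^ q * x ^ q + P ^ q) - c * (a * x + P)
      ≈⟨ +-congʳ (trans (frobenius-+ (a * x) P) (+-congʳ (^-distrib-* a x q))) ⟨
    (a * x + P) ^ q - c * (a * x + P) ∎
    where P = twisted p (x ^ q)

  -- The q-polynomial of the span of the yᵢ, counted with multiplicity. If w is the value at y₀ of
  -- the one for the other yᵢ, composing with τ - w^(q-1) kills w and hence y₀.
  annihilator : ∀ {n} → Vector Carrier n → Vec Carrier n
  annihilator {zero}  y = []
  annihilator {suc n} y = frobeniusMinus (twisted p (y zero) ^ ℕ.pred q) p
    where p = annihilator (y ∘ suc)

  twisted-zero : ∀ {n} (p : Vec Carrier n) → twisted p 0# ≈ 0#
  twisted-zero []      = refl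
  twisted-zero (a ∷ p) = trans (+-cong (zeroʳ a) (trans (twisted-cong p 0^q) (twisted-zero p))) (+-identityˡ 0#)

  annihilator-root : ∀ {n} (y : Vector Carrier n) i → twisted (annihilator y) (y i) ≈ 0#
  annihilator-root {suc n} y i = trans (twisted-frobeniusMinus _ p (y i)) (root i)
    where
    p = annihilator (y ∘ suc)
    w = twisted p (y zero)
    root : ∀ i → twisted p (y i) ^ q - w ^ ℕ.pred q * twisted p (y i) ≈ 0#
    root zero with r , ≡.refl ← nontrivial k = trans (+-congˡ (-‿cong (*-comm _ _))) (-‿inverseʳ _)
    root (suc i) = begin
      twisted p (y (suc i)) ^ q - w ^ ℕ.pred q * twisted p (y (suc i))
        ≈⟨ +-cong (trans (^-congˡ q (annihilator-root (y ∘ suc) i)) 0^q) (-‿cong (*-congˡ (annihilator-root (y ∘ suc) i))) ⟩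
      0# - w ^ ℕ.pred q * 0#
        ≈⟨ solve 1 (λ w → :0 :- w :* :0 := :0) refl _ ⟩
      0# ∎

  moore-annihilator : ∀ {n} (y : Vector Carrier (suc n)) →
                      moore y ≈ twisted (annihilator (y ∘ suc)) (y zero) * moore (y ∘ suc)
  moore-annihilator y = moore-expand (annihilator (y ∘ suc)) y (annihilator-root (y ∘ suc))

  -- Each adjunction multiplies the linear coefficient by -w^(q-1), while by `moore-annihilator` it
  -- multiplies the Moore determinant by w.
  head-annihilator : ∀ {n} (y : Vector Carrier (suc n)) →
                     head (annihilator y) ≈ sign (suc n) * moore y ^ ℕ.pred q
  head-annihilator {zero}  y = begin
    - (y zero ^ ℕ.pred q)                      ≈⟨ solve 1 (λ w → :- w := ((:- :1) :* :1) :* w) refl _ ⟩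
    ((- 1#) * 1#) * y zero ^ ℕ.pred q
      ≈⟨ *-congˡ (^-congˡ (ℕ.pred q) (trans (moore-annihilator y) (*-identityʳ _))) ⟨
    ((- 1#) * 1#) * moore y ^ ℕ.pred q         ∎
  head-annihilator {suc n} y = begin
    head (frobeniusMinus (w ^ ℕ.pred q) p)     ≈⟨ head-frobeniusMinus (w ^ ℕ.pred q) p ⟩
    - (w ^ ℕ.pred q * head p)                  ≈⟨ -‿cong (*-congˡ (head-annihilator (y ∘ suc))) ⟩
    - (w ^ ℕ.pred q * (s * M ^ ℕ.pred q))
      ≈⟨ solve 3 (λ w s M → :- (w :* (s :* M)) := ((:- :1) :* s) :* (w :* M)) refl _ s _ ⟩
    ((- 1#) * s) * (w ^ ℕ.pred q * M ^ ℕ.pred q)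
      ≈⟨ *-congˡ (trans (^-congˡ (ℕ.pred q) (moore-annihilator y)) (^-distrib-* w M (ℕ.pred q))) ⟨
    ((- 1#) * s) * moore y ^ ℕ.pred q          ∎
    where
    p = annihilator (y ∘ suc)
    w = twisted p (y zero)
    s = sign (suc n)
    M = moore (y ∘ suc)
    head-frobeniusMinus : ∀ {n} c (p : Vec Carrier (suc n)) → head (frobeniusMinus c p) ≈ - (c * head p)
    head-frobeniusMinus c (a ∷ p) = refl

  combination : ∀ {n} → Vector Carrier n → Vector (Fin q) n → Carrier
  combination {n} y i = ∑[ j < n ] (κ (element (i j)) * y j)

  -- Grouping the factors by the coefficient ζ of y₀, each inner product is by induction a value of
  -- the smaller q-polynomial, which is linear over k. The outer product over ζ is then the one of
  -- `linear-factors`.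
  annihilator-product : ∀ {n} (y : Vector Carrier n) x →
                        ∏[ t < q ℕ.^ n ] (x - combination y (finToFun t)) ≈ twisted (annihilator y) x
  annihilator-product {zero}  y x = solve 1 (λ x → (x :- :0) :* :1 := x) refl x
  annihilator-product {suc n} y x = begin
    ∏[ t < q ℕ.* q ℕ.^ n ] (x - combination y (finToFun t))
      ≈⟨ ∏-combine R q (q ℕ.^ n) _ ⟩
    ∏[ i < q ] ∏[ s < q ℕ.^ n ] (x - combination y (finToFun (combine i s)))
      ≈⟨ ∏.sum-cong-≋ (λ i → ∏.sum-cong-≋ (split i)) ⟩
    ∏[ i < q ] ∏[ s < q ℕ.^ n ] ((x - κ (element i) * y zero) - combination (y ∘ suc) (finToFun s))
      ≈⟨ ∏.sum-cong-≋ (λ i → trans (annihilator-product (y ∘ suc) _) (linear i)) ⟩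
    ∏[ i < q ] (twisted p x - κ (element i) * w)
      ≈⟨ linear-factors (twisted p x) w ⟩
    twisted p x ^ q - w ^ ℕ.pred q * twisted p x
      ≈⟨ twisted-frobeniusMinus _ p x ⟨
    twisted (annihilator y) x ∎
    where
    p = annihilator (y ∘ suc)
    w = twisted p (y zero)
    split : ∀ i s → x - combination y (finToFun (combine i s)) ≈
                    (x - κ (element i) * y zero) - combination (y ∘ suc) (finToFun s)
    split i s = trans (+-congˡ (-‿cong (+-cong (reflexive (≡.cong (λ j → κ (element j) * y zero) (≡.cong proj₁ eq)))
        (sum-cong-≋ λ j → reflexive (≡.cong (λ t → κ (element (finToFun t j)) * y (suc j)) (≡.cong proj₂ eq))))))
      (solve 3 (λ x u v → x :- (u :+ v) := (x :- u) :- v) refl x _ _)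
      where eq = Fin.remQuot-combine {q} {q ℕ.^ n} i s
    linear : ∀ i → twisted p (x - κ (element i) * y zero) ≈ twisted p x - κ (element i) * w
    linear i = begin
      twisted p (x - κ (element i) * y zero)
        ≈⟨ twisted-cong p (minus x (y zero)) ⟩
      twisted p (1# * x + (- κ (element i)) * y zero)
        ≈⟨ twisted-linear p (1^n≈1 q) (trans (Frobenius.-‿homo _) (-‿cong (frobenius-κ (element i)))) x (y zero) ⟩
      1# * twisted p x + (- κ (element i)) * w
        ≈⟨ minus (twisted p x) w ⟨
      twisted p x - κ (element i) * w ∎
      where
      minus : ∀ u v → u - κ (element i) * v ≈ 1# * u + (- κ (element i)) * v
      minus u v = solve 3 (λ z u v → u :- z :* v := :1 :* u :+ (:- z) :* v) refl (κ (element i)) u v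

  module _ {J : Carrier → Set e} (isIdeal : IsIdeal R J) where
    open IsIdeal isIdeal

    q-closed : ∀ {x} → J x → J (x ^ q)
    q-closed p with r , ≡.refl ← nontrivial k = ^-closed (suc r) p

    pred-q-closed : ∀ {x} → J x → J (x ^ ℕ.pred q)
    pred-q-closed p with r , ≡.refl ← nontrivial k = ^-closed r p

    twisted-closed : ∀ {n} (p : Vec Carrier n) {x} → J x → J (twisted p x)
    twisted-closed []      x∈J = x∈J
    twisted-closed (a ∷ p) x∈J = +-closed (*-closed a x∈J) (twisted-closed p (q-closed x∈J))

    frobeniusMinus-closed : ∀ {n c} {p : Vec Carrier n} → J c → All J p → All J (frobeniusMinus c p)
    frobeniusMinus-closed c∈J []         = neg-closed c∈J ∷ []
    frobeniusMinus-closed c∈J (a∈J ∷ p∈J) =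
      neg-closed (*-closed _ a∈J) ∷ addHead-closed (q-closed a∈J) (frobeniusMinus-closed c∈J p∈J)
      where
      addHead-closed : ∀ {n a} {p : Vec Carrier (suc n)} → J a → All J p → All J (addHead a p)
      addHead-closed {p = _ ∷ _} a∈J (b∈J ∷ p∈J) = +-closed b∈J a∈J ∷ p∈J

    -- The scalar c = w^(q-1) lies in the ideal because q - 1 ≥ 1. The lower coefficients of (τ - c)
    -- ∘ p are built from multiples of c and q-th powers of lower coefficients of p.
    annihilator-closed : ∀ {n} (y : Vector Carrier n) → (∀ i → J (y i)) → All J (annihilator y)
    annihilator-closed {zero}  y y∈J = []
    annihilator-closed {suc n} y y∈J = frobeniusMinus-closed
      (pred-q-closed (twisted-closed (annihilator (y ∘ suc)) (y∈J zero))) (annihilator-closed (y ∘ suc) (y∈J ∘ suc))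

  frobeniusMinus-cong : ∀ {n c c′} {p p′ : Vec Carrier n} → c ≈ c′ → Pointwise _≈_ p p′ →
                        Pointwise _≈_ (frobeniusMinus c p) (frobeniusMinus c′ p′)
  frobeniusMinus-cong c≈c′ []           = -‿cong c≈c′ ∷ []
  frobeniusMinus-cong c≈c′ (a≈a′ ∷ p≈p′) =
    -‿cong (*-cong c≈c′ a≈a′) ∷ addHead-cong (^-congˡ q a≈a′) (frobeniusMinus-cong c≈c′ p≈p′)
    where
    addHead-cong : ∀ {n a a′} {p p′ : Vec Carrier (suc n)} → a ≈ a′ → Pointwise _≈_ p p′ →
                   Pointwise _≈_ (addHead a p) (addHead a′ p′)
    addHead-cong {p = _ ∷ _} {_ ∷ _} a≈a′ (b≈b′ ∷ p≈p′) = +-cong b≈b′ a≈a′ ∷ p≈p′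

  twisted-cong-coefficients : ∀ {n} {p p′ : Vec Carrier n} → Pointwise _≈_ p p′ → ∀ x → twisted p x ≈ twisted p′ x
  twisted-cong-coefficients []             x = refl
  twisted-cong-coefficients (a≈a′ ∷ p≈p′) x = +-cong (*-congʳ a≈a′) (twisted-cong-coefficients p≈p′ (x ^ q))

  sum≈twisted : ∀ {A : Set e} (⟦_⟧ : A → Carrier) {n} (v : Vec A n) y → ⟦ y ⟧ ≈ 1# → ∀ x →
                ∑[ j ≤ n ] (⟦ lookup (v ∷ʳ y) j ⟧ * x ^ (q ℕ.^ toℕ j)) ≈ twisted (map ⟦_⟧ v) x
  sum≈twisted ⟦_⟧ []      y y≈1 x = trans (+-identityʳ _) (trans (*-cong y≈1 (*-identityʳ x)) (*-identityˡ x))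
  sum≈twisted ⟦_⟧ {suc n} (a ∷ v) y y≈1 x = +-cong (*-congˡ (*-identityʳ x))
    (trans (sum-cong-≋ {suc n} λ j → *-congˡ {⟦ lookup (v ∷ʳ y) j ⟧} (sym (^-assocʳ x q (q ℕ.^ toℕ j))))
        (sum≈twisted ⟦_⟧ v y y≈1 (x ^ q)))

module QPolynomialsHom {q : ℕ} (k : FiniteField q a b) (R : CommutativeRing c d)
                       {κ : CommutativeRing.Carrier (FiniteField.ring k) → CommutativeRing.Carrier R}
                       (κ-isHom : IsRingHom (FiniteField.ring k) R κ)
                       (R′ : CommutativeRing e f)
                       {κ′ : CommutativeRing.Carrier (FiniteField.ring k) → CommutativeRing.Carrier R′}
                       (κ′-isHom : IsRingHom (FiniteField.ring k) R′ κ′)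
                       {φ : CommutativeRing.Carrier R → CommutativeRing.Carrier R′} (φ-isHom : IsRingHom R R′ φ) where
  private
    module R = RingLemmas R
    module Q = QPolynomials k R κ-isHom
    module F = FqAlgebra k R κ-isHom
    module F′ = FqAlgebra k R′ κ′-isHom
  open RingLemmas R′
  open QPolynomials k R′ κ′-isHom
  open HomLemmas R R′ φ-isHom
  open Moore R′ F′.frobenius-isHom using (twisted-cong)
  open MooreHom R F.frobenius-isHom R′ F′.frobenius-isHom φ-isHom (λ x → ^-homo x q) public

  frobeniusMinus-homo : ∀ {n} x (p : Vec R.Carrier n) →
                        Pointwise _≈_ (map φ (Q.frobeniusMinus x p)) (frobeniusMinus (φ x) (map φ p))
  frobeniusMinus-homo x []      = -‿homo x ∷ []
  frobeniusMinus-homo x (a ∷ p) =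
    trans (-‿homo _) (-‿cong (*-homo x a)) ∷ addHead-homo a {Q.frobeniusMinus x p} {frobeniusMinus (φ x) (map φ p)}
        (frobeniusMinus-homo x p)
    where
    addHead-homo : ∀ {n} a {p : Vec R.Carrier (suc n)} {p′ : Vec Carrier (suc n)} → Pointwise _≈_ (map φ p) p′ →
                   Pointwise _≈_ (map φ (MonicForms.addHead R (a R.^ q) p)) (MonicForms.addHead R′ (φ a ^ q) p′)
    addHead-homo a {_ ∷ _} {_ ∷ _} (b≈b′ ∷ p≈p′) = trans (+-homo _ _) (+-cong b≈b′ (^-homo a q)) ∷ p≈p′

  annihilator-homo : ∀ {n} (y : Vector R.Carrier n) → Pointwise _≈_ (map φ (Q.annihilator y)) (annihilator (φ ∘ y))
  annihilator-homo {zero}  y = []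
  annihilator-homo {suc n} y = Pointwise.trans trans (frobeniusMinus-homo _ p)
    (frobeniusMinus-cong (trans (^-homo _ (ℕ.pred q)) (^-congˡ (ℕ.pred q)
       (trans (twisted-homo p (y zero)) (twisted-cong-coefficients (annihilator-homo (y ∘ suc)) (φ (y zero))))))
     (annihilator-homo (y ∘ suc)))
    where p = Q.annihilator (y ∘ suc)

-- Power series

module SeriesLemmas (R : CommutativeRing a b) where
  open RingLemmas R
  open PowerSeries R
  private module S = RingLemmas powerSeries

  constant-⊛ : ∀ x f n → (constant x ⊛ f) n ≈ x * f n
  constant-⊛ x f zero    = +-identityʳ _
  constant-⊛ x f (suc n) = trans (+-congˡ (S.zeroˡ f n)) (+-identityʳ _)

  T-⊛-zero : ∀ f → (T ⊛ f) 0 ≈ 0#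
  T-⊛-zero f = trans (+-identityʳ _) (zeroˡ _)

  T-⊛-suc : ∀ f n → (T ⊛ f) (suc n) ≈ f n
  T-⊛-suc f n = trans (+-cong (zeroˡ _) (S.*-identityˡ f n)) (+-identityˡ _)

  T^-⊛ : ∀ l f n → ((T S.^ l) ⊛ f) (l ℕ.+ n) ≈ f n
  T^-⊛ zero    f n = S.*-identityˡ f n
  T^-⊛ (suc l) f n = trans (S.*-assoc T (T S.^ l) f (suc (l ℕ.+ n)))
    (trans (T-⊛-suc ((T S.^ l) ⊛ f) (l ℕ.+ n)) (T^-⊛ l f n))

  constant-sign : ∀ m → constant (Exterior.sign R m) ≋ Exterior.sign powerSeries m
  constant-sign m = S.trans (^-homo (- 1#) m) (S.^-congˡ m (-‿homo 1#))
    where open HomLemmas R powerSeries constant-isHom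

  Degree≤ : ℕ → Series → Set b
  Degree≤ e f = ∀ j → e ℕ.< j → f j ≈ 0#

  degree-mono : ∀ {e e′ f} → e ℕ.≤ e′ → Degree≤ e f → Degree≤ e′ f
  degree-mono e≤e′ p j e′<j = p j (ℕ.≤-<-trans e≤e′ e′<j)

  degree-cong : ∀ {e f g} → f ≋ g → Degree≤ e f → Degree≤ e g
  degree-cong f≋g p j e<j = trans (sym (f≋g j)) (p j e<j)

  degree-zero : ∀ e → Degree≤ e S.0#
  degree-zero e j _ = refl

  degree-constant : ∀ x → Degree≤ 0 (constant x)
  degree-constant x (suc j) _ = refl

  degree-+ : ∀ {e f g} → Degree≤ e f → Degree≤ e g → Degree≤ e (f S.+ g)
  degree-+ p r j e<j = trans (+-cong (p j e<j) (r j e<j)) (+-identityˡ 0#)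

  degree-sub : ∀ {e f g} → Degree≤ e f → Degree≤ e g → Degree≤ e (f S.- g)
  degree-sub p r j e<j = trans (+-cong (p j e<j) (-‿cong (r j e<j))) (-‿inverseʳ 0#)

  degree-* : ∀ {e e′ f g} → Degree≤ e f → Degree≤ e′ g → Degree≤ (e ℕ.+ e′) (f ⊛ g)
  degree-* {e} {e′} {f} {g} p r n e+e′<n = sum-zero {suc n} _ λ i → term (toℕ i) (toℕ i ℕ.≤? e)
    where
    term : ∀ i → Dec (i ℕ.≤ e) → f i * g (n ∸ i) ≈ 0#
    term i (no i≰e)  = trans (*-congʳ (p i (ℕ.≰⇒> i≰e))) (zeroˡ _)
    term i (yes i≤e) = trans (*-congˡ (r (n ∸ i) (ℕ.m+n≤o⇒m≤o∸n (suc e′) (ℕ.≤-trans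
      (ℕ.≤-reflexive (≡.cong suc (ℕ.+-comm e′ i))) (ℕ.≤-trans (s≤s (ℕ.+-monoˡ-≤ e′ i≤e)) e+e′<n))))) (zeroʳ _)

  -- Row i of the columns wedged so far contributes degree d i, and e is the
  -- degree contributed by the columns themselves.
  DegreeΛ≤ : ∀ {n} → Vector ℕ n → ℕ → Exterior.Λ powerSeries n → Set b
  DegreeΛ≤ {zero}  d e ω = Degree≤ e (ω [])
  DegreeΛ≤ {suc n} d e ω = DegreeΛ≤ (d ∘ suc) (e ℕ.+ d zero) (ω ∘ (true ∷_)) × DegreeΛ≤ (d ∘ suc) e (ω ∘ (false ∷_))

  open Exterior powerSeries

  degreeΛ-combine : ∀ {n} {d : Vector ℕ n} {e g e′ x} {ω η : Λ n} → Degree≤ g x →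
                    DegreeΛ≤ d e ω → e ℕ.+ g ℕ.≤ e′ → DegreeΛ≤ d e′ η → DegreeΛ≤ d e′ (λ I → x S.* ω I S.- η I)
  degreeΛ-combine {zero}  {e = e} {g} p r e+g≤e′ s =
    degree-sub (degree-mono (ℕ.≤-trans (ℕ.≤-reflexive (ℕ.+-comm g e)) e+g≤e′) (degree-* p r)) s
  degreeΛ-combine {suc n} {d} {e} {g} p (r , r′) e+g≤e′ (s , s′) =
      degreeΛ-combine p r (ℕ.≤-trans (ℕ.≤-reflexive
        (+-*-Solver.solve 3 (λ e d g → (e :+′ d) :+′ g :=′ (e :+′ g) :+′ d) ≡.refl e (d zero) g))
        (ℕ.+-monoˡ-≤ (d zero) e+g≤e′)) s
    , degreeΛ-combine p r′ e+g≤e′ s′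
    where open +-*-Solver renaming (_:+_ to _:+′_; _:=_ to _:=′_)

  degreeΛ-+ : ∀ {n} {d : Vector ℕ n} {e} {ω η : Λ n} → DegreeΛ≤ d e ω → DegreeΛ≤ d e η → DegreeΛ≤ d e (λ I → ω I S.+ η I)
  degreeΛ-+ {zero}  p        r        = degree-+ p r
  degreeΛ-+ {suc n} (p , p′) (r , r′) = degreeΛ-+ p r , degreeΛ-+ p′ r′

  degreeΛ-cong : ∀ {n} {d : Vector ℕ n} {e} {ω η : Λ n} → (∀ I → ω I ≋ η I) → DegreeΛ≤ d e ω → DegreeΛ≤ d e η
  degreeΛ-cong {zero}  ω≋η p        = degree-cong (ω≋η []) p
  degreeΛ-cong {suc n} ω≋η (p , p′) = degreeΛ-cong (λ I → ω≋η (true ∷ I)) p , degreeΛ-cong (λ I → ω≋η (false ∷ I)) p′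

  degreeΛ-zero : ∀ {n} (d : Vector ℕ n) e → DegreeΛ≤ d e (λ _ → S.0#)
  degreeΛ-zero {zero}  d e = degree-zero e
  degreeΛ-zero {suc n} d e = degreeΛ-zero (d ∘ suc) _ , degreeΛ-zero (d ∘ suc) e

  degreeΛ-1Λ : ∀ {n} (d : Vector ℕ n) → DegreeΛ≤ d 0 1Λ
  degreeΛ-1Λ {zero}  d = degree-constant 1#
  degreeΛ-1Λ {suc n} d = degreeΛ-zero (d ∘ suc) _ , degreeΛ-1Λ (d ∘ suc)

  degreeΛ-wedge : ∀ {n} {d : Vector ℕ n} {e f} {c : Vector Series n} {ω : Λ n} →
                  (∀ i → Degree≤ (d i ℕ.+ f) (c i)) → DegreeΛ≤ d e ω → DegreeΛ≤ d (e ℕ.+ f) (wedge c ω)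
  degreeΛ-wedge {zero}          p r        = degree-zero _
  degreeΛ-wedge {suc n} {d} {e} {f} {c} {ω} p (r , r′) =
      degreeΛ-combine {d = d ∘ suc} (p zero) r′
        (ℕ.≤-reflexive (+-*-Solver.solve 3 (λ e d f → e :+′ (d :+′ f) :=′ (e :+′ f) :+′ d) ≡.refl e (d zero) f))
        (≡.subst (λ e → DegreeΛ≤ (d ∘ suc) e (wedge (c ∘ suc) (ω ∘ (true ∷_))))
          (+-*-Solver.solve 3 (λ e d f → (e :+′ d) :+′ f :=′ (e :+′ f) :+′ d) ≡.refl e (d zero) f)
          (degreeΛ-wedge (p ∘ suc) r))
    , degreeΛ-wedge (p ∘ suc) r′
    where open +-*-Solver renaming (_:+_ to _:+′_; _:=_ to _:=′_)

  -- The degree can be charged to columns (d = 0) or to rows (f = 0). The first choice suits a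
  -- determinant with a constant column, the second one with a constant row.
  degreeΛ-chain : ∀ {n} {d : Vector ℕ n} {f} {c : ℕ → Vector Series n} → (∀ j i → Degree≤ (d i ℕ.+ f) (c j i)) →
                  ∀ m → DegreeΛ≤ d (m ℕ.* f) (chain c m)
  degreeΛ-chain {d = d}           p zero    = degreeΛ-1Λ d
  degreeΛ-chain {d = d} {f} {c} p (suc m) =
    ≡.subst (λ e → DegreeΛ≤ d e (chain c (suc m))) (ℕ.+-comm (m ℕ.* f) f) (degreeΛ-wedge (p m) (degreeΛ-chain p m))

  sum : ∀ {n} → Vector ℕ n → ℕ
  sum {zero}  d = 0
  sum {suc n} d = d zero ℕ.+ sum (d ∘ suc)

  degreeΛ-top : ∀ {n} {d : Vector ℕ n} {e} {ω : Λ n} → DegreeΛ≤ d e ω → Degree≤ (e ℕ.+ sum d) (top ω)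
  degreeΛ-top {zero}  {e = e}     p       = degree-mono (ℕ.m≤m+n e 0) p
  degreeΛ-top {suc n} {d} {e} (p , _) =
    degree-mono (ℕ.≤-reflexive (ℕ.+-assoc e (d zero) (sum (d ∘ suc)))) (degreeΛ-top p)

  sum-zeros : ∀ n → sum {n} (λ _ → 0) ≡ 0
  sum-zeros zero    = ≡.refl
  sum-zeros (suc n) = sum-zeros n

  sum-constant : ∀ m n → sum {m} (λ _ → n) ≡ m ℕ.* n
  sum-constant zero    n = ≡.refl
  sum-constant (suc m) n = ≡.cong (n ℕ.+_) (sum-constant m n)

  sum-all-but-one : ∀ {m} (i : Fin (suc m)) n → sum (updateAt (λ _ → n) i (const 0)) ≡ m ℕ.* n
  sum-all-but-one {m}     zero    n = sum-constant m n
  sum-all-but-one {suc m} (suc i) n = ≡.cong (n ℕ.+_) (sum-all-but-one i n)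

  degree-top : ∀ {n e} {ω : Λ n} → DegreeΛ≤ (λ _ → 0) e ω → Degree≤ e (top ω)
  degree-top {n} {e} p = degree-mono (ℕ.≤-reflexive (≡.trans (≡.cong (e ℕ.+_) (sum-zeros n)) (ℕ.+-identityʳ e)))
      (degreeΛ-top p)

  -- Telescoping: with C and D the chains of the first m columns, c ∧ C - d ∧ D = (c - d) ∧ C + d ∧
  -- (C - D). In the resulting expansion each term has one column of degree 0 and m columns of
  -- degree at most f.
  degreeΛ-chain-difference : ∀ {n f} {c d : ℕ → Vector Series n} →
    (∀ j i → Degree≤ f (c j i)) → (∀ j i → Degree≤ f (d j i)) → (∀ j i → Degree≤ 0 (c j i S.- d j i)) →
    ∀ m → DegreeΛ≤ (λ _ → 0) (m ℕ.* f) (λ I → chain c (suc m) I S.- chain d (suc m) I)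
  degreeΛ-chain-difference {n} {f} {c} {d} p r s m =
      degreeΛ-cong {η = λ I → chain c (suc m) I S.- chain d (suc m) I} (split m) (sum-degree m)
    where
    telescope : ∀ m → Λ n
    telescope m I = wedge (λ i → c m i S.- d m i) (chain c m) I S.+ wedge (d m) (λ J → chain c m J S.- chain d m J) I
    split : ∀ m I → telescope m I ≋ (chain c (suc m) I S.- chain d (suc m) I)
    split m I = S.trans
      (S.+-cong (S.trans (wedge-cong (λ i → minus (c m i) (d m i)) (λ _ → S.refl) I)
          (wedge-linearˡ S.1# (c m) (S.- S.1#) (d m) _ I))
                (S.trans (wedge-cong (λ _ → S.refl) (λ J → minus (chain c m J) (chain d m J)) I)
                    (wedge-linearʳ (d m) S.1# (chain c m) (S.- S.1#) (chain d m) I)))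
      (S.solve 3 (λ cc dc dd → (S.:1 S.:* cc S.:+ (S.:- S.:1) S.:* dc) S.:+
          (S.:1 S.:* dc S.:+ (S.:- S.:1) S.:* dd) S.:= cc S.:- dd) S.refl _ _ _)
      where
      minus : ∀ x y → (x S.- y) ≋ (S.1# S.* x S.+ (S.- S.1#) S.* y)
      minus = S.solve 2 (λ x y → x S.:- y S.:= S.:1 S.:* x S.:+ (S.:- S.:1) S.:* y) S.refl
    sum-degree : ∀ m → DegreeΛ≤ (λ _ → 0) (m ℕ.* f) (telescope m)
    sum-degree m = degreeΛ-+
      (≡.subst (λ e → DegreeΛ≤ (λ _ → 0) e (wedge (λ i → c m i S.- d m i) (chain c m))) (ℕ.+-identityʳ (m ℕ.* f))
         (degreeΛ-wedge (s m) (degreeΛ-chain p m)))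
      (rest m)
      where
      rest : ∀ m → DegreeΛ≤ (λ _ → 0) (m ℕ.* f) (wedge (d m) (λ J → chain c m J S.- chain d m J))
      rest zero    = degreeΛ-cong {ω = λ _ → S.0#}
        (λ I → S.sym (S.trans (wedge-cong (λ _ → S.refl) (λ J → S.-‿inverseʳ (1Λ J)) I) (wedge-zeroʳ (d 0) I)))
        (degreeΛ-zero (λ _ → 0) 0)
      rest (suc m) = ≡.subst (λ e → DegreeΛ≤ (λ _ → 0) e (wedge (d (suc m)) (λ J → chain c (suc m) J S.- chain d (suc m) J)))
        (ℕ.+-comm (m ℕ.* f) f)
        (degreeΛ-wedge (r (suc m)) (degreeΛ-chain-difference p r s m))

  constantCoefficient-isHom : IsRingHom powerSeries R (λ f → f 0)
  constantCoefficient-isHom = record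
    { isSemiringHomomorphism = record
      { isNearSemiringHomomorphism = record
        { +-isMonoidHomomorphism = record
          { isMagmaHomomorphism = record
            { isRelHomomorphism = record { cong = λ p → p 0 }
            ; homo = λ _ _ → refl
            }
          ; ε-homo = refl
          }
        ; *-homo = λ _ _ → +-identityʳ _
        }
      ; 1#-homo = refl
      }
    ; -‿homo = λ _ → refl
    }

module SeriesHom (R : CommutativeRing a b) (R′ : CommutativeRing c d)
                 {φ : CommutativeRing.Carrier R → CommutativeRing.Carrier R′} (φ-isHom : IsRingHom R R′ φ) where
  private
    module R = RingLemmas R
    module P = PowerSeries R
  open RingLemmas R′
  open PowerSeries R′
  open HomLemmas R R′ φ-isHom

  coefficientwise-monomial : ∀ n x → (φ ∘ P.monomial n x) ≋ monomial n (φ x)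
  coefficientwise-monomial zero    x zero    = refl
  coefficientwise-monomial zero    x (suc j) = 0#-homo
  coefficientwise-monomial (suc n) x zero    = 0#-homo
  coefficientwise-monomial (suc n) x (suc j) = coefficientwise-monomial n x j

  coefficientwise-T : (φ ∘ P.T) ≋ T
  coefficientwise-T zero          = 0#-homo
  coefficientwise-T (suc zero)    = 1#-homo
  coefficientwise-T (suc (suc j)) = 0#-homo

  coefficientwise-isHom : IsRingHom P.powerSeries powerSeries (φ ∘_)
  coefficientwise-isHom = record
    { isSemiringHomomorphism = record
      { isNearSemiringHomomorphism = record
        { +-isMonoidHomomorphism = record
          { isMagmaHomomorphism = record
            { isRelHomomorphism = record { cong = λ p n → ⟦⟧-cong (p n) }
            ; homo = λ f g n → +-homo (f n) (g n)
            }
          ; ε-homo = λ _ → 0#-homo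
          }
        ; *-homo = λ f g n → trans (sum-homo {suc n} (λ i → f (toℕ i) R.* g (n ∸ toℕ i)))
          (sum-cong-≋ {suc n} λ i → *-homo (f (toℕ i)) (g (n ∸ toℕ i)))
        }
      ; 1#-homo = λ n → trans (coefficientwise-monomial 0 R.1# n) (constant-1 n)
      }
    ; -‿homo = λ f n → -‿homo (f n)
    }
    where
    constant-1 : constant (φ R.1#) ≋ constant 1#
    constant-1 zero    = 1#-homo
    constant-1 (suc n) = refl

-- The determinant of torsion sections

-- The formal module of height m + 1 over R with [π](X) = πX + p₁X^q + ⋯ + X^(q^(m+1)).
module TorsionDeterminant {q : ℕ} (k : FiniteField q a b) (R : CommutativeRing c d)
    {κ : CommutativeRing.Carrier (FiniteField.ring k) → CommutativeRing.Carrier R}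
    (κ-isHom : IsRingHom (FiniteField.ring k) R κ)
    {m : ℕ} (π : CommutativeRing.Carrier R) (p : Vec (CommutativeRing.Carrier R) m) where
  private module K = CommutativeRing (FiniteField.ring k)
  open RingLemmas R
  open FqAlgebra k R κ-isHom
  open QPolynomials k R κ-isHom
  private
    module κ = HomLemmas (FiniteField.ring k) R κ-isHom
    module M = Moore R frobenius-isHom
  open M using (twisted)
  open SeriesLemmas R
  open PowerSeries R
  private module S = RingLemmas powerSeries
  open SeriesHom R R frobenius-isHom
  open Exterior R using (sign)
  open Exterior powerSeries using (wedge; top; chain; wedge-cong; wedge-linearˡ) renaming (sign to signS)
  private module M̂ = Moore powerSeries coefficientwise-isHom

  [π] : Carrier → Carrier
  [π] = twisted (π ∷ p)

  [π^_] : ℕ → Carrier → Carrier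
  [π^ zero  ] x = x
  [π^ suc n ] x = [π^ n ] ([π] x)

  [π]-cong : ∀ {x y} → x ≈ y → [π] x ≈ [π] y
  [π]-cong = M.twisted-cong (π ∷ p)

  [π^]-cong : ∀ n {x y} → x ≈ y → [π^ n ] x ≈ [π^ n ] y
  [π^]-cong zero    r = r
  [π^]-cong (suc n) r = [π^]-cong n ([π]-cong r)

  [π^]-suc : ∀ n x → [π^ suc n ] x ≡ [π] ([π^ n ] x)
  [π^]-suc zero    x = ≡.refl
  [π^]-suc (suc n) x = [π^]-suc n ([π] x)

  [π^]-linear : ∀ n ζ ξ x y → [π^ n ] (κ ζ * x + κ ξ * y) ≈ κ ζ * [π^ n ] x + κ ξ * [π^ n ] y
  [π^]-linear zero    ζ ξ x y = refl
  [π^]-linear (suc n) ζ ξ x y = trans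
    ([π^]-cong n (M.twisted-linear (π ∷ p) (frobenius-κ ζ) (frobenius-κ ξ) x y)) ([π^]-linear n ζ ξ ([π] x) ([π] y))

  expansion : Carrier → Series
  expansion x n = [π^ n ] x

  expansion-degree : ∀ {n x} → [π^ suc n ] x ≈ 0# → Degree≤ n (expansion x)
  expansion-degree         z zero    ()
  expansion-degree {n} {x} z (suc j) n<1+j with ℕ.m<1+n⇒m<n∨m≡n n<1+j
  ... | inj₂ ≡.refl = z
  ... | inj₁ n<j    = trans (reflexive ([π^]-suc j x))
    (trans ([π]-cong (expansion-degree z j n<j)) (twisted-zero (π ∷ p)))

  twisted-coefficientwise : ∀ {l} (v : Vec Carrier l) f n → M̂.twisted (map constant v) f n ≈ twisted v (f n)
  twisted-coefficientwise []      f n = refl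
  twisted-coefficientwise (x ∷ v) f n = +-cong (constant-⊛ x f n) (twisted-coefficientwise v _ n)

  T⊛expansion : ∀ x → (T ⊛ expansion ([π] x)) ≋ (expansion x S.- constant x)
  T⊛expansion x zero    = trans (T-⊛-zero (expansion ([π] x))) (sym (-‿inverseʳ x))
  T⊛expansion x (suc n) = trans (T-⊛-suc (expansion ([π] x)) n) (solve 1 (λ x → x := x :- :0) refl _)

  T⊛[π]expansion : ∀ x → (T ⊛ M̂.twisted (map constant (π ∷ p)) (expansion x)) ≋ (expansion x S.- constant x)
  T⊛[π]expansion x = S.trans {j = T ⊛ expansion ([π] x)}
    (S.*-congˡ {T} λ n → trans (twisted-coefficientwise (π ∷ p) (expansion x) n) (sym (reflexive ([π^]-suc n x))))
    (T⊛expansion x)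

  μ : ℕ → Vector Carrier (suc m) → Carrier
  μ s x = M̂.moore (expansion ∘ x) s

  μ-cong : ∀ s {x y} → (∀ i → x i ≈ y i) → μ s x ≈ μ s y
  μ-cong s x≈y = M̂.moore-cong (λ i n → [π^]-cong n (x≈y i)) s

  μ-alternating : ∀ s x {i j} → i ≢ j → x i ≈ x j → μ s x ≈ 0#
  μ-alternating s x i≢j xᵢ≈xⱼ = M̂.moore-alternating (expansion ∘ x) i≢j (λ n → [π^]-cong n xᵢ≈xⱼ) s

  constant-fixed : ∀ ζ → (λ n → constant (κ ζ) n ^ q) ≋ constant (κ ζ)
  constant-fixed ζ = S.trans (coefficientwise-monomial 0 (κ ζ)) (⟦⟧-cong (frobenius-κ ζ))
    where open HomLemmas R powerSeries constant-isHom using (⟦⟧-cong)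

  1-fixed : (λ n → S.1# n ^ q) ≋ S.1#
  1-fixed = HomLemmas.1#-homo powerSeries powerSeries coefficientwise-isHom

  μ-linear : ∀ l i ζ ξ {r s t : Vector Carrier (suc m)} → r i ≈ κ ζ * s i + κ ξ * t i →
             (∀ j → j ≢ i → r j ≈ s j) → (∀ j → j ≢ i → r j ≈ t j) → μ l r ≈ κ ζ * μ l s + κ ξ * μ l t
  μ-linear l i ζ ξ {r} {s} {t} rᵢ r≈s r≈t = trans
    (M̂.moore-combination i (constant-fixed ζ) (constant-fixed ξ) (expansion ∘ r) (expansion ∘ s) (expansion ∘ t)
      (λ n → trans ([π^]-cong n rᵢ) (trans ([π^]-linear n ζ ξ (s i) (t i))
        (sym (+-cong (constant-⊛ (κ ζ) (expansion (s i)) n) (constant-⊛ (κ ξ) (expansion (t i)) n)))))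
      (λ j j≢i n → [π^]-cong n (r≈s j j≢i)) (λ j j≢i n → [π^]-cong n (r≈t j j≢i)) l)
    (+-cong (constant-⊛ (κ ζ) (M̂.moore (expansion ∘ s)) l) (constant-⊛ (κ ξ) (M̂.moore (expansion ∘ t)) l))

  iterate-degree : ∀ {e} j {f} → Degree≤ e f → Degree≤ e (M̂.iterate j f)
  iterate-degree zero    p         = p
  iterate-degree (suc j) p l e<l = trans (^-congˡ q (iterate-degree j p l e<l)) 0^q

  moore-degree : ∀ {n} (r : Vector Series (suc m)) → (∀ i → Degree≤ n (r i)) → Degree≤ (suc m ℕ.* n) (M̂.moore r)
  moore-degree {n} r r≤n = degree-top {ω = chain (M̂.columns r) (suc m)}
      (degreeΛ-chain (λ j i → iterate-degree j (r≤n i)) (suc m))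

  moore-degree-constant-row : ∀ {n} (r : Vector Series (suc m)) i → Degree≤ 0 (r i) → (∀ j → j ≢ i → Degree≤ n (r j)) →
                              Degree≤ (m ℕ.* n) (M̂.moore r)
  moore-degree-constant-row {n} r i rᵢ rⱼ =
    degree-mono {f = M̂.moore r} (ℕ.≤-reflexive (≡.cong₂ ℕ._+_ (ℕ.*-zeroʳ (suc m)) (sum-all-but-one i n)))
      (degreeΛ-top {d = weight} {ω = chain (M̂.columns r) (suc m)}
          (degreeΛ-chain {d = weight} (λ j l → iterate-degree j (row l (l Fin.≟ i))) (suc m)))
    where
    weight : Vector ℕ (suc m)
    weight = updateAt (λ _ → n) i (const 0)
    row : ∀ l → Dec (l ≡ i) → Degree≤ (weight l ℕ.+ 0) (r l)
    row l (yes ≡.refl) = degree-mono z≤n rᵢ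
    row l (no l≢i)     = degree-mono (ℕ.≤-reflexive (≡.sym (≡.trans (ℕ.+-identityʳ _)
      (updateAt-minimal l i (λ _ → n) l≢i)))) (rⱼ l l≢i)

  [π]LT : Carrier → Carrier
  [π]LT y = π * y + sign m * y ^ q

  module _ {n : ℕ} (x : Vector Carrier (suc m)) (x-torsion : ∀ i → [π^ suc n ] (x i) ≈ 0#) where
    private
      X = expansion ∘ x
      X-degree : ∀ i → Degree≤ n (X i)
      X-degree i = expansion-degree (x-torsion i)
      W = M̂.twistedChain X

    T⊛[π]moore : (T ⊛ (constant π ⊛ M̂.moore X S.+ signS m ⊛ (λ l → M̂.moore X l ^ q))) ≋
                 (M̂.moore X S.- signS m ⊛ top (wedge (constant ∘ x) W))
    T⊛[π]moore = M̂.moore-eigen T (constant π) (map constant p) X (constant ∘ x) (λ i → T⊛[π]expansion (x i))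

    [π]LT-μ : ∀ {s} → m ℕ.* n ℕ.≤ s → [π]LT (μ s x) ≈ μ (suc s) x
    [π]LT-μ {s} mn≤s = begin
      π * μ s x + sign m * μ s x ^ q
        ≈⟨ +-cong (constant-⊛ π (M̂.moore X) s) (signS-⊛ (λ l → M̂.moore X l ^ q) s) ⟨
      (constant π ⊛ M̂.moore X S.+ signS m ⊛ (λ l → M̂.moore X l ^ q)) s
        ≈⟨ T-⊛-suc (constant π ⊛ M̂.moore X S.+ signS m ⊛ (λ l → M̂.moore X l ^ q)) s ⟨
      (T ⊛ (constant π ⊛ M̂.moore X S.+ signS m ⊛ (λ l → M̂.moore X l ^ q))) (suc s)
        ≈⟨ T⊛[π]moore (suc s) ⟩
      μ (suc s) x - (signS m ⊛ top (wedge (constant ∘ x) W)) (suc s)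
        ≈⟨ +-congˡ (-‿cong (trans (signS-⊛ (top (wedge (constant ∘ x) W)) (suc s))
            (trans (*-congˡ (constants-degree (suc s) (s≤s mn≤s))) (zeroʳ _)))) ⟩
      μ (suc s) x - 0#
        ≈⟨ solve 1 (λ x → x :- :0 := x) refl _ ⟩
      μ (suc s) x ∎
      where
      signS-⊛ : ∀ f l → (signS m ⊛ f) l ≈ sign m * f l
      signS-⊛ f l = trans (S.*-congʳ {f} {signS m} {constant (sign m)} (λ i → sym (constant-sign m i)) l)
          (constant-⊛ (sign m) f l)
      constants-degree : Degree≤ (m ℕ.* n) (top (wedge (constant ∘ x) W))
      constants-degree = degree-mono {f = top (wedge (constant ∘ x) W)} (ℕ.≤-reflexive (ℕ.+-identityʳ _))
        (degree-top {ω = wedge (constant ∘ x) W}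
            (degreeΛ-wedge {ω = W} (λ i → degree-constant (x i))
            (degreeΛ-chain (λ j i → iterate-degree (suc j) (X-degree i)) m)))

    -- All columns of X differ by constants from those of T times the expansion of [π](x), so the
    -- two determinants agree above degree mn. As τ fixes T, a factor T comes out of each of the m +
    -- 1 columns, and the index drops by m + 1.
    μ-shift : ∀ {s} → m ℕ.* n ℕ.< s ℕ.+ suc m → μ (s ℕ.+ suc m) x ≈ μ s ([π] ∘ x)
    μ-shift {s} mn<s+h = begin
      M̂.moore X (s ℕ.+ suc m)
        ≈⟨ solve 2 (λ u v → u := (u :- v) :+ v) refl _ (M̂.moore TY (s ℕ.+ suc m)) ⟩
      (M̂.moore X (s ℕ.+ suc m) - M̂.moore TY (s ℕ.+ suc m)) + M̂.moore TY (s ℕ.+ suc m)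
        ≈⟨ +-cong (degree-top {ω = λ I → chain (M̂.columns X) (suc m) I S.- chain (M̂.columns TY) (suc m) I}
            (degreeΛ-chain-difference (λ j i → iterate-degree j (X-degree i)) (λ j i → iterate-degree j (TY-degree i))
             (λ j i → difference j i) m) _ mn<s+h) (M̂.moore-scale (λ l → coefficientwise-T l) Y (s ℕ.+ suc m)) ⟩
      0# + ((T S.^ suc m) ⊛ M̂.moore Y) (s ℕ.+ suc m)
        ≈⟨ trans (+-identityˡ _) (reflexive (≡.cong ((T S.^ suc m) ⊛ M̂.moore Y) (ℕ.+-comm s (suc m)))) ⟩
      ((T S.^ suc m) ⊛ M̂.moore Y) (suc m ℕ.+ s)
        ≈⟨ T^-⊛ (suc m) (M̂.moore Y) s ⟩
      μ s ([π] ∘ x) ∎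
      where
      Y TY : Vector Series (suc m)
      Y i = expansion ([π] (x i))
      TY i = T ⊛ Y i
      TY-degree : ∀ i → Degree≤ n (TY i)
      TY-degree i = degree-cong (S.sym (T⊛expansion (x i)))
        (degree-sub (X-degree i) (degree-mono z≤n (degree-constant (x i))))
      iterate-sub : ∀ j f g → (M̂.iterate j f S.- M̂.iterate j g) ≋ M̂.iterate j (f S.- g)
      iterate-sub zero    f g = S.refl
      iterate-sub (suc j) f g = S.trans (S.sym (sub-homo _ _)) (⟦⟧-cong (iterate-sub j f g))
        where open HomLemmas powerSeries powerSeries coefficientwise-isHom
      difference : ∀ j i → Degree≤ 0 (M̂.iterate j (X i) S.- M̂.iterate j (TY i))
      difference j i = degree-cong (S.sym (iterate-sub j (X i) (TY i))) (iterate-degree j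
        (degree-cong (S.trans (S.solve 2 (λ x c → c S.:= x S.:- (x S.:- c)) S.refl (X i) (constant (x i)))
          (S.+-congˡ (S.-‿cong (S.sym (T⊛expansion (x i)))))) (degree-constant (x i))))

  -- Row i is the constant x i plus T times the expansion of [π](x i). With the constant in row i
  -- the determinant has degree at most mn, so at index s + 1 only the part with T remains.
  μ-row-shift : ∀ {n s} i (x y : Vector Carrier (suc m)) → y i ≈ [π] (x i) → (∀ j → j ≢ i → y j ≈ x j) →
                (∀ j → j ≢ i → [π^ suc n ] (x j) ≈ 0#) → m ℕ.* n ℕ.≤ s → μ s y ≈ μ (suc s) x
  μ-row-shift {n} {s} i x y yᵢ y≈x x-torsion mn≤s = sym (begin
    μ (suc s) x
      ≈⟨ M̂.moore-combination i 1-fixed coefficientwise-T (expansion ∘ x) row (expansion ∘ y) xᵢ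
           (λ j j≢i → S.reflexive (≡.sym (updateAt-minimal j i _ j≢i))) (λ j j≢i n → [π^]-cong n (sym (y≈x j j≢i))) (suc s) ⟩
    (S.1# ⊛ M̂.moore row) (suc s) + (T ⊛ M̂.moore (expansion ∘ y)) (suc s)
      ≈⟨ +-cong (trans (S.*-identityˡ (M̂.moore row) (suc s)) (moore-degree-constant-row row i
           (degree-cong (S.reflexive (≡.sym (updateAt-updates i _))) (degree-constant (x i)))
           (λ j j≢i → degree-cong (S.reflexive (≡.sym (updateAt-minimal j i _ j≢i))) (expansion-degree (x-torsion j j≢i)))
           (suc s) (s≤s mn≤s))) (T-⊛-suc (M̂.moore (expansion ∘ y)) s) ⟩
    0# + μ s y
      ≈⟨ +-identityˡ _ ⟩
    μ s y ∎)
    where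
    row : Vector Series (suc m)
    row = updateAt (expansion ∘ x) i (const (constant (x i)))
    xᵢ : expansion (x i) ≋ (S.1# S.* row i S.+ T S.* expansion (y i))
    xᵢ = S.trans (S.solve 2 (λ x c → x S.:= S.:1 S.:* c S.:+ (x S.:- c)) S.refl (expansion (x i)) (constant (x i)))
      (S.+-cong {S.1# S.* constant (x i)} {S.1# S.* row i} {expansion (x i) S.- constant (x i)} {T S.* expansion (y i)}
        (S.*-congˡ {S.1#} (S.reflexive (≡.sym (updateAt-updates i (expansion ∘ x)))))
        (S.trans {j = T S.* expansion ([π] (x i))} (S.sym (T⊛expansion (x i))) (S.*-congˡ {T} λ n → [π^]-cong n (sym yᵢ))))

  [π^_]LT : ℕ → Carrier → Carrier
  [π^ zero  ]LT y = y
  [π^ suc j ]LT y = [π^ j ]LT ([π]LT y)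

  [π^]LT-cong : ∀ j {x y} → x ≈ y → [π^ j ]LT x ≈ [π^ j ]LT y
  [π^]LT-cong zero    r = r
  [π^]LT-cong (suc j) r = [π^]LT-cong j (+-cong (*-congˡ r) (*-congˡ (^-congˡ q r)))

  [π^]LT-μ : ∀ {n} x → (∀ i → [π^ suc n ] (x i) ≈ 0#) → ∀ {s} → m ℕ.* n ℕ.≤ s → ∀ j →
             [π^ j ]LT (μ s x) ≈ μ (j ℕ.+ s) x
  [π^]LT-μ x z mn≤s zero    = refl
  [π^]LT-μ x z {s} mn≤s (suc j) = trans ([π^]LT-cong j ([π]LT-μ x z mn≤s))
    (trans ([π^]LT-μ x z (ℕ.m≤n⇒m≤1+n mn≤s) j) (reflexive (≡.cong (λ l → μ l x) (ℕ.+-suc j s))))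

  -- After n + 1 steps the index mn has grown to mn + n + 1, one beyond the degree bound (m + 1)n.
  μ-torsion : ∀ {n} x → (∀ i → [π^ suc n ] (x i) ≈ 0#) → [π^ suc n ]LT (μ (m ℕ.* n) x) ≈ 0#
  μ-torsion {n} x z = trans ([π^]LT-μ x z ℕ.≤-refl (suc n))
      (moore-degree (expansion ∘ x) (λ i → expansion-degree (z i)) _ ℕ.≤-refl)

  -- Both sides are the coefficient at index m(n + 1) + 1 = mn + (m + 1): one step of the LT action
  -- leads up to it, and [π] on all sections leads down from it by m + 1.
  μ-compatible : ∀ {n} x → (∀ i → [π^ suc (suc n) ] (x i) ≈ 0#) →
                 μ (m ℕ.* n) ([π] ∘ x) ≈ [π]LT (μ (m ℕ.* suc n) x)
  μ-compatible {n} x z = sym (trans ([π]LT-μ x z ℕ.≤-refl) (trans (reflexive (≡.cong (λ l → μ l x) eq))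
    (μ-shift x z (ℕ.≤-reflexive eq))))
    where
    eq : suc (m ℕ.* suc n) ≡ m ℕ.* n ℕ.+ suc m
    eq = ≡.trans (≡.cong suc (≡.trans (ℕ.*-suc m n) (ℕ.+-comm m (m ℕ.* n)))) (≡.sym (ℕ.+-suc (m ℕ.* n) m))

  [π^n]LT-μ : ∀ n x → (∀ i → [π^ suc n ] (x i) ≈ 0#) → [π^ n ]LT (μ (m ℕ.* n) x) ≈ M.moore ([π^ n ] ∘ x)
  [π^n]LT-μ n x z = trans ([π^]LT-μ x z ℕ.≤-refl n) (leading n x z)
    where
    -- The index (m + 1)n is the top degree. Each [π] on all sections lowers it by m + 1, and after
    -- n of them the constant coefficient is left, the Moore determinant of the sections themselves.
    leading : ∀ n x → (∀ i → [π^ suc n ] (x i) ≈ 0#) → μ (n ℕ.+ m ℕ.* n) x ≈ M.moore ([π^ n ] ∘ x)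
    leading zero    x z = trans (reflexive (≡.cong (λ l → μ l x) (ℕ.*-zeroʳ m))) (moore-homo (expansion ∘ x))
      where open MooreHom powerSeries coefficientwise-isHom R frobenius-isHom constantCoefficient-isHom (λ _ → refl)
    leading (suc n) x z = trans (reflexive (≡.cong (λ l → μ l x) eq))
      (trans (μ-shift x z mn<) (leading n ([π] ∘ x) z))
      where
      eq : suc n ℕ.+ m ℕ.* suc n ≡ (n ℕ.+ m ℕ.* n) ℕ.+ suc m
      eq = ≡.trans (≡.cong (suc n ℕ.+_) (≡.trans (ℕ.*-suc m n) (ℕ.+-comm m (m ℕ.* n))))
        (≡.trans (≡.cong suc (≡.sym (ℕ.+-assoc n (m ℕ.* n) m))) (≡.sym (ℕ.+-suc _ m)))
      mn< : m ℕ.* suc n ℕ.< (n ℕ.+ m ℕ.* n) ℕ.+ suc m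
      mn< = ≡.subst (m ℕ.* suc n ℕ.<_) eq (s≤s (ℕ.m≤n+m _ n))

  private
    infixl 20 _[_]≔_
    _[_]≔_ : Vector Carrier (suc m) → Fin (suc m) → Carrier → Vector Carrier (suc m)
    x [ i ]≔ y = updateAt x i (const y)

  μ-sum : ∀ l i x {N} (ζ : Vector K.Carrier N) (y : Vector Carrier N) →
          μ l (x [ i ]≔ (∑[ j < N ] (κ (ζ j) * y j))) ≈ ∑[ j < N ] (κ (ζ j) * μ l (x [ i ]≔ y j))
  -- The empty sum in row i is written as 0 · x i + 0 · x i, so that linearity makes the value zero.
  μ-sum l i x {zero}  ζ y = trans (μ-linear l i K.0# K.0# {s = x} {x}
      (trans (reflexive (updateAt-updates i x)) (sym (trans (+-cong (zeros (x i)) (zeros (x i))) (+-identityˡ 0#))))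
      (λ j j≢i → reflexive (updateAt-minimal j i x j≢i)) (λ j j≢i → reflexive (updateAt-minimal j i x j≢i)))
    (trans (+-cong (zeros _) (zeros _)) (+-identityˡ 0#))
    where
    zeros : ∀ u → κ K.0# * u ≈ 0#
    zeros u = trans (*-congʳ κ.0#-homo) (zeroˡ u)
  μ-sum l i x {suc N} ζ y = trans (μ-linear l i (ζ zero) K.1# {s = x [ i ]≔ y zero} {x [ i ]≔ rest}
      (begin
        (x [ i ]≔ (κ (ζ zero) * y zero + rest)) i   ≡⟨ updateAt-updates i x ⟩
        κ (ζ zero) * y zero + rest                  ≈⟨ +-congˡ (ones rest) ⟨
        κ (ζ zero) * y zero + κ K.1# * rest         ≡⟨ ≡.cong₂ (λ u v → κ (ζ zero) * u + κ K.1# * v)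
                                                         (updateAt-updates i x) (updateAt-updates i x) ⟨
        κ (ζ zero) * (x [ i ]≔ y zero) i + κ K.1# * (x [ i ]≔ rest) i ∎)
      (λ j j≢i → reflexive (≡.trans (updateAt-minimal j i x j≢i) (≡.sym (updateAt-minimal j i x j≢i))))
      (λ j j≢i → reflexive (≡.trans (updateAt-minimal j i x j≢i) (≡.sym (updateAt-minimal j i x j≢i)))))
    (+-congˡ (trans (ones _) (μ-sum l i x (ζ ∘ suc) (y ∘ suc))))
    where
    rest = ∑[ j < N ] (κ (ζ (suc j)) * y (suc j))
    ones : ∀ u → κ K.1# * u ≈ u
    ones u = trans (*-congʳ κ.1#-homo) (*-identityˡ u)

  -- The terms on both sides are κ (α j) times the coefficient at index j + mn, reached by j row
  -- shifts on the left and by `[π^]LT-μ` on the right.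
  μ-homogeneous : ∀ {n} x i y → (∀ j → j ≢ i → [π^ suc n ] (x j) ≈ 0#) → [π^ suc n ] y ≈ 0# → (α : ℕ → K.Carrier) → ∀ N →
    μ (m ℕ.* n) (x [ i ]≔ (∑[ j < N ] (κ (α (toℕ j)) * [π^ toℕ j ] y))) ≈
    ∑[ j < N ] (κ (α (toℕ j)) * [π^ toℕ j ]LT (μ (m ℕ.* n) (x [ i ]≔ y)))
  μ-homogeneous {n} x i y x-torsion y-torsion α N = trans (μ-sum (m ℕ.* n) i x {N} (α ∘ toℕ) (λ j → [π^ toℕ j ] y))
    (sum-cong-≋ {N} λ j → *-congˡ (trans (shift (toℕ j) y) (sym ([π^]LT-μ (x [ i ]≔ y) torsion ℕ.≤-refl (toℕ j)))))
    where
    torsion : ∀ j → [π^ suc n ] ((x [ i ]≔ y) j) ≈ 0#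
    torsion j with j Fin.≟ i
    ... | yes ≡.refl = trans (reflexive (≡.cong [π^ suc n ] (updateAt-updates i x))) y-torsion
    ... | no j≢i     = trans (reflexive (≡.cong [π^ suc n ] (updateAt-minimal j i x j≢i))) (x-torsion j j≢i)
    shift : ∀ j y → μ (m ℕ.* n) (x [ i ]≔ [π^ j ] y) ≈ μ (j ℕ.+ m ℕ.* n) (x [ i ]≔ y)
    shift zero    y = refl
    shift (suc j) y = trans (shift j ([π] y)) (μ-row-shift i (x [ i ]≔ y) (x [ i ]≔ [π] y)
      (reflexive (≡.trans (updateAt-updates i x) (≡.cong [π] (≡.sym (updateAt-updates i x)))))
      (λ l l≢i → reflexive (≡.trans (updateAt-minimal l i x l≢i) (≡.sym (updateAt-minimal l i x l≢i))))
      (λ l l≢i → trans (reflexive (≡.cong [π^ suc n ] (updateAt-minimal l i x l≢i))) (x-torsion l l≢i))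
      (ℕ.m≤n+m _ j))

-- Divisibility of q-polynomials in R[[T]]

module QSeries {q : ℕ} (k : FiniteField q a b) (R : CommutativeRing c d)
               {κ : CommutativeRing.Carrier (FiniteField.ring k) → CommutativeRing.Carrier R}
               (κ-isHom : IsRingHom (FiniteField.ring k) R κ) where
  open FiniteFieldLemmas using (nontrivial)
  open RingLemmas R
  open PowerSeries R
  open SeriesLemmas R
  private
    module S = RingLemmas powerSeries
    module constant = HomLemmas R powerSeries constant-isHom

  constantκ-isHom : IsRingHom (FiniteField.ring k) powerSeries (constant ∘ κ)
  constantκ-isHom = isRingHomomorphism S.trans κ-isHom constant-isHom

  private
    module F = FqAlgebra k R κ-isHom
    module FS = FqAlgebra k powerSeries constantκ-isHom
    module τ = HomLemmas R R F.frobenius-isHom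
  open Moore R F.frobenius-isHom using (iterate; twisted)
  -- Here τ is the q-power map of the series ring itself, sending T to T^q, in contrast to the
  -- coefficientwise map used for the determinants of expansions, which fixes the variable.
  module MS = Moore powerSeries FS.frobenius-isHom

  iterate-+ : ∀ s x y → iterate s (x + y) ≈ iterate s x + iterate s y
  iterate-+ zero    x y = refl
  iterate-+ (suc s) x y = trans (τ.⟦⟧-cong (iterate-+ s x y)) (τ.+-homo _ _)

  iterate-* : ∀ s x y → iterate s (x * y) ≈ iterate s x * iterate s y
  iterate-* zero    x y = refl
  iterate-* (suc s) x y = trans (τ.⟦⟧-cong (iterate-* s x y)) (τ.*-homo _ _)

  iterate-suc : ∀ s x → iterate s (x ^ q) ≡ iterate (suc s) x
  iterate-suc zero    x = ≡.refl
  iterate-suc (suc s) x = ≡.cong (_^ q) (iterate-suc s x)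

  twisted≈sum : ∀ {A : Set e} (⟦_⟧ : A → Carrier) {l} (v : Vec A l) x →
                twisted (map ⟦_⟧ v) x ≈ ∑[ i < l ] (⟦ lookup v i ⟧ * iterate (toℕ i) x) + iterate l x
  twisted≈sum ⟦_⟧ []      x = sym (+-identityˡ x)
  twisted≈sum ⟦_⟧ {suc l} (a ∷ v) x = trans (+-congˡ (trans (twisted≈sum ⟦_⟧ v (x ^ q)) (+-cong
      (sum-cong-≋ {l} λ i → *-congˡ {⟦ lookup v i ⟧} (reflexive (iterate-suc (toℕ i) x))) (reflexive (iterate-suc l x)))))
    (sym (+-assoc _ _ _))

  -- Σᵢ vᵢ T^(e qⁱ) + T^(e qˡ).
  qSeries : ∀ {l} → Vec Carrier l → ℕ → Series
  qSeries v e = MS.twisted (map constant v) (T S.^ e)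

  qSeries-∷ : ∀ {l} a (v : Vec Carrier l) e →
              qSeries (a ∷ v) e ≋ (constant a ⊛ (T S.^ e) S.+ qSeries v (e ℕ.* q))
  qSeries-∷ a v e = S.+-congˡ {constant a ⊛ (T S.^ e)} (MS.twisted-cong (map constant v) (S.^-assocʳ T e q))

  q≥2 : 2 ℕ.≤ q
  q≥2 with r , ≡.refl ← nontrivial k = s≤s (s≤s z≤n)

  q≥1 : 1 ℕ.≤ q
  q≥1 = ℕ.≤-trans (s≤s z≤n) q≥2

  q^l≥1 : ∀ l → 1 ℕ.≤ q ℕ.^ l
  q^l≥1 zero    = s≤s z≤n
  q^l≥1 (suc l) = ℕ.*-mono-≤ q≥1 (q^l≥1 l)

  e≤e*q^l : ∀ e l → e ℕ.≤ e ℕ.* q ℕ.^ l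
  e≤e*q^l e l = ℕ.≤-trans (ℕ.≤-reflexive (≡.sym (ℕ.*-identityʳ e))) (ℕ.*-monoʳ-≤ e (q^l≥1 l))

  degree-^ : ∀ {n g} → Degree≤ n g → ∀ l → Degree≤ (l ℕ.* n) (g S.^ l)
  degree-^ p zero    = degree-constant 1#
  degree-^ p (suc l) = degree-* p (degree-^ p l)

  degree-T^ : ∀ e → Degree≤ e (T S.^ e)
  degree-T^ e = degree-mono (ℕ.≤-reflexive (ℕ.*-identityʳ e)) (degree-^ (λ { (suc zero) (s≤s ()) ; (suc (suc j)) _ → refl }) e)

  qSeries-degree : ∀ {l} (v : Vec Carrier l) e → Degree≤ (e ℕ.* q ℕ.^ l) (qSeries v e)
  qSeries-degree []      e = degree-mono (ℕ.≤-reflexive (≡.sym (ℕ.*-identityʳ e))) (degree-T^ e)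
  qSeries-degree {suc l} (a ∷ v) e = degree-cong (S.sym (qSeries-∷ a v e)) (degree-+ {f = constant a ⊛ (T S.^ e)}
    (degree-mono (e≤e*q^l e (suc l)) (degree-* (degree-constant a) (degree-T^ e)))
    (degree-mono (ℕ.≤-reflexive (ℕ.*-assoc e q (q ℕ.^ l))) (qSeries-degree v (e ℕ.* q))))

  ⊛-T^ : ∀ g e n → (g ⊛ (T S.^ e)) (n ℕ.+ e) ≈ g n
  ⊛-T^ g e n = trans (S.*-comm g (T S.^ e) (n ℕ.+ e))
    (trans (reflexive (≡.cong ((T S.^ e) ⊛ g) (ℕ.+-comm n e))) (T^-⊛ e g n))

  T^-low : ∀ e {j} → j ℕ.< e → (T S.^ e) j ≈ 0#
  T^-low (suc e) {zero}  _         = T-⊛-zero (T S.^ e)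
  T^-low (suc e) {suc j} (s≤s j<e) = trans (T-⊛-suc (T S.^ e) j) (T^-low e j<e)

  qSeries-low : ∀ {l} (v : Vec Carrier l) {e j} → j ℕ.< e → qSeries v e j ≈ 0#
  qSeries-low []      {e} j<e = T^-low e j<e
  qSeries-low (a ∷ v) {e} {j} j<e = trans (qSeries-∷ a v e j) (trans (+-cong
      (trans (constant-⊛ a (T S.^ e) j) (trans (*-congˡ (T^-low e j<e)) (zeroʳ a)))
      (qSeries-low v (ℕ.≤-trans j<e (ℕ.≤-trans (ℕ.≤-reflexive (≡.sym (ℕ.*-identityʳ e))) (ℕ.*-monoʳ-≤ e q≥1)))))
    (+-identityˡ 0#))

  qSeries-linear : ∀ {l} (v : Vec Carrier (suc l)) → qSeries v 1 1 ≈ head v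
  qSeries-linear (a ∷ v) = trans (qSeries-∷ a v 1 1) (trans (+-cong
      (trans (constant-⊛ a (T S.^ 1) 1) (trans (*-congˡ (S.*-identityʳ T 1)) (*-identityʳ a)))
      (qSeries-low v (≡.subst (2 ℕ.≤_) (≡.sym (ℕ.*-identityˡ q)) q≥2)))
    (+-identityʳ a))

  -- The coefficient of the product at the index of gⱼ T^(e qˡ) is gⱼ up to
  -- multiples of the higher coefficients of g.
  ⊛-qSeries-top : ∀ {P : Carrier → Set e} → P 0# → (∀ {x y} → P x → P y → P (x + y)) → ∀ (g : Series) j {l}
      (v : Vec Carrier l) n →
                  1 ℕ.≤ n → All (λ a → ∀ i → j ℕ.< i → P (a * g i)) v →
                  ∃[ r ] P r × (g ⊛ qSeries v n) (j ℕ.+ n ℕ.* q ℕ.^ l) ≈ g j + r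
  ⊛-qSeries-top {P = P} P0 P+ g j []      n 1≤n [] = 0# , P0 ,
    trans (reflexive (≡.cong (λ i → (g ⊛ (T S.^ n)) (j ℕ.+ i)) (ℕ.*-identityʳ n))) (trans (⊛-T^ g n j) (sym (+-identityʳ _)))
  ⊛-qSeries-top {P = P} P0 P+ g j {suc l} (a ∷ v) n 1≤n (p ∷ ps) with ⊛-qSeries-top {P = P} P0 P+ g j v (n ℕ.* q) (ℕ.*-mono-≤ 1≤n q≥1) ps
  ... | r , Pr , eq = a * g i + r , P+ (p i j<i) Pr , (begin
    (g ⊛ qSeries (a ∷ v) n) (j ℕ.+ N)
      ≈⟨ S.*-congˡ {g} (qSeries-∷ a v n) (j ℕ.+ N) ⟩
    (g ⊛ (constant a ⊛ (T S.^ n) S.+ qSeries v (n ℕ.* q))) (j ℕ.+ N)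
      ≈⟨ S.solve 4 (λ g a t s → g S.:* (a S.:* t S.:+ s) S.:= a S.:* (g S.:* t) S.:+ g S.:* s) S.refl
           g (constant a) (T S.^ n) (qSeries v (n ℕ.* q)) (j ℕ.+ N) ⟩
    (constant a ⊛ (g ⊛ (T S.^ n))) (j ℕ.+ N) + (g ⊛ qSeries v (n ℕ.* q)) (j ℕ.+ N)
      ≈⟨ +-cong (trans (constant-⊛ a (g ⊛ (T S.^ n)) (j ℕ.+ N))
          (*-congˡ (trans (reflexive (≡.cong (g ⊛ (T S.^ n)) (≡.sym i+n)))
           (⊛-T^ g n i)))) (trans (reflexive (≡.cong (λ N → (g ⊛ qSeries v (n ℕ.* q)) (j ℕ.+ N))
               (≡.sym (ℕ.*-assoc n q (q ℕ.^ l))))) eq) ⟩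
    a * g i + (g j + r)
      ≈⟨ solve 3 (λ x y r → x :+ (y :+ r) := y :+ (x :+ r)) refl _ (g j) r ⟩
    g j + (a * g i + r) ∎)
    where
    N = n ℕ.* q ℕ.^ suc l
    n<N : n ℕ.< N
    n<N = ℕ.≤-trans (ℕ.≤-trans (ℕ.+-monoˡ-≤ n 1≤n)
        (ℕ.≤-reflexive (≡.trans (≡.cong (n ℕ.+_) (≡.sym (ℕ.+-identityʳ n))) (ℕ.*-comm 2 n))))
      (ℕ.*-monoʳ-≤ n (ℕ.≤-trans q≥2 (≡.subst (ℕ._≤ q ℕ.* q ℕ.^ l) (ℕ.*-identityʳ q) (ℕ.*-monoʳ-≤ q (q^l≥1 l)))))
    -- The coefficient of g that meets the term a Tⁿ; its index exceeds j because n < N.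
    i = j ℕ.+ (N ∸ n)
    i+n : i ℕ.+ n ≡ j ℕ.+ N
    i+n = ≡.trans (ℕ.+-assoc j (N ∸ n) n) (≡.cong (j ℕ.+_) (ℕ.m∸n+n≡m (ℕ.<⇒≤ n<N)))
    j<i : j ℕ.< i
    j<i = ≡.subst (ℕ._< i) (ℕ.+-identityʳ j) (ℕ.+-monoʳ-< j (ℕ.m<n⇒0<n∸m n<N))

  twisted-frobenius : ∀ {l} (v : Vec Carrier l) x →
                      (MS.twisted (map constant v) x S.^ q) ≋ MS.twisted (map constant (map (_^ q) v)) (x S.^ q)
  twisted-frobenius []      x = S.refl
  twisted-frobenius (a ∷ v) x = S.trans (FS.frobenius-+ (constant a ⊛ x) (MS.twisted (map constant v) (x S.^ q)))
    (S.+-cong {_} {constant (a ^ q) ⊛ (x S.^ q)} {_} {MS.twisted (map constant (map (_^ q) v)) ((x S.^ q) S.^ q)}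
      (S.trans (S.^-distrib-* (constant a) x q) (S.*-congʳ {x S.^ q} (S.sym (constant.^-homo a q))))
      (twisted-frobenius v (x S.^ q)))

  -- The exponent is qˢ, given as a successor so that it is visibly positive and one factor
  -- `qSeries v 1` can be split off the power.
  qSeries-frobenius : ∀ s {l} (v : Vec Carrier l) → ∃[ n ] (qSeries v 1 S.^ suc n) ≋ qSeries (map (iterate s) v) (suc n)
  qSeries-frobenius zero    v = 0 , S.trans (S.*-identityʳ (qSeries v 1))
    (S.reflexive (≡.cong (λ v → qSeries v 1) (≡.sym (map-id v))))
  qSeries-frobenius (suc s) v with qSeries-frobenius s v | nontrivial k
  ... | n , eq | r , q≡ = suc r ℕ.+ n ℕ.* q , (let Q = qSeries v 1 ; v′ = map (iterate s) v in
    S.trans (S.reflexive (≡.cong (Q S.^_) (≡.sym (eq′ n r q≡))))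
        (S.trans (S.sym (S.^-assocʳ Q (suc n) q)) (S.trans (S.^-congˡ q eq)
      (S.trans (twisted-frobenius v′ (T S.^ suc n))
          (S.trans (MS.twisted-cong (map constant (map (_^ q) v′)) (S.^-assocʳ T (suc n) q))
        (S.reflexive (≡.cong₂ qSeries (≡.sym (map-∘ (_^ q) (iterate s) v)) (eq′ n r q≡))))))))
    where
    eq′ : ∀ n r → q ≡ suc (suc r) → suc n ℕ.* q ≡ suc (suc r ℕ.+ n ℕ.* q)
    eq′ n r ≡.refl = ≡.refl

  module _ {l : ℕ} (p p′ : Vec Carrier l) (g : Series) (eq : (g ⊛ qSeries p 1) ≋ qSeries p′ 1) where

    private
      1*q^l : 1 ℕ.* q ℕ.^ l ≡ q ℕ.^ l
      1*q^l = ℕ.*-identityˡ _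

      zero+ : ∀ {x y} → x ≈ 0# → y ≈ 0# → x + y ≈ 0#
      zero+ p r = trans (+-cong p r) (+-identityˡ 0#)

      higher-zero : ∀ {j m} (v : Vec Carrier m) → (∀ i → j ℕ.< i → g i ≈ 0#) → All (λ a → ∀ i → j ℕ.< i → a * g i ≈ 0#) v
      higher-zero []      z = []
      higher-zero (a ∷ v) z = (λ i j<i → trans (*-congˡ (z i j<i)) (zeroʳ a)) ∷ higher-zero v z

    -- Both q-polynomials are monic of degree q^l, so their coefficients there show that the
    -- constant quotient is 1.
    quotient-constant⇒head≈ : (∀ j → 1 ℕ.≤ j → g j ≈ 0#) → qSeries p 1 1 ≈ qSeries p′ 1 1
    quotient-constant⇒head≈ g≈0 = begin
      qSeries p 1 1           ≈⟨ S.*-identityˡ (qSeries p 1) 1 ⟨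
      (S.1# ⊛ qSeries p 1) 1  ≈⟨ S.*-congʳ {qSeries p 1} {S.1#} {g} (λ { zero → sym g₀≈1 ; (suc j) → sym (g≈0 (suc j) (s≤s z≤n)) }) 1 ⟩
      (g ⊛ qSeries p 1) 1     ≈⟨ eq 1 ⟩
      qSeries p′ 1 1          ∎
      where
      top : ∀ (h : Series) (v : Vec Carrier l) → (∀ i → 0 ℕ.< i → h i ≈ 0#) → (h ⊛ qSeries v 1) (1 ℕ.* q ℕ.^ l) ≈ h 0
      top h v h≈0 with ⊛-qSeries-top {P = _≈ 0#} refl zero+ h 0 v 1 (s≤s z≤n) (higher v)
        where
        higher : ∀ {m} (v : Vec Carrier m) → All (λ a → ∀ i → 0 ℕ.< i → a * h i ≈ 0#) v
        higher []      = []
        higher (a ∷ v) = (λ i 0<i → trans (*-congˡ (h≈0 i 0<i)) (zeroʳ a)) ∷ higher v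
      ... | r , r≈0 , eq = trans eq (trans (+-congˡ r≈0) (+-identityʳ _))
      g₀≈1 : g 0 ≈ 1#
      g₀≈1 = trans (sym (top g p g≈0)) (trans (eq _) (trans (sym (S.*-identityˡ (qSeries p′ 1) _))
        (top S.1# p′ λ { (suc i) _ → refl })))

    -- Descending induction from N. Since p is monic, the product has at j + q^l the coefficient g j
    -- plus multiples of higher coefficients of g, which vanish already, whereas the right side has
    -- degree at most q^l.
    polynomial-quotient-constant : ∀ N → (∀ j → N ℕ.≤ j → g j ≈ 0#) → ∀ j → 1 ℕ.≤ j → g j ≈ 0#
    polynomial-quotient-constant N g≤N j 1≤j = descend N j 1≤j (ℕ.m≤m+n N j)
      where
      descend : ∀ n j → 1 ℕ.≤ j → N ℕ.≤ n ℕ.+ j → g j ≈ 0#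
      descend zero    j 1≤j N≤j = g≤N j N≤j
      descend (suc n) j 1≤j N≤  with ⊛-qSeries-top {P = _≈ 0#} refl zero+ g j p 1 (s≤s z≤n)
        (higher-zero p λ i j<i → descend n i (ℕ.≤-trans 1≤j (ℕ.<⇒≤ j<i))
          (ℕ.≤-trans N≤ (ℕ.≤-trans (ℕ.≤-reflexive (≡.sym (ℕ.+-suc n j))) (ℕ.+-monoʳ-≤ n j<i))))
      ... | r , r≈0 , top = begin
        g j                                       ≈⟨ +-identityʳ _ ⟨
        g j + 0#                                  ≈⟨ +-congˡ r≈0 ⟨
        g j + r                                   ≈⟨ top ⟨
        (g ⊛ qSeries p 1) (j ℕ.+ 1 ℕ.* q ℕ.^ l)   ≈⟨ eq _ ⟩
        qSeries p′ 1 (j ℕ.+ 1 ℕ.* q ℕ.^ l)        ≈⟨ qSeries-degree p′ 1 _ (ℕ.+-monoˡ-≤ (1 ℕ.* q ℕ.^ l) 1≤j) ⟩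
        0#                                        ∎

    -- Replacing the divisor by its power of exponent qˢ raises its coefficients
    -- to that power, which brings them into the ideal 𝔪.
    separated-quotient-constant : (F : ℕ → Carrier → Set e) → (∀ x → F 0 x) → (∀ N → IsIdeal R (F N)) →
      (∀ {N a x} → F 1 a → F N x → F (suc N) (a * x)) → (∀ x → (∀ N → F N x) → x ≈ 0#) →
      ∀ s → All (F 1 ∘ iterate s) p → ∀ j → 1 ℕ.≤ j → g j ≈ 0#
    separated-quotient-constant F F₀ F-ideal F-* separated s p∈F j 1≤j = separated (g j) λ N → deep N j 1≤j
      where
      n = proj₁ (qSeries-frobenius s p)
      v = map (iterate s) p
      -- The degree of g is unknown, but g p^(n+1) = p′ pⁿ bounds the degree of this product.
      product-degree : Degree≤ (suc n ℕ.* (1 ℕ.* q ℕ.^ l)) (g ⊛ qSeries v (suc n))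
      product-degree = degree-cong
        (S.trans (S.*-congʳ {qSeries p 1 S.^ n} (S.sym eq)) (S.trans (S.*-assoc g (qSeries p 1) (qSeries p 1 S.^ n))
          (S.*-congˡ {g} (proj₂ (qSeries-frobenius s p)))))
        (degree-* (qSeries-degree p′ 1) (degree-^ (qSeries-degree p 1) n))
      -- Induction on N for all j at once: up to sign g j is a sum of higher coefficients of g,
      -- already in the N-th ideal, each multiplied by a coefficient of v, which lies in the first.
      deep : ∀ N j → 1 ℕ.≤ j → F N (g j)
      deep zero    j 1≤j = F₀ (g j)
      deep (suc N) j 1≤j with ⊛-qSeries-top {P = F (suc N)} I.0-in I.+-closed g j v (suc n) (s≤s z≤n) (higher p p∈F)
        where
        module I = IsIdeal (F-ideal (suc N))
        higher : ∀ {m} (u : Vec Carrier m) → All (F 1 ∘ iterate s) u →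
                 All (λ a → ∀ i → j ℕ.< i → F (suc N) (a * g i)) (map (iterate s) u)
        higher []      []       = []
        higher (a ∷ u) (z ∷ zs) = (λ i j<i → F-* z (deep N i (ℕ.≤-trans 1≤j (ℕ.<⇒≤ j<i)))) ∷ higher u zs
      ... | r , r∈F , top = I.resp (sym gj≈-r) (I.neg-closed r∈F)
        where
        module I = IsIdeal (F-ideal (suc N))
        gj≈-r : g j ≈ - r
        gj≈-r = begin
          g j             ≈⟨ solve 2 (λ g r → g := (g :+ r) :- r) refl (g j) r ⟩
          (g j + r) - r   ≈⟨ +-congʳ top ⟨
          (g ⊛ qSeries v (suc n)) (j ℕ.+ suc n ℕ.* q ℕ.^ l) - r
                          ≈⟨ +-congʳ (product-degree _ (ℕ.≤-trans (ℕ.≤-reflexive (≡.cong (λ i → suc (suc n ℕ.* i)) 1*q^l))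
                               (ℕ.+-monoˡ-≤ (suc n ℕ.* q ℕ.^ l) 1≤j))) ⟩
          0# - r          ≈⟨ +-identityˡ _ ⟩
          - r             ∎

-- The morphisms μₙ

module TorsionDeterminantHom {q : ℕ} (k : FiniteField q a b) (R : CommutativeRing c d)
    {κ : CommutativeRing.Carrier (FiniteField.ring k) → CommutativeRing.Carrier R}
    (κ-isHom : IsRingHom (FiniteField.ring k) R κ)
    (R′ : CommutativeRing e f)
    {κ′ : CommutativeRing.Carrier (FiniteField.ring k) → CommutativeRing.Carrier R′}
    (κ′-isHom : IsRingHom (FiniteField.ring k) R′ κ′)
    {φ : CommutativeRing.Carrier R → CommutativeRing.Carrier R′} (φ-isHom : IsRingHom R R′ φ)
    {m : ℕ} {π : CommutativeRing.Carrier R} {p : Vec (CommutativeRing.Carrier R) m}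
    {π′ : CommutativeRing.Carrier R′} {p′ : Vec (CommutativeRing.Carrier R′) m}
    (p≈p′ : Pointwise (CommutativeRing._≈_ R′) (map φ (π ∷ p)) (π′ ∷ p′)) where
  private
    module D = TorsionDeterminant k R κ-isHom π p
    module D′ = TorsionDeterminant k R′ κ′-isHom π′ p′
    module F = FqAlgebra k R κ-isHom
    module F′ = FqAlgebra k R′ κ′-isHom
  open RingLemmas R′
  open QPolynomials k R′ κ′-isHom using (twisted-cong-coefficients)
  open QPolynomialsHom k R κ-isHom R′ κ′-isHom φ-isHom using (twisted-homo)
  open HomLemmas R R′ φ-isHom using (^-homo)

  [π^]-homo : ∀ n x → φ (D.[π^_] n x) ≈ D′.[π^_] n (φ x)
  [π^]-homo zero    x = refl
  [π^]-homo (suc n) x = trans ([π^]-homo n (D.[π] x))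
    (D′.[π^]-cong n (trans (twisted-homo (π ∷ p) x) (twisted-cong-coefficients p≈p′ (φ x))))

  μ-homo : ∀ s (x : Vector _ (suc m)) → φ (D.μ s x) ≈ D′.μ s (φ ∘ x)
  μ-homo s x = trans (moore-homo (D.expansion ∘ x) s)
    (Moore.moore-cong (PowerSeries.powerSeries R′) (SeriesHom.coefficientwise-isHom R′ R′ F′.frobenius-isHom)
      (λ i n → [π^]-homo n (x i)) s)
    where
    open MooreHom (PowerSeries.powerSeries R) (SeriesHom.coefficientwise-isHom R R F.frobenius-isHom)
                  (PowerSeries.powerSeries R′) (SeriesHom.coefficientwise-isHom R′ R′ F′.frobenius-isHom)
                  (SeriesHom.coefficientwise-isHom R R′ φ-isHom) (λ g n → ^-homo (g n) q)

multiConstant-isHom : (R : CommutativeRing a b) (m : ℕ) → IsRingHom R (multiPowerSeries R m) (multiConstant R m)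
multiConstant-isHom R zero    = id-isHom R
multiConstant-isHom R (suc m) = isRingHomomorphism (CommutativeRing.trans (multiPowerSeries R (suc m)))
  (multiConstant-isHom R m) (PowerSeries.constant-isHom (multiPowerSeries R m))

module OverAlgebra {a b c d : Level} {q : ℕ} (k : FiniteField q a b) (k̄ : AlgebraicClosure (FiniteField.ring k) c d) (m : ℕ)
                   (e f : Level) (R : Algebra (LubinTate.𝒜 k k̄ m e f) e f) where
  open LubinTate k k̄ m e f
  private
    module k = FiniteField k
    module k̄ = AlgebraicClosure k̄
    module 𝒜 = CommutativeRing 𝒜
    module A = Algebra R
  open RingLemmas A.ring
  open A using (⟦_⟧)
  private
    module ⟦⟧ = HomLemmas 𝒜 A.ring A.isHom
    module embed = HomLemmas 𝒪̂nr 𝒜 (multiConstant-isHom 𝒪̂nr m)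

  κ-isHom : IsRingHom k.ring A.ring (λ ζ → ⟦ embed (PowerSeries.constant k̄.ring (k̄.ι ζ)) ⟧)
  κ-isHom = isRingHomomorphism trans
    (isRingHomomorphism 𝒜.trans
      (isRingHomomorphism (CommutativeRing.trans 𝒪̂nr) k̄.ι-isHom (PowerSeries.constant-isHom k̄.ring))
      (multiConstant-isHom 𝒪̂nr m))
    A.isHom

  π : Carrier
  π = ⟦ embed πnr ⟧

  generators : Vec 𝒜.Carrier h
  generators = embed πnr ∷ u

  private
    κ : CommutativeRing.Carrier k.ring → Carrier
    κ ζ = ⟦ embed (PowerSeries.constant k̄.ring (k̄.ι ζ)) ⟧
    module U = Sections ℱuniv R
    module L = Sections (LT ⊗𝒜) R
    module M = Moore A.ring (FqAlgebra.frobenius-isHom k A.ring κ-isHom)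
    module Q = QPolynomials k A.ring κ-isHom
    module κ = HomLemmas k.ring A.ring κ-isHom
  open TorsionDeterminant k A.ring κ-isHom π (map ⟦_⟧ u)
  open Exterior A.ring using (sign)

  univ-[π] : ∀ x → U.[π] x ≈ [π] x
  univ-[π] = Q.sum≈twisted ⟦_⟧ generators 𝒜.1# ⟦⟧.1#-homo

  univ-[π^] : ∀ n x → U.[π^_] n x ≈ [π^ n ] x
  univ-[π^] zero    x = refl
  univ-[π^] (suc n) x = trans (univ-[π^] n (U.[π] x)) ([π^]-cong n (univ-[π] x))

  LT-[π] : ∀ x → L.[π] x ≈ [π]LT x
  LT-[π] x = +-cong (*-congˡ (*-identityʳ x)) (trans (+-identityʳ _)
    (*-cong sign-homo (^-congʳ x (ℕ.*-identityʳ q))))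
    where
    module 𝒪 = RingLemmas 𝒪̂nr
    sign-homo : ⟦ embed ((𝒪.- 𝒪.1#) 𝒪.^ m) ⟧ ≈ sign m
    sign-homo = trans (⟦⟧.⟦⟧-cong (embed.^-homo (𝒪.- 𝒪.1#) m)) (trans (⟦⟧.^-homo _ m)
      (^-congˡ m (trans (⟦⟧.⟦⟧-cong (𝒜.trans (embed.-‿homo 𝒪.1#) (𝒜.-‿cong embed.1#-homo)))
        (trans (⟦⟧.-‿homo 𝒜.1#) (-‿cong ⟦⟧.1#-homo)))))

  LT-[π^] : ∀ n x → L.[π^_] n x ≈ [π^ n ]LT x
  LT-[π^] zero    x = refl
  LT-[π^] (suc n) x = trans (LT-[π^] n (L.[π] x)) ([π^]LT-cong n (LT-[π] x))

  torsion : ∀ {n} ((x , _) : Torsion ℱuniv R n) → [π^ n ] x ≈ 0#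
  torsion {n} (x , p) = trans (sym (univ-[π^] n x)) p

  determinant : ∀ n → Vector (Torsion ℱuniv R (suc n)) h → Torsion (LT ⊗𝒜) R (suc n)
  determinant n X = μ (m ℕ.* n) (proj₁ ∘ X) ,
    trans (LT-[π^] (suc n) _) (μ-torsion {n} (proj₁ ∘ X) (λ i → torsion {suc n} (X i)))

  private
    proj₁-updateAt : ∀ {n} (X : Vector (Torsion ℱuniv R n) h) i w j →
                     proj₁ (updateAt X i (const w) j) ≡ updateAt (proj₁ ∘ X) i (const (proj₁ w)) j
    proj₁-updateAt X i w j with j Fin.≟ i
    ... | yes ≡.refl = ≡.trans (≡.cong proj₁ (updateAt-updates i X)) (≡.sym (updateAt-updates i (proj₁ ∘ X)))
    ... | no  j≢i    = ≡.trans (≡.cong proj₁ (updateAt-minimal j i X j≢i)) (≡.sym (updateAt-minimal j i (proj₁ ∘ X) j≢i))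

    at-updateAt : ∀ {n} (X : Vector (Torsion ℱuniv R (suc n)) h) i w →
                  proj₁ (determinant n (updateAt X i (const w))) ≈ μ (m ℕ.* n) (updateAt (proj₁ ∘ X) i (const (proj₁ w)))
    at-updateAt {n} X i w = μ-cong (m ℕ.* n) λ j → reflexive (proj₁-updateAt {suc n} X i w j)

  determinant-additive : ∀ n (X : Vector (Torsion ℱuniv R (suc n)) h) i (s t w : Torsion ℱuniv R (suc n)) →
    proj₁ w ≈ proj₁ s + proj₁ t →
    proj₁ (determinant n (updateAt X i (const w))) ≈
      proj₁ (determinant n (updateAt X i (const s))) + proj₁ (determinant n (updateAt X i (const t)))
  determinant-additive n X i s t w w≈s+t = trans (at-updateAt {n} X i w) (trans
    (μ-linear (m ℕ.* n) i K.1# K.1# {s = x s} {x t}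
      (trans (reflexive (updateAt-updates i (proj₁ ∘ X))) (trans w≈s+t (sym (+-cong (row s) (row t)))))
      (λ j j≢i → reflexive (≡.trans (updateAt-minimal j i (proj₁ ∘ X) j≢i) (≡.sym (updateAt-minimal j i (proj₁ ∘ X) j≢i))))
      (λ j j≢i → reflexive (≡.trans (updateAt-minimal j i (proj₁ ∘ X) j≢i) (≡.sym (updateAt-minimal j i (proj₁ ∘ X) j≢i)))))
    (+-cong (trans (one _) (sym (at-updateAt {n} X i s))) (trans (one _) (sym (at-updateAt {n} X i t)))))
    where
    module K = CommutativeRing k.ring
    x : Torsion ℱuniv R (suc n) → Vector Carrier h
    x w = updateAt (proj₁ ∘ X) i (const (proj₁ w))
    one : ∀ y → κ K.1# * y ≈ y
    one y = trans (*-congʳ κ.1#-homo) (*-identityˡ y)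
    row : ∀ s → κ K.1# * x s i ≈ proj₁ s
    row s = trans (one _) (reflexive (updateAt-updates i (proj₁ ∘ X)))

  determinant-homogeneous : ∀ n (X : Vector (Torsion ℱuniv R (suc n)) h) i (α : CommutativeRing.Carrier 𝒪F)
    (s w : Torsion ℱuniv R (suc n)) → proj₁ w ≈ (U.[_]mod-π^_ α (suc n)) (proj₁ s) →
    proj₁ (determinant n (updateAt X i (const w))) ≈
      (L.[_]mod-π^_ α (suc n)) (proj₁ (determinant n (updateAt X i (const s))))
  determinant-homogeneous n X i α s w w≈αs = trans (at-updateAt {n} X i w) (trans
    (μ-cong (m ℕ.* n) row)
    (trans (μ-homogeneous {n} (proj₁ ∘ X) i (proj₁ s) (λ j _ → torsion {suc n} (X j)) (torsion {suc n} s) α (suc n))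
      (sum-cong-≋ {suc n} λ j → *-congˡ {κ (α (toℕ j))}
          (trans ([π^]LT-cong (toℕ j) (sym (at-updateAt {n} X i s))) (sym (LT-[π^] (toℕ j) _))))))
    where
    αs = ∑[ j ≤ n ] (κ (α (toℕ j)) * [π^ toℕ j ] (proj₁ s))
    row : ∀ j → updateAt (proj₁ ∘ X) i (const (proj₁ w)) j ≈ updateAt (proj₁ ∘ X) i (const αs) j
    row j with j Fin.≟ i
    ... | yes ≡.refl = trans (reflexive (updateAt-updates i (proj₁ ∘ X))) (trans
      (trans w≈αs (sum-cong-≋ {suc n} λ j → *-congˡ {κ (α (toℕ j))} (univ-[π^] (toℕ j) (proj₁ s))))
      (sym (reflexive (updateAt-updates i (proj₁ ∘ X)))))
    ... | no  j≢i    = reflexive (≡.trans (updateAt-minimal j i (proj₁ ∘ X) j≢i) (≡.sym (updateAt-minimal j i (proj₁ ∘ X) j≢i)))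

  determinant-compatible : ∀ n (X : Vector (Torsion ℱuniv R (suc (suc n))) h) →
    proj₁ (determinant n (λ i → U.[π]ₜ (suc n) (X i))) ≈ L.[π] (proj₁ (determinant (suc n) X))
  determinant-compatible n X = trans (μ-cong (m ℕ.* n) λ i → univ-[π] (proj₁ (X i)))
    (trans (μ-compatible {n} (proj₁ ∘ X) (λ i → torsion {suc (suc n)} (X i))) (sym (LT-[π] _)))

-- Drinfeld level structures

module DrinfeldOverAlgebra {a b c d : Level} {q : ℕ} (k : FiniteField q a b)
    (k̄ : AlgebraicClosure (FiniteField.ring k) c d) (m : ℕ) (e f : Level) (R : Algebra (LubinTate.𝒜 k k̄ m e f) e f) where
  open LubinTate k k̄ m e f
  open OverAlgebra k k̄ m e f R
  private
    module k = FiniteField k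
    module k̄ = AlgebraicClosure k̄
    module 𝒜 = CommutativeRing 𝒜
    module A = Algebra R
  open RingLemmas A.ring
  open PowerSeries A.ring
  open SeriesLemmas A.ring
  open A using (⟦_⟧)
  private
    κ : CommutativeRing.Carrier k.ring → Carrier
    κ ζ = ⟦ embed (PowerSeries.constant k̄.ring (k̄.ι ζ)) ⟧
    module S = RingLemmas powerSeries
    module ⟦⟧ = HomLemmas 𝒜 A.ring A.isHom
    module M = Moore A.ring (FqAlgebra.frobenius-isHom k A.ring κ-isHom)
    module Q = QPolynomials k A.ring κ-isHom
    module κ = HomLemmas k.ring A.ring κ-isHom
  open TorsionDeterminant k A.ring κ-isHom π (map ⟦_⟧ u)
  open QSeries k A.ring κ-isHom
  open Exterior A.ring using (sign)

  module _ (G : FormalModule 𝒜) (n : ℕ) (X : Vector (Torsion G R (suc n)) (FormalModule.height G))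
           (y : Vector Carrier (FormalModule.height G)) (X≈y : ∀ i → Sections.[π^_] G R n (proj₁ (X i)) ≈ y i) where
    open FormalModule G using (height)
    private
      module G = DrinfeldLevel G R n X
      module QS = QPolynomials k powerSeries constantκ-isHom
      module constant = HomLemmas A.ring powerSeries constant-isHom

    monomial-sum : ∀ n ζ (t : ℕ → Carrier) → ∑[ j ≤ n ] (κ (PowerSeries.monomial k.ring n ζ (toℕ j)) * t (toℕ j)) ≈ κ ζ * t n
    monomial-sum zero    ζ t = +-identityʳ _
    monomial-sum (suc n) ζ t = trans (+-cong (trans (*-congʳ κ.0#-homo) (zeroˡ _)) (monomial-sum n ζ (t ∘ suc)))
        (+-identityˡ _)

    -- The representative ζπⁿ of π⁻¹ζ has a single nonzero coefficient, so the divisor sees the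
    -- sections only through their images under [πⁿ].
    φ≈combination : ∀ (i : Vector (Fin q) height) → G.φ (G.π⁻¹ (Inverse.to k.elements ∘ i)) ≈ Q.combination y i
    φ≈combination i = sum-cong-≋ {height} λ l →
      trans (monomial-sum n (Inverse.to k.elements (i l)) (λ j → Sections.[π^_] G R j (proj₁ (X l)))) (*-congˡ (X≈y l))

    -- The product formula is applied in R[[T]] to the constants yᵢ at the point T, and the
    -- coefficients are then brought back to R. The formal module is arbitrary, so that this serves
    -- both ℱuniv with h sections and LT with one.
    divisor≈qSeries : G.divisor ≋ qSeries (Q.annihilator y) 1
    divisor≈qSeries = S.trans {j = S.prod-syntax (q ℕ.^ height) λ t → T S.- QS.combination (constant ∘ y) (finToFun t)}
      (S.∏.sum-cong-≋ {q ℕ.^ height} λ t → S.+-congˡ {T}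
          (S.-‿cong {constant (G.φ (G.π⁻¹ (Inverse.to k.elements ∘ finToFun t)))}
        {QS.combination (constant ∘ y) (finToFun t)} (S.trans (constant.⟦⟧-cong (φ≈combination (finToFun t)))
          (S.trans (constant.sum-homo (λ j → κ (Inverse.to k.elements (finToFun t j)) * y j))
            (S.sum-cong-≋ {height} λ j → constant.*-homo (κ (Inverse.to k.elements (finToFun t j))) (y j))))))
      (S.trans (QS.annihilator-product (constant ∘ y) T) (S.trans
        (S.sym (QS.twisted-cong-coefficients (QPolynomialsHom.annihilator-homo k A.ring κ-isHom powerSeries
            constantκ-isHom constant-isHom y) T))
        (MS.twisted-cong (map constant (Q.annihilator y)) (S.sym (S.*-identityʳ T)))))

  univ-[π]T : Sections.[π] ℱuniv (R [[T]]) T ≋ qSeries (map ⟦_⟧ generators) 1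
  univ-[π]T = S.trans
    (QPolynomials.sum≈twisted k powerSeries constantκ-isHom (constant ∘ ⟦_⟧) generators 𝒜.1#
      (HomLemmas.⟦⟧-cong A.ring powerSeries constant-isHom ⟦⟧.1#-homo) T)
    (S.trans (S.reflexive (≡.cong (λ v → MS.twisted v T) (map-∘ constant ⟦_⟧ generators)))
      (MS.twisted-cong (map constant (map ⟦_⟧ generators)) (S.sym (S.*-identityʳ T))))

  private
    γ : Fin h → Carrier
    γ i = ⟦ lookup generators i ⟧

    𝔪 : ℕ → Carrier → Set (e ⊔ f)
    𝔪 N x = _∈𝔪^_ R x N

    𝔪-resp : ∀ N {x x′} → x ≈ x′ → 𝔪 N x → 𝔪 N x′
    𝔪-resp zero    eq x∈𝔪             = tt
    𝔪-resp (suc N) eq (t , t∈𝔪 , x≈) = t , t∈𝔪 , trans (sym eq) x≈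

    𝔪-0 : ∀ N → 𝔪 N 0#
    𝔪-0 zero    = tt
    𝔪-0 (suc N) = (λ _ → 0#) , (λ _ → 𝔪-0 N) , sym (sum-zero {h} (λ i → γ i * 0#) λ i → zeroʳ (γ i))

    𝔪-+ : ∀ N {x x′} → 𝔪 N x → 𝔪 N x′ → 𝔪 N (x + x′)
    𝔪-+ zero    _              _                 = tt
    𝔪-+ (suc N) (t , t∈𝔪 , x≈) (t′ , t′∈𝔪 , x′≈) = (λ i → t i + t′ i) , (λ i → 𝔪-+ N (t∈𝔪 i) (t′∈𝔪 i)) ,
      trans (+-cong x≈ x′≈) (trans (sym (∑-distrib-+ {h} (λ i → γ i * t i) (λ i → γ i * t′ i)))
          (sum-cong-≋ {h} λ i → sym (distribˡ (γ i) (t i) (t′ i))))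

    𝔪-* : ∀ N r {x} → 𝔪 N x → 𝔪 N (r * x)
    𝔪-* zero    r _              = tt
    𝔪-* (suc N) r (t , t∈𝔪 , x≈) = (λ i → r * t i) , (λ i → 𝔪-* N r (t∈𝔪 i)) ,
      trans (*-congˡ x≈) (trans (*-distribˡ-sum {h} r (λ i → γ i * t i))
        (sum-cong-≋ {h} λ i → solve 3 (λ r g t → r :* (g :* t) := g :* (r :* t)) refl r (γ i) (t i)))

    𝔪-isIdeal : ∀ N → IsIdeal A.ring (𝔪 N)
    𝔪-isIdeal N = record { resp = 𝔪-resp N ; 0-in = 𝔪-0 N ; +-closed = 𝔪-+ N ; *-closed = 𝔪-* N }

    𝔪-product : ∀ {N r x} → 𝔪 1 r → 𝔪 N x → 𝔪 (suc N) (r * x)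
    𝔪-product {N} {r} {x} (t , _ , r≈) x∈𝔪 = (λ i → x * t i) , (λ i → IsIdeal.*-closedʳ (𝔪-isIdeal N) (t i) x∈𝔪) ,
      trans (*-comm r x) (trans (*-congˡ r≈) (trans (*-distribˡ-sum {h} x (λ i → γ i * t i))
        (sum-cong-≋ {h} λ i → solve 3 (λ r g t → r :* (g :* t) := g :* (r :* t)) refl x (γ i) (t i))))

    -- The preimage of 𝔪R under the h-th iterate of Frobenius. It contains every section killed by
    -- [π], and being an ideal it then contains the lower coefficients of their annihilator.
    iterate∈𝔪-isIdeal : IsIdeal A.ring (𝔪 1 ∘ M.iterate h)
    iterate∈𝔪-isIdeal = record
      { resp     = λ eq → 𝔪-resp 1 (M.iterate-cong h eq)
      ; 0-in     = 𝔪-resp 1 (sym iterate-0) (𝔪-0 1)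
      ; +-closed = λ {x} {x′} p r → 𝔪-resp 1 (sym (iterate-+ h x x′)) (𝔪-+ 1 p r)
      ; *-closed = λ r {x} p → 𝔪-resp 1 (sym (iterate-* h r x)) (𝔪-* 1 (M.iterate h r) p)
      }
      where
      iterate-0 : M.iterate h 0# ≈ 0#
      iterate-0 = begin
        M.iterate h 0#
          ≈⟨ solve 1 (λ u → u := (u :+ u) :- u) refl (M.iterate h 0#) ⟩
        (M.iterate h 0# + M.iterate h 0#) - M.iterate h 0#
          ≈⟨ +-congʳ (trans (sym (iterate-+ h 0# 0#)) (M.iterate-cong h (+-identityˡ 0#))) ⟩
        M.iterate h 0# - M.iterate h 0#
          ≈⟨ -‿inverseʳ _ ⟩
        0# ∎

    -- [π] reduces to the h-th iterate of Frobenius modulo 𝔪.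
    [π]-torsion∈𝔪 : ∀ x → [π] x ≈ 0# → 𝔪 1 (M.iterate h x)
    [π]-torsion∈𝔪 x [π]x≈0 = (λ i → - M.iterate (toℕ i) x) , (λ _ → tt) , (begin
      M.iterate h x
        ≈⟨ solve 2 (λ s t → t := (s :+ t) :- s) refl (∑[ i < h ] (γ i * M.iterate (toℕ i) x)) _ ⟩
      _ ≈⟨ +-congʳ (trans (sym (twisted≈sum ⟦_⟧ generators x)) [π]x≈0) ⟩
      0# - ∑[ i < h ] (γ i * M.iterate (toℕ i) x)
        ≈⟨ solve 1 (λ s → :0 :- s := (:- :1) :* s) refl _ ⟩
      (- 1#) * (∑[ i < h ] (γ i * M.iterate (toℕ i) x))
        ≈⟨ *-distribˡ-sum {h} (- 1#) (λ i → γ i * M.iterate (toℕ i) x) ⟩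
      ∑[ i < h ] ((- 1#) * (γ i * M.iterate (toℕ i) x))
        ≈⟨ sum-cong-≋ {h} (λ i → solve 2 (λ g t → (:- :1) :* (g :* t) := g :* (:- t)) refl (γ i) (M.iterate (toℕ i) x)) ⟩
      ∑[ i < h ] (γ i * (- M.iterate (toℕ i) x)) ∎)

  module _ (n : ℕ) (X : Vector (Torsion ℱuniv R (suc n)) h) where
    private
      module X = DrinfeldLevel ℱuniv R n X
      module Y = DrinfeldLevel (LT ⊗𝒜) R n (λ _ → determinant n X)
      y : Vector Carrier h
      y i = [π^ n ] (proj₁ (X i))
      z = M.moore y
      p = Q.annihilator y
      p′ = map ⟦_⟧ generators

    univ-divides : ∀ {g} → (g ⊛ X.divisor) ≋ X.[π]T → (g ⊛ qSeries p 1) ≋ qSeries p′ 1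
    univ-divides {g} eq = S.trans (S.*-congˡ {g} (S.sym (divisor≈qSeries ℱuniv n X y (λ i → univ-[π^] n (proj₁ (X i))))))
      (S.trans eq univ-[π]T)

    LT-divides : qSeries p 1 1 ≈ qSeries p′ 1 1 → (constant (sign m) ⊛ Y.divisor) ≋ Y.[π]T
    LT-divides eq = S.trans (S.*-congˡ {constant (sign m)} (divisor≈qSeries (LT ⊗𝒜) n (λ _ → determinant n X) (λ _ → z)
        (λ _ → trans (LT-[π^] n _) ([π^n]LT-μ n (proj₁ ∘ X) (λ i → torsion {suc n} (X i))))))
      (S.trans product (S.sym LT-[π]T))
      where
      w = z ^ ℕ.pred q
      module constant = HomLemmas A.ring powerSeries constant-isHom
      π≈ : π ≈ sign m * (- w)
      π≈ = begin
        π                    ≈⟨ qSeries-linear p′ ⟨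
        qSeries p′ 1 1       ≈⟨ eq ⟨
        qSeries p 1 1        ≈⟨ qSeries-linear p ⟩
        head p               ≈⟨ Q.head-annihilator y ⟩
        ((- 1#) * sign m) * w ≈⟨ solve 2 (λ s w → ((:- :1) :* s) :* w := s :* (:- w)) refl (sign m) w ⟩
        sign m * (- w)       ∎
      -- The annihilator of the single section z reduces to `(- w) ∷ []`, that is T^q - wT with w =
      -- z^(q-1).
      product : (constant (sign m) ⊛ qSeries ((- w) ∷ []) 1) ≋ (constant π ⊛ T S.+ constant (sign m) ⊛ (T S.^ q))
      product = S.trans (S.*-congˡ {constant (sign m)} {_} {constant (- w) ⊛ T S.+ (T S.^ q)}
          (S.+-cong (S.*-congˡ {constant (- w)} (S.*-identityʳ T)) (S.^-congˡ q (S.*-identityʳ T))))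
        (S.trans (S.distribˡ (constant (sign m)) (constant (- w) ⊛ T) (T S.^ q))
          (S.+-congʳ {constant (sign m) ⊛ (T S.^ q)} (S.trans (S.sym (S.*-assoc (constant (sign m)) (constant (- w)) T))
            (S.*-congʳ {T} (S.trans (S.sym (constant.*-homo (sign m) (- w))) (constant.⟦⟧-cong (sym π≈)))))))
      LT-[π]T : Y.[π]T ≋ (constant π ⊛ T S.+ constant (sign m) ⊛ (T S.^ q))
      LT-[π]T = S.trans (OverAlgebra.LT-[π] k k̄ m e f (R [[T]]) T)
        (S.+-congˡ {constant π ⊛ T} (S.*-congʳ {T S.^ q} (S.sym (constant-sign m))))

    preservesDrinfeld : 𝔪-Separated R → IsDrinfeld ℱuniv R n X → IsDrinfeld (LT ⊗𝒜) R n (λ _ → determinant n X)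
    preservesDrinfeld separated (g , eq) = constant (sign m) , LT-divides
      (quotient-constant⇒head≈ p p′ g (univ-divides {g} eq) (separated-quotient-constant p p′ g (univ-divides {g} eq)
        𝔪 (λ _ → tt) 𝔪-isIdeal (λ {N} {r} {x} → 𝔪-product {N} {r} {x}) separated h
        (Q.annihilator-closed iterate∈𝔪-isIdeal y λ i → [π]-torsion∈𝔪 (y i)
          (trans (sym (reflexive ([π^]-suc n (proj₁ (X i))))) (torsion {suc n} (X i))))))

    preservesDrinfeldPolynomial : IsDrinfeldPolynomial ℱuniv R n X →
                                  IsDrinfeldPolynomial (LT ⊗𝒜) R n (λ _ → determinant n X)
    preservesDrinfeldPolynomial (g , (N , g≤N) , eq) = constant (sign m) , (1 , λ { (suc j) _ → refl }) , LT-divides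
      (quotient-constant⇒head≈ p p′ g (univ-divides {g} eq)
        (polynomial-quotient-constant p p′ g (univ-divides {g} eq) N g≤N))

module _ {a b c d : Level} {q : ℕ} (k : FiniteField q a b) (k̄ : AlgebraicClosure (FiniteField.ring k) c d) (m : ℕ)
    (e f : Level) where
  open LubinTate k k̄ m e f
  private module Over = OverAlgebra k k̄ m e f

  determinantMorphism : ∀ n → Morphism (suc n)
  determinantMorphism n = record
    { at      = λ R → Over.determinant R n
    ; natural = λ {R} {S} φ X Y φX≈Y → CommutativeRing.trans (Algebra.ring S)
        (TorsionDeterminantHom.μ-homo k (Algebra.ring R) (Over.κ-isHom R) (Algebra.ring S) (Over.κ-isHom S)
            (AlgebraHom.isHom φ)
          (coefficients {R} {S} φ (Over.generators R)) (m ℕ.* n) (proj₁ ∘ X))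
        (TorsionDeterminant.μ-cong k (Algebra.ring S) (Over.κ-isHom S) _ _ (m ℕ.* n) φX≈Y)
    }
    where
    coefficients : ∀ {R S} (φ : AlgebraHom R S) {l} (v : Vec _ l) → Pointwise (Algebra._≈_ S)
      (map (AlgebraHom.to φ) (map (Algebra.⟦_⟧ R) v)) (map (Algebra.⟦_⟧ S) v)
    coefficients φ []      = []
    coefficients φ (x ∷ v) = AlgebraHom.commutes φ x ∷ coefficients φ v

theorem3p2 : ∀ {a b c d : Level} (e f : Level) {q : ℕ} (k : FiniteField q a b)
    (k̄ : AlgebraicClosure (FiniteField.ring k) c d) (m : ℕ) →
    Σ[ μ ∈ (∀ n → LubinTate.Morphism k k̄ m e f (suc n)) ]
    (∀ n → LubinTate.IsMultilinear k k̄ m e f (μ n))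
    × (∀ n → LubinTate.IsAlternating k k̄ m e f (μ n))
    × (∀ n → LubinTate.IsCompatible k k̄ m e f (μ n) (μ (suc n)))
    × (∀ n → LubinTate.PreservesDrinfeld k k̄ m e f (μ n))
    × (∀ n → LubinTate.PreservesDrinfeldPolynomial k k̄ m e f (μ n))
theorem3p2 e f k k̄ m =
    determinantMorphism k k̄ m e f
  , (λ n → record { additive = λ R → Over.determinant-additive R n ; homogeneous = λ R → Over.determinant-homogeneous R n })
  , (λ n R X i j i≢j → TorsionDeterminant.μ-alternating k (Algebra.ring R) (Over.κ-isHom R) _ _ (m ℕ.* n) (proj₁ ∘ X) i≢j)
  , (λ n R X → Over.determinant-compatible R n X)
  , (λ n R separated X → Drinfeld.preservesDrinfeld R n X separated)
  , (λ n R X → Drinfeld.preservesDrinfeldPolynomial R n X)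
  where
  module Over = OverAlgebra k k̄ m e f
  module Drinfeld = DrinfeldOverAlgebra k k̄ m e f
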